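{- Let $n\ge1$, let $f\colon\{0,1\}^n\to\{ -1,+1\}$ be given, and let $d=\deg(f)$. Put $F_1=[f(x\wedge y)]_{x,y}$ and $F_2=[f(x\vee y)]_{x,y}$, where the row index $x$ and the column index $y$ range over $\{0,1\}^n$. Then $$\max\{\operatorname{rk}F_1,\ \operatorname{rk}F_2\}\;\ge\;\left(\frac{3}{2\sqrt2}\right)^d\;\ge\;1.06^d.$$ In particular, the communication problem $F$ of computing, on input $x,y\in\{0,1\}^n$, both of the quantities $f(x\wedge y)$ and $f(x\vee y)$ satisfies the log-rank conjecture, i.e. $D(F)\le(\log_2\operatorname{rk}F)^c+c$ for some absolute constant $c>0$ (independent of $n$ and $f$).
   Context: The operations $x\wedge y$, $x\vee y$ are bitwise AND and OR. The rank $\operatorname{rk}$ is over the reals. Degree: every function $f\colon\{0,1\}^n\to\mathbb{R}$ has a unique representation $f(x)=\sum_{S\subseteq\{1,\dots,n\}}\alpha_S\prod_{i\in S}x_i$ with real $\alpha_S$; $\deg(f)=\max\{|S|:\alpha_S\ne0\}$. The communication problem $F$ is expressed formally as a two-party function by introducing an additional input bit $b\in\{0,1\}$ indicating the desired output: $F((x,b),y)=f(x\wedge y)$ if $b=0$ and $F((x,b),y)=f(x\vee y)$ if $b=1$, where Alice holds $(x,b)$ and Bob holds $y$; $\operatorname{rk}F$ is the rank of the corresponding $\pm1$ matrix. $D(F)$ is the deterministic two-party communication complexity (least worst-case number of bits exchanged by a deterministic protocol computing $F$). -}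

module Defs where

open import Algebra.Bundles.Raw using (RawRing)
open import Data.Bool using (Bool; true; false; _∧_; _∨_; if_then_else_)
open import Data.Fin using (Fin)
open import Data.Fin.Subset using (Subset; inside; outside; ∣_∣)
open import Data.Integer as ℤ using (+_)
import Data.Integer.Properties as ℤP
open import Data.Nat as ℕ using (ℕ; zero; suc)
import Data.Nat.Properties as ℕP
open import Data.Nat.Induction using (<-rec)
open import Data.Nat.Logarithm
  using (⌊log₂_⌋; ⌊log₂⌋-mono-≤; ⌊log₂⌊n/2⌋⌋≡⌊log₂n⌋∸1; ⌊log₂[2^n]⌋≡n)
open import Data.Nat.Tactic.RingSolver using (solve-∀)
open import Data.Product using (∃; _×_; _,_; proj₁; proj₂)
open import Data.Rational as ℚ using (ℚ; 0ℚ; 1ℚ)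
import Data.Rational.Properties as ℚP
import Data.Rational.Unnormalised as ℚᵘ
import Data.Rational.Unnormalised.Properties as ℚᵘP
open import Data.Rational.Solver using (module +-*-Solver)
open import Data.Sign using (Sign)
open import Data.Sum using (inj₁; inj₂)
open import Data.Vec using (Vec; []; _∷_; zipWith; lookup)
open import Level using (0ℓ)
open import Relation.Nullary using (yes; no; contradiction)
open import Relation.Binary.PropositionalEquality
  using (_≡_; _≢_; refl; sym; trans; cong; cong₂; subst; subst₂)

-- Real numbers are Cauchy sequences of rationals, compared with the
-- setoid equality _≈_.  Convergence proofs are abstract so that they are
-- never normalised.

Eventually : (ℕ → Set) → Set
Eventually P = ∃ λ N → ∀ n → N ℕ.≤ n → P n

IsCauchy : (ℕ → ℚ) → Set
IsCauchy s = ∀ ε → 0ℚ ℚ.< ε →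
  ∃ λ N → ∀ m n → N ℕ.≤ m → N ℕ.≤ n → ℚ.∣ s m ℚ.- s n ∣ ℚ.≤ ε

record ℝ : Set where
  constructor mkℝ
  field
    seq    : ℕ → ℚ
    cauchy : IsCauchy seq

open ℝ public

infix 4 _≈_ _≤_ _≥_ _<_

_≈_ : ℝ → ℝ → Set
x ≈ y = ∀ ε → 0ℚ ℚ.< ε → Eventually λ n → ℚ.∣ seq x n ℚ.- seq y n ∣ ℚ.≤ ε

_≤_ : ℝ → ℝ → Set
x ≤ y = ∀ ε → 0ℚ ℚ.< ε → Eventually λ n → seq x n ℚ.≤ seq y n ℚ.+ ε

_≥_ : ℝ → ℝ → Set
x ≥ y = y ≤ x

_<_ : ℝ → ℝ → Set
x < y = ∃ λ δ → (0ℚ ℚ.< δ) × Eventually λ n → seq x n ℚ.+ δ ℚ.≤ seq y n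

module CauchyLemmas where
  open ℚP.≤-Reasoning

  p≤∣p∣ : ∀ p → p ℚ.≤ ℚ.∣ p ∣
  p≤∣p∣ p with ℚP.∣p∣≡p∨∣p∣≡-p p
  ... | inj₁ e = ℚP.≤-reflexive (sym e)
  ... | inj₂ e = begin
    p           ≡⟨ solve 1 (λ a → a := :- (:- a)) refl p ⟩
    ℚ.- (ℚ.- p) ≡⟨ cong ℚ.-_ (sym e) ⟩
    ℚ.- ℚ.∣ p ∣ ≤⟨ ℚP.neg-antimono-≤ (ℚP.0≤∣p∣ p) ⟩
    0ℚ          ≤⟨ ℚP.0≤∣p∣ p ⟩
    ℚ.∣ p ∣     ∎
    where open +-*-Solver

  ∣-∣-comm : ∀ p q → ℚ.∣ p ℚ.- q ∣ ≡ ℚ.∣ q ℚ.- p ∣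
  ∣-∣-comm p q = trans (cong ℚ.∣_∣ (solve 2 (λ a b → a :- b := :- (b :- a)) refl p q))
                       (ℚP.∣-p∣≡∣p∣ (q ℚ.- p))
    where open +-*-Solver

  ∣-∣-bound : ∀ {p q ε} → p ℚ.≤ q ℚ.+ ε → q ℚ.≤ p ℚ.+ ε → ℚ.∣ p ℚ.- q ∣ ℚ.≤ ε
  ∣-∣-bound {p} {q} {ε} a b with ℚP.∣p∣≡p∨∣p∣≡-p (p ℚ.- q)
  ... | inj₁ e = begin
    ℚ.∣ p ℚ.- q ∣     ≡⟨ e ⟩
    p ℚ.- q           ≤⟨ ℚP.+-monoˡ-≤ (ℚ.- q) a ⟩
    q ℚ.+ ε ℚ.- q     ≡⟨ solve 2 (λ x y → x :+ y :- x := y) refl q ε ⟩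
    ε                 ∎
    where open +-*-Solver
  ... | inj₂ e = begin
    ℚ.∣ p ℚ.- q ∣     ≡⟨ e ⟩
    ℚ.- (p ℚ.- q)     ≡⟨ solve 2 (λ x y → :- (x :- y) := y :- x) refl p q ⟩
    q ℚ.- p           ≤⟨ ℚP.+-monoˡ-≤ (ℚ.- p) b ⟩
    p ℚ.+ ε ℚ.- p     ≡⟨ solve 2 (λ x y → x :+ y :- x := y) refl p ε ⟩
    ε                 ∎
    where open +-*-Solver

  ∣-∣-bound⁻ : ∀ {p q ε} → ℚ.∣ p ℚ.- q ∣ ℚ.≤ ε → p ℚ.≤ q ℚ.+ ε
  ∣-∣-bound⁻ {p} {q} {ε} a = begin
    p                       ≡⟨ solve 2 (λ x y → x := y :+ (x :- y)) refl p q ⟩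
    q ℚ.+ (p ℚ.- q)         ≤⟨ ℚP.+-monoʳ-≤ q (p≤∣p∣ (p ℚ.- q)) ⟩
    q ℚ.+ ℚ.∣ p ℚ.- q ∣     ≤⟨ ℚP.+-monoʳ-≤ q a ⟩
    q ℚ.+ ε                 ∎
    where open +-*-Solver

  0<p*q : ∀ {p q} → 0ℚ ℚ.< p → 0ℚ ℚ.< q → 0ℚ ℚ.< p ℚ.* q
  0<p*q {p} {q} a b = begin-strict
    0ℚ          ≡⟨ sym (ℚP.*-zeroʳ p) ⟩
    p ℚ.* 0ℚ    <⟨ ℚP.*-monoʳ-<-pos p {{ℚ.positive a}} b ⟩
    p ℚ.* q     ∎

  *-mono-≤ : ∀ {p q r s} → 0ℚ ℚ.≤ r → 0ℚ ℚ.≤ q → p ℚ.≤ q → r ℚ.≤ s → p ℚ.* r ℚ.≤ q ℚ.* s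
  *-mono-≤ {p} {q} {r} {s} 0≤r 0≤q a b = begin
    p ℚ.* r ≤⟨ ℚP.*-monoʳ-≤-nonNeg r {{ℚ.nonNegative 0≤r}} a ⟩
    q ℚ.* r ≤⟨ ℚP.*-monoˡ-≤-nonNeg q {{ℚ.nonNegative 0≤q}} b ⟩
    q ℚ.* s ∎

  0<½ : 0ℚ ℚ.< ℚ.½
  0<½ = ℚP.positive⁻¹ ℚ.½

  0<1 : 0ℚ ℚ.< 1ℚ
  0<1 = ℚP.positive⁻¹ 1ℚ

  halves : ∀ ε → ε ℚ.* ℚ.½ ℚ.+ ε ℚ.* ℚ.½ ≡ ε
  halves ε = trans (sym (ℚP.*-distribˡ-+ ε ℚ.½ ℚ.½)) (ℚP.*-identityʳ ε)

  abstract
    const-cauchy : ∀ q → IsCauchy (λ _ → q)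
    const-cauchy q ε 0<ε = 0 , λ _ _ _ _ → begin
      ℚ.∣ q ℚ.- q ∣ ≡⟨ cong ℚ.∣_∣ (ℚP.+-inverseʳ q) ⟩
      0ℚ            ≤⟨ ℚP.<⇒≤ 0<ε ⟩
      ε             ∎

  abstract
    +-cauchy : ∀ {s t} → IsCauchy s → IsCauchy t → IsCauchy (λ n → s n ℚ.+ t n)
    +-cauchy {s} {t} cs ct ε 0<ε with cs (ε ℚ.* ℚ.½) (0<p*q 0<ε 0<½) | ct (ε ℚ.* ℚ.½) (0<p*q 0<ε 0<½)
    ... | M , f | N , g = M ℕ.⊔ N , λ m n p q → begin
      ℚ.∣ (s m ℚ.+ t m) ℚ.- (s n ℚ.+ t n) ∣
        ≡⟨ cong ℚ.∣_∣ (solve 4 (λ a b c d → (a :+ b) :- (c :+ d) := (a :- c) :+ (b :- d)) refl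
                          (s m) (t m) (s n) (t n)) ⟩
      ℚ.∣ (s m ℚ.- s n) ℚ.+ (t m ℚ.- t n) ∣
        ≤⟨ ℚP.∣p+q∣≤∣p∣+∣q∣ (s m ℚ.- s n) (t m ℚ.- t n) ⟩
      ℚ.∣ s m ℚ.- s n ∣ ℚ.+ ℚ.∣ t m ℚ.- t n ∣
        ≤⟨ ℚP.+-mono-≤ (f m n (ℕP.m⊔n≤o⇒m≤o M N p) (ℕP.m⊔n≤o⇒m≤o M N q))
                       (g m n (ℕP.m⊔n≤o⇒n≤o M N p) (ℕP.m⊔n≤o⇒n≤o M N q)) ⟩
      ε ℚ.* ℚ.½ ℚ.+ ε ℚ.* ℚ.½ ≡⟨ halves ε ⟩
      ε ∎
      where open +-*-Solver

  abstract
    neg-cauchy : ∀ {s} → IsCauchy s → IsCauchy (λ n → ℚ.- s n)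
    neg-cauchy {s} cs ε 0<ε with cs ε 0<ε
    ... | N , f = N , λ m n p q → begin
      ℚ.∣ ℚ.- s m ℚ.- (ℚ.- s n) ∣
        ≡⟨ cong ℚ.∣_∣ (solve 2 (λ a b → (:- a) :- (:- b) := b :- a) refl (s m) (s n)) ⟩
      ℚ.∣ s n ℚ.- s m ∣ ≤⟨ f n m q p ⟩
      ε ∎
      where open +-*-Solver

  cauchy-bounded : ∀ {s} → IsCauchy s →
    ∃ λ B → (0ℚ ℚ.< B) × Eventually λ n → ℚ.∣ s n ∣ ℚ.≤ B
  cauchy-bounded {s} cs with cs 1ℚ 0<1
  ... | N , f = 1ℚ ℚ.+ ℚ.∣ s N ∣
              , ℚP.+-mono-<-≤ {0ℚ} {1ℚ} {0ℚ} {ℚ.∣ s N ∣} 0<1 (ℚP.0≤∣p∣ (s N))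
              , N , λ n p → begin
    ℚ.∣ s n ∣ ≡⟨ cong ℚ.∣_∣ (solve 2 (λ a b → a := (a :- b) :+ b) refl (s n) (s N)) ⟩
    ℚ.∣ (s n ℚ.- s N) ℚ.+ s N ∣ ≤⟨ ℚP.∣p+q∣≤∣p∣+∣q∣ (s n ℚ.- s N) (s N) ⟩
    ℚ.∣ s n ℚ.- s N ∣ ℚ.+ ℚ.∣ s N ∣ ≤⟨ ℚP.+-monoˡ-≤ ℚ.∣ s N ∣ (f n N p ℕP.≤-refl) ⟩
    1ℚ ℚ.+ ℚ.∣ s N ∣ ∎
    where open +-*-Solver

  inv : ℚ → ℚ
  inv q with q ℚP.≟ 0ℚ
  ... | yes _  = 0ℚ
  ... | no q≢0 = ℚ.1/_ q {{ℚ.≢-nonZero q≢0}}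

  inv-inverse : ∀ q → q ≢ 0ℚ → q ℚ.* inv q ≡ 1ℚ
  inv-inverse q q≢0 with q ℚP.≟ 0ℚ
  ... | yes e = contradiction e q≢0
  ... | no q≢0′ = ℚP.*-inverseʳ q {{ℚ.≢-nonZero q≢0′}}

  0<⇒≢0 : ∀ {q} → 0ℚ ℚ.< q → q ≢ 0ℚ
  0<⇒≢0 a refl = ℚP.<-irrefl refl a

  inv-pos : ∀ {q} → 0ℚ ℚ.< q → 0ℚ ℚ.< inv q
  inv-pos {q} a = ℚP.*-cancelˡ-<-nonNeg q {{ℚ.nonNegative (ℚP.<⇒≤ a)}} (begin-strict
    q ℚ.* 0ℚ    ≡⟨ ℚP.*-zeroʳ q ⟩
    0ℚ          <⟨ 0<1 ⟩
    1ℚ          ≡⟨ sym (inv-inverse q (0<⇒≢0 a)) ⟩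
    q ℚ.* inv q ∎)

  inv-antimono : ∀ {p q} → 0ℚ ℚ.< p → p ℚ.≤ q → inv q ℚ.≤ inv p
  inv-antimono {p} {q} a b = ℚP.*-cancelˡ-≤-pos p {{ℚ.positive a}} (begin
    p ℚ.* inv q ≤⟨ ℚP.*-monoʳ-≤-nonNeg (inv q) {{ℚ.nonNegative (ℚP.<⇒≤ (inv-pos 0<q))}} b ⟩
    q ℚ.* inv q ≡⟨ inv-inverse q (0<⇒≢0 0<q) ⟩
    1ℚ          ≡⟨ sym (inv-inverse p (0<⇒≢0 a)) ⟩
    p ℚ.* inv p ∎)
    where 0<q = ℚP.<-≤-trans a b

  *-difference : ∀ a b c d → a ℚ.* b ℚ.- c ℚ.* d ≡ a ℚ.* (b ℚ.- d) ℚ.+ d ℚ.* (a ℚ.- c)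
  *-difference = solve 4 (λ a b c d → a :* b :- c :* d := a :* (b :- d) :+ d :* (a :- c)) refl
    where open +-*-Solver

  factor : ∀ x y e z → x ℚ.* (e ℚ.* z) ℚ.+ y ℚ.* (e ℚ.* z) ≡ e ℚ.* ((x ℚ.+ y) ℚ.* z)
  factor = solve 4 (λ x y e z → x :* (e :* z) :+ y :* (e :* z) := e :* ((x :+ y) :* z)) refl
    where open +-*-Solver

  cross-difference : ∀ x y i j → (y ℚ.* j) ℚ.* i ℚ.- (x ℚ.* i) ℚ.* j ≡ (y ℚ.- x) ℚ.* (i ℚ.* j)
  cross-difference = solve 4 (λ x y i j → (y :* j) :* i :- (x :* i) :* j := (y :- x) :* (i :* j)) refl
    where open +-*-Solver

  regroup : ∀ e d i → (e ℚ.* (d ℚ.* d)) ℚ.* (i ℚ.* i) ≡ e ℚ.* ((d ℚ.* i) ℚ.* (d ℚ.* i))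
  regroup = solve 3 (λ e d i → (e :* (d :* d)) :* (i :* i) := e :* ((d :* i) :* (d :* i))) refl
    where open +-*-Solver

  product-difference : ∀ a b c d {B C η} → 0ℚ ℚ.≤ B → 0ℚ ℚ.≤ C →
    ℚ.∣ a ∣ ℚ.≤ B → ℚ.∣ d ∣ ℚ.≤ C → ℚ.∣ b ℚ.- d ∣ ℚ.≤ η → ℚ.∣ a ℚ.- c ∣ ℚ.≤ η →
    ℚ.∣ a ℚ.* b ℚ.- c ℚ.* d ∣ ℚ.≤ B ℚ.* η ℚ.+ C ℚ.* η
  product-difference a b c d {B} {C} {η} 0≤B 0≤C a≤B d≤C b-d≤η a-c≤η = begin
    ℚ.∣ a ℚ.* b ℚ.- c ℚ.* d ∣
      ≡⟨ cong ℚ.∣_∣ (*-difference a b c d) ⟩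
    ℚ.∣ a ℚ.* (b ℚ.- d) ℚ.+ d ℚ.* (a ℚ.- c) ∣
      ≤⟨ ℚP.∣p+q∣≤∣p∣+∣q∣ (a ℚ.* (b ℚ.- d)) (d ℚ.* (a ℚ.- c)) ⟩
    ℚ.∣ a ℚ.* (b ℚ.- d) ∣ ℚ.+ ℚ.∣ d ℚ.* (a ℚ.- c) ∣
      ≡⟨ cong₂ ℚ._+_ (ℚP.∣p*q∣≡∣p∣*∣q∣ a (b ℚ.- d)) (ℚP.∣p*q∣≡∣p∣*∣q∣ d (a ℚ.- c)) ⟩
    ℚ.∣ a ∣ ℚ.* ℚ.∣ b ℚ.- d ∣ ℚ.+ ℚ.∣ d ∣ ℚ.* ℚ.∣ a ℚ.- c ∣
      ≤⟨ ℚP.+-mono-≤ (*-mono-≤ (ℚP.0≤∣p∣ (b ℚ.- d)) 0≤B a≤B b-d≤η)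
                     (*-mono-≤ (ℚP.0≤∣p∣ (a ℚ.- c)) 0≤C d≤C a-c≤η) ⟩
    B ℚ.* η ℚ.+ C ℚ.* η ∎

  rescale : ∀ B C ε → 0ℚ ℚ.< B ℚ.+ C →
    B ℚ.* (ε ℚ.* inv (B ℚ.+ C)) ℚ.+ C ℚ.* (ε ℚ.* inv (B ℚ.+ C)) ≡ ε
  rescale B C ε 0<B+C =
    trans (factor B C ε (inv (B ℚ.+ C)))
      (trans (cong (ε ℚ.*_) (inv-inverse (B ℚ.+ C) (0<⇒≢0 0<B+C))) (ℚP.*-identityʳ ε))

  abstract
    *-cauchy : ∀ {s t} → IsCauchy s → IsCauchy t → IsCauchy (λ n → s n ℚ.* t n)
    *-cauchy {s} {t} cs ct ε 0<ε =
      conclude (cauchy-bounded cs) (cauchy-bounded ct)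
      where
      finish : ∀ B C η → 0ℚ ℚ.< B → 0ℚ ℚ.< C → B ℚ.* η ℚ.+ C ℚ.* η ≡ ε →
        Eventually (λ n → ℚ.∣ s n ∣ ℚ.≤ B) → Eventually (λ n → ℚ.∣ t n ∣ ℚ.≤ C) →
        (∃ λ N → ∀ m n → N ℕ.≤ m → N ℕ.≤ n → ℚ.∣ s m ℚ.- s n ∣ ℚ.≤ η) →
        (∃ λ N → ∀ m n → N ℕ.≤ m → N ℕ.≤ n → ℚ.∣ t m ℚ.- t n ∣ ℚ.≤ η) →
        ∃ λ N → ∀ m n → N ℕ.≤ m → N ℕ.≤ n → ℚ.∣ s m ℚ.* t m ℚ.- s n ℚ.* t n ∣ ℚ.≤ ε
      finish B C η 0<B 0<C e (M₁ , b) (M₂ , c) (M₃ , f) (M₄ , g) =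
        N₁ ℕ.⊔ N₂ , λ m n p q → subst (ℚ.∣ s m ℚ.* t m ℚ.- s n ℚ.* t n ∣ ℚ.≤_) e
          (product-difference (s m) (t m) (s n) (t n) {B} {C} {η} (ℚP.<⇒≤ 0<B) (ℚP.<⇒≤ 0<C)
            (b m (ℕP.m⊔n≤o⇒m≤o M₁ M₂ (ℕP.m⊔n≤o⇒m≤o N₁ N₂ p)))
            (c n (ℕP.m⊔n≤o⇒n≤o M₁ M₂ (ℕP.m⊔n≤o⇒m≤o N₁ N₂ q)))
            (g m n (ℕP.m⊔n≤o⇒n≤o M₃ M₄ (ℕP.m⊔n≤o⇒n≤o N₁ N₂ p)) (ℕP.m⊔n≤o⇒n≤o M₃ M₄ (ℕP.m⊔n≤o⇒n≤o N₁ N₂ q)))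
            (f m n (ℕP.m⊔n≤o⇒m≤o M₃ M₄ (ℕP.m⊔n≤o⇒n≤o N₁ N₂ p)) (ℕP.m⊔n≤o⇒m≤o M₃ M₄ (ℕP.m⊔n≤o⇒n≤o N₁ N₂ q))))
        where
        N₁ N₂ : ℕ
        N₁ = M₁ ℕ.⊔ M₂
        N₂ = M₃ ℕ.⊔ M₄
      conclude :
        (∃ λ B → (0ℚ ℚ.< B) × Eventually λ n → ℚ.∣ s n ∣ ℚ.≤ B) →
        (∃ λ C → (0ℚ ℚ.< C) × Eventually λ n → ℚ.∣ t n ∣ ℚ.≤ C) →
        ∃ λ N → ∀ m n → N ℕ.≤ m → N ℕ.≤ n → ℚ.∣ s m ℚ.* t m ℚ.- s n ℚ.* t n ∣ ℚ.≤ ε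
      conclude (B , 0<B , b) (C , 0<C , c) =
        finish B C η 0<B 0<C (rescale B C ε 0<B+C) b c (cs η 0<η) (ct η 0<η)
        where
        0<B+C : 0ℚ ℚ.< B ℚ.+ C
        0<B+C = ℚP.+-mono-< {0ℚ} {B} {0ℚ} {C} 0<B 0<C
        η : ℚ
        η = ε ℚ.* inv (B ℚ.+ C)
        0<η : 0ℚ ℚ.< η
        0<η = 0<p*q {ε} {inv (B ℚ.+ C)} 0<ε (inv-pos {B ℚ.+ C} 0<B+C)

  abstract
    inv-cauchy : ∀ {s} → IsCauchy s → (δ : ℚ) → 0ℚ ℚ.< δ → Eventually (λ n → δ ℚ.≤ s n) →
      IsCauchy (λ n → inv (s n))
    inv-cauchy {s} cs δ 0<δ (M , b) ε 0<ε with cs (ε ℚ.* (δ ℚ.* δ)) (0<p*q 0<ε (0<p*q 0<δ 0<δ))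
    ... | M′ , f = M ℕ.⊔ M′ , λ m n p q →
      let bm = b m (ℕP.m⊔n≤o⇒m≤o M M′ p)
          bn = b n (ℕP.m⊔n≤o⇒m≤o M M′ q)
          0<sm = ℚP.<-≤-trans 0<δ bm
          0<sn = ℚP.<-≤-trans 0<δ bn
          im = inv (s m)
          i′ = inv (s n)
          0≤im = ℚP.<⇒≤ (inv-pos 0<sm)
          0≤in = ℚP.<⇒≤ (inv-pos 0<sn)
      in begin
      ℚ.∣ im ℚ.- i′ ∣
        ≡⟨ cong ℚ.∣_∣ (cong₂ ℚ._-_ (sym (ℚP.*-identityˡ im)) (sym (ℚP.*-identityˡ i′))) ⟩
      ℚ.∣ 1ℚ ℚ.* im ℚ.- 1ℚ ℚ.* i′ ∣
        ≡⟨ cong ℚ.∣_∣ (cong₂ (λ u v → u ℚ.* im ℚ.- v ℚ.* i′)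
             (sym (inv-inverse (s n) (0<⇒≢0 0<sn))) (sym (inv-inverse (s m) (0<⇒≢0 0<sm)))) ⟩
      ℚ.∣ (s n ℚ.* i′) ℚ.* im ℚ.- (s m ℚ.* im) ℚ.* i′ ∣
        ≡⟨ cong ℚ.∣_∣ (cross-difference (s m) (s n) im i′) ⟩
      ℚ.∣ (s n ℚ.- s m) ℚ.* (im ℚ.* i′) ∣
        ≡⟨ ℚP.∣p*q∣≡∣p∣*∣q∣ (s n ℚ.- s m) (im ℚ.* i′) ⟩
      ℚ.∣ s n ℚ.- s m ∣ ℚ.* ℚ.∣ im ℚ.* i′ ∣
        ≡⟨ cong (ℚ.∣ s n ℚ.- s m ∣ ℚ.*_) (ℚP.0≤p⇒∣p∣≡p (ℚP.<⇒≤ (0<p*q (inv-pos 0<sm) (inv-pos 0<sn)))) ⟩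
      ℚ.∣ s n ℚ.- s m ∣ ℚ.* (im ℚ.* i′)
        ≤⟨ *-mono-≤ (ℚP.<⇒≤ (0<p*q (inv-pos 0<sm) (inv-pos 0<sn)))
                    (ℚP.<⇒≤ (0<p*q 0<ε (0<p*q 0<δ 0<δ)))
                    (f n m (ℕP.m⊔n≤o⇒n≤o M M′ q) (ℕP.m⊔n≤o⇒n≤o M M′ p))
                    (*-mono-≤ 0≤in (ℚP.<⇒≤ (inv-pos 0<δ)) (inv-antimono 0<δ bm) (inv-antimono 0<δ bn)) ⟩
      (ε ℚ.* (δ ℚ.* δ)) ℚ.* (inv δ ℚ.* inv δ)
        ≡⟨ regroup ε δ (inv δ) ⟩
      ε ℚ.* ((δ ℚ.* inv δ) ℚ.* (δ ℚ.* inv δ))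
        ≡⟨ cong (λ u → ε ℚ.* (u ℚ.* u)) (inv-inverse δ (0<⇒≢0 0<δ)) ⟩
      ε ℚ.* (1ℚ ℚ.* 1ℚ)
        ≡⟨ ℚP.*-identityʳ ε ⟩
      ε ∎

open CauchyLemmas

fromℚ : ℚ → ℝ
fromℚ q = mkℝ (λ _ → q) (const-cauchy q)

fromℕ : ℕ → ℝ
fromℕ k = fromℚ (+ k ℚ./ 1)

ℝ-rawRing : RawRing 0ℓ 0ℓ
ℝ-rawRing = record
  { Carrier = ℝ
  ; _≈_     = _≈_
  ; _+_     = λ x y → mkℝ (λ n → seq x n ℚ.+ seq y n) (+-cauchy {seq x} {seq y} (cauchy x) (cauchy y))
  ; _*_     = λ x y → mkℝ (λ n → seq x n ℚ.* seq y n) (*-cauchy {seq x} {seq y} (cauchy x) (cauchy y))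
  ; -_      = λ x → mkℝ (λ n → ℚ.- seq x n) (neg-cauchy {seq x} (cauchy x))
  ; 0#      = fromℚ 0ℚ
  ; 1#      = fromℚ 1ℚ
  }

open RawRing ℝ-rawRing public
  using (_+_; _*_; 0#; 1#; _≉_)
open import Algebra.Definitions.RawSemiring (RawRing.rawSemiring ℝ-rawRing) public
  using (_^_; sum; product)

infix 8 _⁻¹⟨_⟩

_⁻¹⟨_⟩ : (x : ℝ) → 0# < x → ℝ
x ⁻¹⟨ δ , 0<δ , N , b ⟩ = mkℝ (λ n → inv (seq x n))
  (inv-cauchy {seq x} (cauchy x) δ 0<δ
    (N , λ n p → subst (ℚ._≤ seq x n) (ℚP.+-identityˡ δ) (b n p)))

module GridLemmas where

  /-mono : ∀ a b k m → a ℕ.* suc m ℕ.≤ b ℕ.* suc k → + a ℚ./ suc k ℚ.≤ + b ℚ./ suc m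
  /-mono a b k m h = ℚP.toℚᵘ-cancel-≤ (begin
    ℚ.toℚᵘ (+ a ℚ./ suc k) ≃⟨ ℚP.toℚᵘ-fromℚᵘ (ℚᵘ.mkℚᵘ (+ a) k) ⟩
    ℚᵘ.mkℚᵘ (+ a) k        ≤⟨ ℚᵘ.*≤* (subst₂ ℤ._≤_ (ℤP.pos-* a (suc m)) (ℤP.pos-* b (suc k)) (ℤ.+≤+ h)) ⟩
    ℚᵘ.mkℚᵘ (+ b) m        ≃⟨ ℚᵘP.≃-sym (ℚP.toℚᵘ-fromℚᵘ (ℚᵘ.mkℚᵘ (+ b) m)) ⟩
    ℚ.toℚᵘ (+ b ℚ./ suc m) ∎)
    where open ℚᵘP.≤-Reasoning

  /-suc : ∀ b m → + suc b ℚ./ suc m ≡ + b ℚ./ suc m ℚ.+ + 1 ℚ./ suc m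
  /-suc b m = ℚP.toℚᵘ-injective (begin-equality
    ℚ.toℚᵘ (+ suc b ℚ./ suc m) ≃⟨ ℚP.toℚᵘ-fromℚᵘ (ℚᵘ.mkℚᵘ (+ suc b) m) ⟩
    ℚᵘ.mkℚᵘ (+ suc b) m ≃⟨ ℚᵘ.*≡* (trans (sym (ℤP.pos-* (suc b) (suc m ℕ.* suc m))) (trans (cong +_ (lem b (suc m)))
        (trans (ℤP.pos-* (b ℕ.* suc m ℕ.+ 1 ℕ.* suc m) (suc m)) (cong (ℤ._* (+ suc m))
          (trans (ℤP.pos-+ (b ℕ.* suc m) (1 ℕ.* suc m)) (cong₂ ℤ._+_ (ℤP.pos-* b (suc m)) (ℤP.pos-* 1 (suc m)))))))) ⟩
    ℚᵘ.mkℚᵘ (+ b) m ℚᵘ.+ ℚᵘ.mkℚᵘ (+ 1) m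
      ≃⟨ ℚᵘP.+-cong (ℚᵘP.≃-sym (ℚP.toℚᵘ-fromℚᵘ (ℚᵘ.mkℚᵘ (+ b) m)))
                    (ℚᵘP.≃-sym (ℚP.toℚᵘ-fromℚᵘ (ℚᵘ.mkℚᵘ (+ 1) m))) ⟩
    ℚ.toℚᵘ (+ b ℚ./ suc m) ℚᵘ.+ ℚ.toℚᵘ (+ 1 ℚ./ suc m)
      ≃⟨ ℚᵘP.≃-sym (ℚP.toℚᵘ-homo-+ (+ b ℚ./ suc m) (+ 1 ℚ./ suc m)) ⟩
    ℚ.toℚᵘ (+ b ℚ./ suc m ℚ.+ + 1 ℚ./ suc m) ∎)
    where
    open ℚᵘP.≤-Reasoning
    lem : ∀ b m → suc b ℕ.* (m ℕ.* m) ≡ (b ℕ.* m ℕ.+ 1 ℕ.* m) ℕ.* m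
    lem = solve-∀

  archimedean : ∀ ε → 0ℚ ℚ.< ε → ∃ λ N → + 1 ℚ./ suc N ℚ.≤ ε
  archimedean ε@(ℚ.mkℚ (+ suc p) d c) 0<ε =
    d , subst (+ 1 ℚ./ suc d ℚ.≤_) (ℚP.↥p/↧p≡p ε)
          (/-mono 1 (suc p) d d (ℕP.*-monoˡ-≤ (suc d) (ℕ.s≤s (ℕ.z≤n {p}))))
  archimedean (ℚ.mkℚ (+ zero) d c) (ℚ.*<* (ℤ.+<+ ()))
  archimedean (ℚ.mkℚ (ℤ.-[1+ p ]) d c) (ℚ.*<* ())

  abstract
    approx-cauchy : (a : ℕ → ℕ) → (∀ k m → a k ℕ.* suc m ℕ.≤ suc (a m) ℕ.* suc k) →
      IsCauchy (λ k → + a k ℚ./ suc k)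
    approx-cauchy a h ε 0<ε with archimedean ε 0<ε
    ... | N , 1/N≤ε = N , λ m n p q → ∣-∣-bound (half m n q) (half n m p)
      where
      open ℚP.≤-Reasoning
      half : ∀ k m → N ℕ.≤ m → + a k ℚ./ suc k ℚ.≤ + a m ℚ./ suc m ℚ.+ ε
      half k m N≤m = begin
        + a k ℚ./ suc k                     ≤⟨ /-mono (a k) (suc (a m)) k m (h k m) ⟩
        + suc (a m) ℚ./ suc m               ≡⟨ /-suc (a m) m ⟩
        + a m ℚ./ suc m ℚ.+ + 1 ℚ./ suc m   ≤⟨ ℚP.+-monoʳ-≤ (+ a m ℚ./ suc m)
                                                 (/-mono 1 1 m N (ℕP.*-monoʳ-≤ 1 (ℕ.s≤s N≤m))) ⟩
        + a m ℚ./ suc m ℚ.+ + 1 ℚ./ suc N   ≤⟨ ℚP.+-monoʳ-≤ (+ a m ℚ./ suc m) 1/N≤ε ⟩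
        + a m ℚ./ suc m ℚ.+ ε               ∎

open GridLemmas

⌊√_⌋ : ℕ → ℕ
⌊√ zero ⌋  = 0
⌊√ suc n ⌋ with ⌊√ n ⌋
... | r with suc r ℕ.* suc r ℕ.≤? suc n
...   | yes _ = suc r
...   | no  _ = r

⌊√⌋-lower : ∀ n → ⌊√ n ⌋ ℕ.* ⌊√ n ⌋ ℕ.≤ n
⌊√⌋-lower zero = ℕ.z≤n
⌊√⌋-lower (suc n) with ⌊√ n ⌋ | ⌊√⌋-lower n
... | r | ih with suc r ℕ.* suc r ℕ.≤? suc n
...   | yes p = p
...   | no  _ = ℕP.m≤n⇒m≤1+n ih

⌊√⌋-upper : ∀ n → n ℕ.< suc ⌊√ n ⌋ ℕ.* suc ⌊√ n ⌋
⌊√⌋-upper zero = ℕ.s≤s ℕ.z≤n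
⌊√⌋-upper (suc n) with ⌊√ n ⌋ | ⌊√⌋-upper n
... | r | ih with suc r ℕ.* suc r ℕ.≤? suc n
...   | yes _ = ℕP.≤-<-trans ih (ℕP.*-mono-< (ℕP.n<1+n (suc r)) (ℕP.n<1+n (suc r)))
...   | no  p = ℕP.≰⇒> p

2^⌊log₂⌋≤ : ∀ n → .{{ℕ.NonZero n}} → 2 ℕ.^ ⌊log₂ n ⌋ ℕ.≤ n
2^⌊log₂⌋≤ = <-rec (λ n → .{{ℕ.NonZero n}} → 2 ℕ.^ ⌊log₂ n ⌋ ℕ.≤ n) step
  where
  open ℕP.≤-Reasoning
  half : ∀ n → 2 ℕ.* ℕ.⌊ n /2⌋ ℕ.≤ n
  half zero = ℕ.z≤n
  half (suc zero) = ℕ.z≤n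
  half (suc (suc n)) = begin
    2 ℕ.* suc ℕ.⌊ n /2⌋     ≡⟨ ℕP.*-suc 2 ℕ.⌊ n /2⌋ ⟩
    2 ℕ.+ 2 ℕ.* ℕ.⌊ n /2⌋   ≤⟨ ℕP.+-monoʳ-≤ 2 (half n) ⟩
    2 ℕ.+ n                 ∎
  pow : ∀ k → 2 ℕ.^ k ℕ.≤ 2 ℕ.* 2 ℕ.^ (k ℕ.∸ 1)
  pow zero = ℕ.s≤s ℕ.z≤n
  pow (suc k) = ℕP.≤-refl
  step : ∀ n → (∀ {m} → m ℕ.< n → .{{ℕ.NonZero m}} → 2 ℕ.^ ⌊log₂ m ⌋ ℕ.≤ m) →
         .{{ℕ.NonZero n}} → 2 ℕ.^ ⌊log₂ n ⌋ ℕ.≤ n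
  step (suc zero) rec = ℕ.s≤s ℕ.z≤n
  step n@(suc (suc m)) rec = begin
    2 ℕ.^ ⌊log₂ n ⌋                   ≤⟨ pow ⌊log₂ n ⌋ ⟩
    2 ℕ.* 2 ℕ.^ (⌊log₂ n ⌋ ℕ.∸ 1)     ≡⟨ cong (λ k → 2 ℕ.* 2 ℕ.^ k) (sym (⌊log₂⌊n/2⌋⌋≡⌊log₂n⌋∸1 n)) ⟩
    2 ℕ.* 2 ℕ.^ ⌊log₂ ℕ.⌊ n /2⌋ ⌋     ≤⟨ ℕP.*-monoʳ-≤ 2 (rec (ℕP.⌊n/2⌋<n (suc m))) ⟩
    2 ℕ.* ℕ.⌊ n /2⌋                   ≤⟨ half n ⟩
    n                                 ∎

<2^[1+⌊log₂⌋] : ∀ n → n ℕ.< 2 ℕ.^ suc ⌊log₂ n ⌋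
<2^[1+⌊log₂⌋] n = ℕP.≰⇒> λ h → ℕP.<-irrefl refl
  (ℕP.≤-trans (ℕP.≤-reflexive (sym (⌊log₂[2^n]⌋≡n (suc ⌊log₂ n ⌋)))) (⌊log₂⌋-mono-≤ h))

module FloorLemmas where
  open ℕP.≤-Reasoning

  √-approx : ∀ N k m → let r = λ k → ⌊√ N ℕ.* (suc k ℕ.* suc k) ⌋ in
    r k ℕ.* suc m ℕ.≤ suc (r m) ℕ.* suc k
  √-approx N k m = ℕP.≮⇒≥ λ h → ℕP.<-irrefl refl (begin-strict
    (suc b ℕ.* suc k) ℕ.* (suc b ℕ.* suc k) <⟨ ℕP.*-mono-< h h ⟩
    (a ℕ.* suc m) ℕ.* (a ℕ.* suc m)         ≡⟨ sq a (suc m) ⟩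
    (a ℕ.* a) ℕ.* (suc m ℕ.* suc m)         ≤⟨ ℕP.*-monoˡ-≤ (suc m ℕ.* suc m) (⌊√⌋-lower (N ℕ.* (suc k ℕ.* suc k))) ⟩
    (N ℕ.* (suc k ℕ.* suc k)) ℕ.* (suc m ℕ.* suc m) ≡⟨ sw N (suc k ℕ.* suc k) (suc m ℕ.* suc m) ⟩
    (N ℕ.* (suc m ℕ.* suc m)) ℕ.* (suc k ℕ.* suc k)
      ≤⟨ ℕP.*-monoˡ-≤ (suc k ℕ.* suc k) (ℕP.<⇒≤ (⌊√⌋-upper (N ℕ.* (suc m ℕ.* suc m)))) ⟩
    (suc b ℕ.* suc b) ℕ.* (suc k ℕ.* suc k) ≡⟨ sym (sq (suc b) (suc k)) ⟩
    (suc b ℕ.* suc k) ℕ.* (suc b ℕ.* suc k) ∎)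
    where
    a = ⌊√ N ℕ.* (suc k ℕ.* suc k) ⌋
    b = ⌊√ N ℕ.* (suc m ℕ.* suc m) ⌋
    sq : ∀ x y → (x ℕ.* y) ℕ.* (x ℕ.* y) ≡ (x ℕ.* x) ℕ.* (y ℕ.* y)
    sq = solve-∀
    sw : ∀ x y z → (x ℕ.* y) ℕ.* z ≡ (x ℕ.* z) ℕ.* y
    sw = solve-∀

  log₂-approx : ∀ N k m → let l = λ k → ⌊log₂ N ℕ.^ suc k ⌋ in
    l k ℕ.* suc m ℕ.≤ suc (l m) ℕ.* suc k
  log₂-approx zero k m = ℕ.z≤n
  log₂-approx N@(suc _) k m = ℕP.≮⇒≥ λ h → ℕP.<-irrefl refl (begin-strict
    2 ℕ.^ (suc b ℕ.* suc k)         <⟨ ℕP.^-monoʳ-< 2 (ℕP.n<1+n 1) h ⟩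
    2 ℕ.^ (a ℕ.* suc m)             ≡⟨ sym (ℕP.^-*-assoc 2 a (suc m)) ⟩
    (2 ℕ.^ a) ℕ.^ suc m             ≤⟨ ℕP.^-monoˡ-≤ (suc m) (2^⌊log₂⌋≤ (N ℕ.^ suc k) {{ℕP.m^n≢0 N (suc k)}}) ⟩
    (N ℕ.^ suc k) ℕ.^ suc m         ≡⟨ ℕP.^-*-assoc N (suc k) (suc m) ⟩
    N ℕ.^ (suc k ℕ.* suc m)         ≡⟨ cong (N ℕ.^_) (ℕP.*-comm (suc k) (suc m)) ⟩
    N ℕ.^ (suc m ℕ.* suc k)         ≡⟨ sym (ℕP.^-*-assoc N (suc m) (suc k)) ⟩
    (N ℕ.^ suc m) ℕ.^ suc k         ≤⟨ ℕP.^-monoˡ-≤ (suc k) (ℕP.<⇒≤ (<2^[1+⌊log₂⌋] (N ℕ.^ suc m))) ⟩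
    (2 ℕ.^ suc b) ℕ.^ suc k         ≡⟨ ℕP.^-*-assoc 2 (suc b) (suc k) ⟩
    2 ℕ.^ (suc b ℕ.* suc k)         ∎)
    where
    a = ⌊log₂ N ℕ.^ suc k ⌋
    b = ⌊log₂ N ℕ.^ suc m ⌋

open FloorLemmas

-- The k-th approximation, with K = k + 1, is ⌊√(N K²)⌋ / K, which lies
-- within 1/K of the square root.

√ : ℕ → ℝ
√ N = mkℝ (λ k → + ⌊√ N ℕ.* (suc k ℕ.* suc k) ⌋ ℚ./ suc k)
          (approx-cauchy (λ k → ⌊√ N ℕ.* (suc k ℕ.* suc k) ⌋) (√-approx N))

-- The k-th approximation, with K = k + 1, is ⌊log₂(N^K)⌋ / K, which lies
-- within 1/K of log₂ N.  Junk value: log₂ 0 is 0.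

log₂ : ℕ → ℝ
log₂ N = mkℝ (λ k → + ⌊log₂ N ℕ.^ suc k ⌋ ℚ./ suc k)
             (approx-cauchy (λ k → ⌊log₂ N ℕ.^ suc k ⌋) (log₂-approx N))

abstract
  0<2√2 : 0# < fromℕ 2 * √ 2
  0<2√2 = 1ℚ , 0<1 , 0 , λ k _ → bound k
    where
    open ℚP.≤-Reasoning
    r : ℕ → ℕ
    r k = ⌊√ 2 ℕ.* (suc k ℕ.* suc k) ⌋
    big : ∀ k → suc k ℕ.≤ r k
    big k = ℕP.≮⇒≥ λ h → ℕP.<-irrefl refl
      (ℕP.<-≤-trans (⌊√⌋-upper (2 ℕ.* (suc k ℕ.* suc k)))
        (ℕP.≤-trans (ℕP.*-mono-≤ h h) (ℕP.m≤m+n (suc k ℕ.* suc k) _)))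
    bound : ∀ k → 0ℚ ℚ.+ 1ℚ ℚ.≤ seq (fromℕ 2 * √ 2) k
    bound k = begin
      0ℚ ℚ.+ 1ℚ                             ≤⟨ /-mono 1 (r k) 0 k
                                                 (subst₂ ℕ._≤_ (sym (ℕP.*-identityˡ (suc k)))
                                                   (sym (ℕP.*-identityʳ (r k))) (big k)) ⟩
      + r k ℚ./ suc k                       ≡⟨ sym (ℚP.*-identityˡ _) ⟩
      1ℚ ℚ.* (+ r k ℚ./ suc k)              ≤⟨ ℚP.*-monoʳ-≤-nonNeg (+ r k ℚ./ suc k)
                                                 {{ℚP.normalize-nonNeg (r k) (suc k)}}
                                                 (/-mono 1 2 0 0 (ℕ.s≤s ℕ.z≤n)) ⟩
      (+ 2 ℚ./ 1) ℚ.* (+ r k ℚ./ suc k)     ∎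

3/2√2 : ℝ
3/2√2 = fromℕ 3 * (fromℕ 2 * √ 2) ⁻¹⟨ 0<2√2 ⟩

1·06 : ℝ
1·06 = fromℚ (+ 106 ℚ./ 100)

Matrix : Set → Set → Set
Matrix R C = R → C → ℝ

LinearlyIndependent : ∀ {k} {C : Set} → (Fin k → C → ℝ) → Set
LinearlyIndependent {k} {C} v = (a : Fin k → ℝ) →
  (∀ (j : C) → sum (λ i → a i * v i j) ≈ 0#) → ∀ i → a i ≈ 0#

record IsRank {R C : Set} (M : Matrix R C) (r : ℕ) : Set where
  field
    rows        : Fin r → R
    independent : LinearlyIndependent (λ i → M (rows i))
    maximal     : ∀ k (ρ : Fin k → R) → LinearlyIndependent (λ i → M (ρ i)) → k ℕ.≤ r

signℝ : Sign → ℝ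
signℝ Sign.+ = fromℚ 1ℚ
signℝ Sign.- = fromℚ (ℚ.- 1ℚ)

bitℝ : Bool → ℝ
bitℝ b = if b then 1# else 0#

sumSubsets : ∀ {n} → (Subset n → ℝ) → ℝ
sumSubsets {zero}  g = g []
sumSubsets {suc n} g = sumSubsets (λ S → g (outside ∷ S)) + sumSubsets (λ S → g (inside ∷ S))

monomial : ∀ {n} → Subset n → Vec Bool n → ℝ
monomial S x = product (λ i → if lookup S i then bitℝ (lookup x i) else 1#)

-- The coefficients α are determined up to _≈_ by g, so IsDegree g holds
-- for at most one d.

record IsDegree {n} (g : Vec Bool n → ℝ) (d : ℕ) : Set where
  field
    α          : Subset n → ℝ
    represents : ∀ x → g x ≈ sumSubsets (λ S → α S * monomial S x)
    attained   : ∃ λ S → (α S ≉ 0#) × ∣ S ∣ ≡ d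
    bounded    : ∀ S → α S ≉ 0# → ∣ S ∣ ℕ.≤ d

module _ {n} (f : Vec Bool n → Sign) where

  andMatrix : Matrix (Vec Bool n) (Vec Bool n)
  andMatrix x y = signℝ (f (zipWith _∧_ x y))

  orMatrix : Matrix (Vec Bool n) (Vec Bool n)
  orMatrix x y = signℝ (f (zipWith _∨_ x y))

  problem : Vec Bool n × Bool → Vec Bool n → Sign
  problem (x , false) y = f (zipWith _∧_ x y)
  problem (x , true)  y = f (zipWith _∨_ x y)

  problemMatrix : Matrix (Vec Bool n × Bool) (Vec Bool n)
  problemMatrix u y = signℝ (problem u y)

data Protocol (X Y Z : Set) : Set where
  output : Z → Protocol X Y Z
  alice  : (X → Bool) → (Bool → Protocol X Y Z) → Protocol X Y Z
  bob    : (Y → Bool) → (Bool → Protocol X Y Z) → Protocol X Y Z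

module _ {X Y Z : Set} where

  run : Protocol X Y Z → X → Y → Z
  run (output z)     x y = z
  run (alice s next) x y = run (next (s x)) x y
  run (bob s next)   x y = run (next (s y)) x y

  bits : Protocol X Y Z → X → Y → ℕ
  bits (output z)     x y = 0
  bits (alice s next) x y = suc (bits (next (s x)) x y)
  bits (bob s next)   x y = suc (bits (next (s y)) x y)

  ComputableWithin : (X → Y → Z) → ℕ → Set
  ComputableWithin F k = ∃ λ (π : Protocol X Y Z) →
    (∀ x y → run π x y ≡ F x y) × (∀ x y → bits π x y ℕ.≤ k)

  record IsCommunicationComplexity (F : X → Y → Z) (D : ℕ) : Set where
    field
      achieved : ComputableWithin F D
      least    : ∀ k → ComputableWithin F k → D ℕ.≤ k

{-# OPTIONS --safe #-}

-- Rank.  Write f = f₀ + x (f₁ − f₀) for a variable x.  The AND matrix of f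
-- is [[A₀, A₀], [A₀, A₁]], of rank rk A₀ + rk (A₁ − A₀), and its OR matrix is
-- [[B₀, B₁], [B₁, B₁]], of rank rk B₁ + rk (B₁ − B₀).  By induction on the
-- variables, rk F₁ · rk F₂ ≥ 2^|S| for every monomial S of f, which gives
-- max (rk F₁) (rk F₂) ≥ √2^d; and 3/(2√2) ≤ √2.
--
-- Communication.  A decision tree for f gives a protocol for F, so it remains
-- to bound its depth by a polynomial in d ≤ 2 log₂ (rk F).  Take disjoint
-- blocks B₁, …, B_k, each inside a monomial of maximal degree, such that f
-- changes from 0 to B_i.  If q z is the mean of f on the union of random
-- blocks, each taken with probability z, then q is a polynomial of degree at
-- most d, bounded by 1 on [0, 1], with |q′ 0| = 2 k; hence k is at most a
-- polynomial in d by Markov's inequality.  For a maximal choice of blocks,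
-- every monomial of degree d meets their union, so that querying the union
-- lowers the degree.
module Submission where

open import Defs
open import Data.Bool as Bool using (Bool; true; false; _∧_; _∨_; if_then_else_; b≤b; f≤t)
open import Data.Fin as Fin using (Fin; zero; suc; _↑ˡ_; _↑ʳ_; splitAt)
import Data.Fin.Properties as FinP
open import Data.Fin.Subset using (Subset; inside; outside; ∣_∣; ⊥; ⁅_⁆; _∪_; _∩_)
open import Data.Fin.Subset.Properties using (anySubset?; ∣p∣≤n)
open import Data.Integer using (+_)
open import Data.Maybe as Maybe using (Maybe; just; nothing; maybe; is-just)
open import Data.Nat as ℕ using (ℕ; zero; suc; s≤s; z≤n)
import Data.Nat.Properties as ℕP
open import Data.Nat.Combinatorics using (_C_; nC1≡n; nCk+nC[k+1]≡[n+1]C[k+1]; k>n⇒nCk≡0)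
open import Data.Nat.Logarithm using (⌊log₂_⌋; ⌊log₂⌋-mono-≤; ⌊log₂[2^n]⌋≡n)
open import Data.Nat.Tactic.RingSolver using (solve-∀)
open import Data.Product using (∃; _×_; _,_; proj₁; proj₂)
open import Data.Rational as ℚ using (ℚ; 0ℚ; 1ℚ)
import Data.Rational.Properties as ℚP
open import Data.Rational.Solver using (module +-*-Solver)
open import Data.Sign using (Sign)
open import Data.Sum using (_⊎_; inj₁; inj₂)
open import Data.Vec as Vec using (Vec; []; _∷_; zipWith; lookup; map; replicate)
open import Data.Vec.Functional using () renaming (_++_ to _⧺_)
open import Data.Vec.Functional.Properties using (lookup-++ˡ; lookup-++ʳ)
import Data.Vec.Properties as VecP
open import Data.Vec.Relation.Binary.Pointwise.Inductive as Pointwise using (Pointwise; []; _∷_)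
open import Function using (_∘_)
open import Relation.Nullary using (Dec; yes; no; contradiction; ¬?; _×-dec_)
open import Relation.Binary.PropositionalEquality
  using (_≡_; _≢_; refl; sym; trans; cong; cong₂; subst; subst₂; module ≡-Reasoning)

open CauchyLemmas
open GridLemmas
open +-*-Solver using (solve; _:=_; _:+_; _:*_; _:-_; :-_; con)
open import Algebra.Definitions.RawSemiring ℚ.+-*-rawSemiring using () renaming (_^_ to _^ℚ_)

-- The ranks are only ever bounded from below, by explicit independent rows, so no elimination over
-- the reals is needed. Matrix entries and polynomial coefficients are kept rational, hence can be
-- tested for zero; real numbers enter through the weights of linear combinations, the given
-- representation of f and the final bounds. The product of the two ranks is the quantity that grows
-- in the induction: at each variable of S one rank adds up over two subfunctions while the other is
-- only known to reach the larger of two values, and which is which depends on the coefficients.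
-- Markov's inequality may lose a polynomial factor, so no Chebyshev polynomials are needed. If p
-- has degree below d, then p((i - d)²/d²) has degree below 2d in i, so its finite difference of
-- order 2d over i = 0, ..., 2d vanishes. The square moves the point 0 to the middle, where the
-- binomial weight is at least a share 1/(2d + 1) of the total 4^d, and keeps all other nodes in
-- [1/d², 1]. Thus p(0) is controlled by the values at the other nodes.

private variable
  n k l m d e : ℕ
  Y Z : Set

-- Ranks of AND and OR matrices

-- Identities between reals are checked term by term in ℚ; z and z′ are therefore given only through
-- their sequences, which builds the rewriting of both sides into the lemma.
≈-sub : ∀ (x x′ y y′ z z′ : ℝ) → x ≈ x′ → y ≈ y′ →
  (∀ m → seq z m ≡ seq x m ℚ.- seq y m) → (∀ m → seq z′ m ≡ seq x′ m ℚ.- seq y′ m) → z ≈ z′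
≈-sub x x′ y y′ z z′ p q e e′ ε 0<ε
  with p (ε ℚ.* ℚ.½) (0<p*q 0<ε 0<½) | q (ε ℚ.* ℚ.½) (0<p*q 0<ε 0<½)
... | M , f | N , g = M ℕ.⊔ N , λ m h → begin
  ℚ.∣ seq z m ℚ.- seq z′ m ∣
    ≡⟨ cong ℚ.∣_∣ (cong₂ ℚ._-_ (e m) (e′ m)) ⟩
  ℚ.∣ (seq x m ℚ.- seq y m) ℚ.- (seq x′ m ℚ.- seq y′ m) ∣
    ≡⟨ cong ℚ.∣_∣ (solve 4 (λ a b c d → (a :- b) :- (c :- d) := (a :- c) :- (b :- d)) refl
         (seq x m) (seq y m) (seq x′ m) (seq y′ m)) ⟩
  ℚ.∣ (seq x m ℚ.- seq x′ m) ℚ.- (seq y m ℚ.- seq y′ m) ∣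
    ≤⟨ ℚP.∣p-q∣≤∣p∣+∣q∣ (seq x m ℚ.- seq x′ m) (seq y m ℚ.- seq y′ m) ⟩
  ℚ.∣ seq x m ℚ.- seq x′ m ∣ ℚ.+ ℚ.∣ seq y m ℚ.- seq y′ m ∣
    ≤⟨ ℚP.+-mono-≤ (f m (ℕP.m⊔n≤o⇒m≤o M N h)) (g m (ℕP.m⊔n≤o⇒n≤o M N h)) ⟩
  ε ℚ.* ℚ.½ ℚ.+ ε ℚ.* ℚ.½ ≡⟨ halves ε ⟩
  ε ∎
  where open ℚP.≤-Reasoning

≈-scale : ∀ q (x x′ z z′ : ℝ) → x ≈ x′ →
  (∀ m → seq z m ≡ q ℚ.* seq x m) → (∀ m → seq z′ m ≡ q ℚ.* seq x′ m) → z ≈ z′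
≈-scale q x x′ z z′ p e e′ ε 0<ε with p η 0<η
  where
  -- Adding 1 to |q| keeps the divisor positive, so that q = 0 needs no case of its own.
  B = 1ℚ ℚ.+ ℚ.∣ q ∣
  0<B : 0ℚ ℚ.< B
  0<B = ℚP.+-mono-<-≤ {0ℚ} {1ℚ} {0ℚ} {ℚ.∣ q ∣} 0<1 (ℚP.0≤∣p∣ q)
  η = ε ℚ.* inv B
  0<η : 0ℚ ℚ.< η
  0<η = 0<p*q {ε} {inv B} 0<ε (inv-pos {B} 0<B)
... | N , f = N , λ m h → begin
  ℚ.∣ seq z m ℚ.- seq z′ m ∣
    ≡⟨ cong ℚ.∣_∣ (cong₂ ℚ._-_ (e m) (e′ m)) ⟩
  ℚ.∣ q ℚ.* seq x m ℚ.- q ℚ.* seq x′ m ∣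
    ≡⟨ cong ℚ.∣_∣ (solve 3 (λ a b c → a :* b :- a :* c := a :* (b :- c)) refl q (seq x m) (seq x′ m)) ⟩
  ℚ.∣ q ℚ.* (seq x m ℚ.- seq x′ m) ∣
    ≡⟨ ℚP.∣p*q∣≡∣p∣*∣q∣ q (seq x m ℚ.- seq x′ m) ⟩
  ℚ.∣ q ∣ ℚ.* ℚ.∣ seq x m ℚ.- seq x′ m ∣
    ≤⟨ *-mono-≤ (ℚP.0≤∣p∣ (seq x m ℚ.- seq x′ m)) (ℚP.<⇒≤ 0<B)
         (subst (ℚ._≤ B) (ℚP.+-identityˡ ℚ.∣ q ∣) (ℚP.+-monoˡ-≤ ℚ.∣ q ∣ (ℚP.<⇒≤ 0<1))) (f m h) ⟩
  B ℚ.* (ε ℚ.* inv B)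
    ≡⟨ solve 3 (λ a b c → a :* (b :* c) := b :* (a :* c)) refl B ε (inv B) ⟩
  ε ℚ.* (B ℚ.* inv B) ≡⟨ cong (ε ℚ.*_) (inv-inverse B (0<⇒≢0 0<B)) ⟩
  ε ℚ.* 1ℚ ≡⟨ ℚP.*-identityʳ ε ⟩
  ε ∎
  where
  open ℚP.≤-Reasoning
  B = 1ℚ ℚ.+ ℚ.∣ q ∣
  0<B : 0ℚ ℚ.< B
  0<B = ℚP.+-mono-<-≤ {0ℚ} {1ℚ} {0ℚ} {ℚ.∣ q ∣} 0<1 (ℚP.0≤∣p∣ q)

fromℚ-cong : ∀ {p q} → p ≡ q → fromℚ p ≈ fromℚ q
fromℚ-cong {p} refl ε 0<ε = 0 , λ _ _ →
  subst (ℚ._≤ ε) (sym (cong ℚ.∣_∣ (ℚP.+-inverseʳ p))) (ℚP.<⇒≤ 0<ε)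

lin : (Fin k → ℝ) → (Fin k → ℚ) → ℝ
lin a v = sum (λ i → a i * fromℚ (v i))

Independent : (Fin k → Y → ℚ) → Set
Independent v = LinearlyIndependent (λ i y → fromℚ (v i y))

lin-cong : ∀ (a : Fin k → ℝ) {v w} → (∀ i → v i ≡ w i) → ∀ m → seq (lin a v) m ≡ seq (lin a w) m
lin-cong {zero}  a e m = refl
lin-cong {suc k} a e m = cong₂ ℚ._+_ (cong (seq (a zero) m ℚ.*_) (e zero)) (lin-cong (a ∘ suc) (e ∘ suc) m)

lin-sub : ∀ (a : Fin k → ℝ) v w m →
  seq (lin a (λ i → v i ℚ.- w i)) m ≡ seq (lin a v) m ℚ.- seq (lin a w) m
lin-sub {zero}  a v w m = refl
lin-sub {suc k} a v w m = trans (cong (seq (a zero) m ℚ.* (v zero ℚ.- w zero) ℚ.+_)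
    (lin-sub (a ∘ suc) (v ∘ suc) (w ∘ suc) m))
  (solve 5 (λ a v w s t → a :* (v :- w) :+ (s :- t) := (a :* v :+ s) :- (a :* w :+ t)) refl
    (seq (a zero) m) (v zero) (w zero) (seq (lin (a ∘ suc) (v ∘ suc)) m) (seq (lin (a ∘ suc) (w ∘ suc)) m))

lin-split : ∀ k (a : Fin (k ℕ.+ l) → ℝ) v m → seq (lin a v) m ≡
  seq (lin (a ∘ (_↑ˡ l)) (v ∘ (_↑ˡ l))) m ℚ.+ seq (lin (a ∘ (k ↑ʳ_)) (v ∘ (k ↑ʳ_))) m
lin-split zero    a v m = sym (ℚP.+-identityˡ _)
lin-split (suc k) a v m = trans (cong (seq (a zero) m ℚ.* v zero ℚ.+_) (lin-split k (a ∘ suc) (v ∘ suc) m))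
  (sym (ℚP.+-assoc (seq (a zero) m ℚ.* v zero) _ _))

null-sub : ∀ x y z → x ≈ 0# → y ≈ 0# → (∀ m → seq z m ≡ seq x m ℚ.- seq y m) → z ≈ 0#
null-sub x y z p q e = ≈-sub x 0# y 0# z 0# p q e λ _ → refl

null-scale : ∀ q x z → x ≈ 0# → (∀ m → seq z m ≡ q ℚ.* seq x m) → z ≈ 0#
null-scale q x z p e = ≈-scale q x 0# z 0# p e λ _ → sym (ℚP.*-zeroʳ q)

lin-null : ∀ (a : Fin k → ℝ) v → (∀ i → a i ≈ 0#) → lin a v ≈ 0#
lin-null {zero}  a v h = fromℚ-cong {0ℚ} refl
lin-null {suc k} a v h = null-sub (a zero * fromℚ (v zero)) neg (lin a v)
  (null-scale (v zero) (a zero) (a zero * fromℚ (v zero)) (h zero) (λ m → ℚP.*-comm (seq (a zero) m) (v zero)))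
  (null-scale (ℚ.- 1ℚ) rest neg (lin-null (a ∘ suc) (v ∘ suc) (h ∘ suc)) (λ _ → refl))
  (λ m → solve 2 (λ a b → a :+ b := a :- con (ℚ.- 1ℚ) :* b) refl (seq (a zero) m ℚ.* v zero) (seq rest m))
  where
  rest neg : ℝ
  rest = lin (a ∘ suc) (v ∘ suc)
  neg = fromℚ (ℚ.- 1ℚ) * rest

-- The coefficients of u and w vanish by subtracting the columns c₀ from the
-- columns c₁, and those of v then by the columns c₀ alone.
block-independent : ∀ {v : Fin k → Y → ℚ} {u w : Fin l → Y → ℚ} (z : Fin (k ℕ.+ l) → Z → ℚ) (c₀ c₁ : Y → Z) →
  Independent v → Independent (λ i y → w i y ℚ.- u i y) →
  (∀ i y → z (i ↑ˡ l) (c₀ y) ≡ v i y) → (∀ i y → z (i ↑ˡ l) (c₁ y) ≡ v i y) →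
  (∀ i y → z (k ↑ʳ i) (c₀ y) ≡ u i y) → (∀ i y → z (k ↑ʳ i) (c₁ y) ≡ w i y) → Independent z
block-independent {k} {Y} {l} {v = v} {u} {w} z c₀ c₁ iv iwu z₀v z₁v z₀u z₁w a h = λ i →
  subst (λ j → a j ≈ 0#) (FinP.join-splitAt k l i) (null (splitAt k i))
  where
  aˡ = a ∘ (_↑ˡ l)
  aʳ = a ∘ (k ↑ʳ_)
  col : ∀ (c : Y → _) {u : Fin l → Y → ℚ} → (∀ i y → z (i ↑ˡ l) (c y) ≡ v i y) → (∀ i y → z (k ↑ʳ i) (c y) ≡ u i y) →
    ∀ y m → seq (lin a (λ i → z i (c y))) m ≡ seq (lin aˡ (λ i → v i y)) m ℚ.+ seq (lin aʳ (λ i → u i y)) m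
  col c e e′ y m = trans (lin-split k a (λ i → z i (c y)) m)
    (cong₂ ℚ._+_ (lin-cong aˡ (λ i → e i y) m) (lin-cong aʳ (λ i → e′ i y) m))
  nullʳ : ∀ i → aʳ i ≈ 0#
  nullʳ = iwu aʳ λ y → null-sub (lin a (λ i → z i (c₁ y))) (lin a (λ i → z i (c₀ y))) (lin aʳ (λ i → w i y ℚ.- u i y))
    (h (c₁ y)) (h (c₀ y))
    (λ m → trans (lin-sub aʳ (λ i → w i y) (λ i → u i y) m) (trans
      (solve 3 (λ p q r → p :- q := (r :+ p) :- (r :+ q)) refl
        (seq (lin aʳ (λ i → w i y)) m) (seq (lin aʳ (λ i → u i y)) m) (seq (lin aˡ (λ i → v i y)) m))
      (sym (cong₂ ℚ._-_ (col c₁ z₁v z₁w y m) (col c₀ z₀v z₀u y m)))))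
  nullˡ : ∀ i → aˡ i ≈ 0#
  nullˡ = iv aˡ λ y → null-sub (lin a (λ i → z i (c₀ y))) (lin aʳ (λ i → u i y)) (lin aˡ (λ i → v i y))
    (h (c₀ y)) (lin-null aʳ (λ i → u i y) nullʳ)
    (λ m → trans
      (solve 2 (λ p q → p := (p :+ q) :- q) refl (seq (lin aˡ (λ i → v i y)) m) (seq (lin aʳ (λ i → u i y)) m))
      (cong (ℚ._- seq (lin aʳ (λ i → u i y)) m) (sym (col c₀ z₀v z₀u y m))))
  null : ∀ s → a (Fin.join k l s) ≈ 0#
  null (inj₁ i) = nullˡ i
  null (inj₂ i) = nullʳ i

column-independent : ∀ {v : Fin k → Y → ℚ} (z : Fin k → Z → ℚ) (c : Y → Z) →
  Independent v → (∀ i y → z i (c y) ≡ v i y) → Independent z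
column-independent {v = v} z c iv e a h = iv a λ y →
  null-scale 1ℚ (lin a (λ i → z i (c y))) (lin a (λ i → v i y)) (h (c y))
    (λ m → trans (sym (lin-cong a (λ i → e i y) m)) (sym (ℚP.*-identityˡ _)))

-- A combination of the rows that vanishes on the columns c₀ and c₁ vanishes on their differences,
-- where independence is known.
difference-independent : ∀ {u w : Fin k → Y → ℚ} (z : Fin k → Z → ℚ) (c₀ c₁ : Y → Z) →
  Independent (λ i y → w i y ℚ.- u i y) →
  (∀ i y → z i (c₀ y) ≡ u i y) → (∀ i y → z i (c₁ y) ≡ w i y) → Independent z
difference-independent {u = u} {w} z c₀ c₁ iwu e₀ e₁ a h = iwu a λ y →
  null-sub (lin a (λ i → z i (c₁ y))) (lin a (λ i → z i (c₀ y))) (lin a (λ i → w i y ℚ.- u i y)) (h (c₁ y)) (h (c₀ y))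
    (λ m → trans (lin-sub a (λ i → w i y) (λ i → u i y) m)
      (sym (cong₂ ℚ._-_ (lin-cong a (λ i → e₁ i y) m) (lin-cong a (λ i → e₀ i y) m))))

-- Multilinear coefficients and the growth of the rank product

lo hi ∂ : (Vec Bool (suc n) → ℚ) → Vec Bool n → ℚ
lo f x = f (false ∷ x)
hi f x = f (true ∷ x)
∂  f x = hi f x ℚ.- lo f x

-- Möbius inversion by recursion: the iterated difference in the variables of S, with all other
-- variables set to 0.
coef : (Vec Bool n → ℚ) → Subset n → ℚ
coef f []            = f []
coef f (outside ∷ S) = coef (lo f) S
coef f (inside ∷ S)  = coef (∂ f) S

coef-cong : ∀ {f g : Vec Bool n → ℚ} → (∀ x → f x ≡ g x) → ∀ S → coef f S ≡ coef g S
coef-cong e []            = e []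
coef-cong e (outside ∷ S) = coef-cong (e ∘ (false ∷_)) S
coef-cong e (inside ∷ S)  = coef-cong (λ x → cong₂ ℚ._-_ (e (true ∷ x)) (e (false ∷ x))) S

coef-+ : ∀ (f g : Vec Bool n → ℚ) S → coef (λ x → f x ℚ.+ g x) S ≡ coef f S ℚ.+ coef g S
coef-+ f g []            = refl
coef-+ f g (outside ∷ S) = coef-+ (lo f) (lo g) S
coef-+ f g (inside ∷ S)  = trans
  (coef-cong (λ x → solve 4 (λ a b c d → (a :+ b) :- (c :+ d) := (a :- c) :+ (b :- d)) refl
    (hi f x) (hi g x) (lo f x) (lo g x)) S)
  (coef-+ (∂ f) (∂ g) S)

coef-hi : ∀ (f : Vec Bool (suc n) → ℚ) S → coef (hi f) S ≡ coef f (outside ∷ S) ℚ.+ coef f (inside ∷ S)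
coef-hi f S = trans
  (coef-cong (λ x → solve 2 (λ a b → a := b :+ (a :- b)) refl (hi f x) (lo f x)) S)
  (coef-+ (lo f) (∂ f) S)

AndRows OrRows : (Vec Bool n → ℚ) → ℕ → Set
AndRows {n} f k = ∃ λ (ρ : Fin k → Vec Bool n) → Independent λ i y → f (zipWith _∧_ (ρ i) y)
OrRows  {n} f k = ∃ λ (ρ : Fin k → Vec Bool n) → Independent λ i y → f (zipWith _∨_ (ρ i) y)

module _ (f : Vec Bool (suc n) → ℚ) where

  private
    join : (b c : Bool) → (Fin k → Vec Bool n) → (Fin l → Vec Bool n) → Fin (k ℕ.+ l) → Vec Bool (suc n)
    join b c ρ σ = ((b ∷_) ∘ ρ) ⧺ ((c ∷_) ∘ σ)

  and-join : AndRows (lo f) k → AndRows (∂ f) l → AndRows f (k ℕ.+ l)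
  and-join (ρ , i) (σ , j) = join false true ρ σ ,
    block-independent _ (false ∷_) (true ∷_) i j
      (λ i y → cong (λ r → f (zipWith _∧_ r (false ∷ y))) (lookup-++ˡ ((false ∷_) ∘ ρ) ((true ∷_) ∘ σ) i))
      (λ i y → cong (λ r → f (zipWith _∧_ r (true ∷ y))) (lookup-++ˡ ((false ∷_) ∘ ρ) ((true ∷_) ∘ σ) i))
      (λ i y → cong (λ r → f (zipWith _∧_ r (false ∷ y))) (lookup-++ʳ ((false ∷_) ∘ ρ) ((true ∷_) ∘ σ) i))
      (λ i y → cong (λ r → f (zipWith _∧_ r (true ∷ y))) (lookup-++ʳ ((false ∷_) ∘ ρ) ((true ∷_) ∘ σ) i))

  -- In the OR matrix the block row that repeats itself has first bit true, so `hi` takes the place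
  -- of `lo` and the row prefixes are exchanged.
  or-join : OrRows (hi f) k → OrRows (∂ f) l → OrRows f (k ℕ.+ l)
  or-join (ρ , i) (σ , j) = join true false ρ σ ,
    block-independent _ (false ∷_) (true ∷_) i j
      (λ i y → cong (λ r → f (zipWith _∨_ r (false ∷ y))) (lookup-++ˡ ((true ∷_) ∘ ρ) ((false ∷_) ∘ σ) i))
      (λ i y → cong (λ r → f (zipWith _∨_ r (true ∷ y))) (lookup-++ˡ ((true ∷_) ∘ ρ) ((false ∷_) ∘ σ) i))
      (λ i y → cong (λ r → f (zipWith _∨_ r (false ∷ y))) (lookup-++ʳ ((true ∷_) ∘ ρ) ((false ∷_) ∘ σ) i))
      (λ i y → cong (λ r → f (zipWith _∨_ r (true ∷ y))) (lookup-++ʳ ((true ∷_) ∘ ρ) ((false ∷_) ∘ σ) i))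

  -- The embeddings of a single block serve the factor that is only a maximum, and the variables
  -- outside S.
  and-lo : AndRows (lo f) k → AndRows f k
  and-lo (ρ , i) = (false ∷_) ∘ ρ , column-independent _ (false ∷_) i λ _ _ → refl

  and-hi : AndRows (hi f) k → AndRows f k
  and-hi (ρ , i) = (true ∷_) ∘ ρ , column-independent _ (true ∷_) i λ _ _ → refl

  and-∂ : AndRows (∂ f) k → AndRows f k
  and-∂ (ρ , i) = (true ∷_) ∘ ρ ,
    difference-independent _ (false ∷_) (true ∷_) i (λ _ _ → refl) (λ _ _ → refl)

  or-lo : OrRows (lo f) k → OrRows f k
  or-lo (ρ , i) = (false ∷_) ∘ ρ , column-independent _ (false ∷_) i λ _ _ → refl

  or-∂ : OrRows (∂ f) k → OrRows f k
  or-∂ (ρ , i) = (false ∷_) ∘ ρ ,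
    difference-independent _ (false ∷_) (true ∷_) i (λ _ _ → refl) (λ _ _ → refl)

singleton-independent : ∀ (z : Fin 1 → Y → ℚ) y → z zero y ≢ 0ℚ → Independent z
singleton-independent z y q≢0 a h zero = null-scale (inv q) (lin a (λ i → z i y)) (a zero) (h y)
  (λ m → trans (trans (sym (ℚP.*-identityˡ (seq (a zero) m)))
      (cong (ℚ._* seq (a zero) m) (sym (inv-inverse q q≢0))))
    (solve 3 (λ q i a → (q :* i) :* a := i :* (a :* q :+ con 0ℚ)) refl q (inv q) (seq (a zero) m)))
  where q = z zero y

-- A sum in one factor and a maximum in the other already double the product, since both old
-- products are at least P.
⊔-*-+-≤ˡ : ∀ {P} k₁ k₂ l₁ l₂ → P ℕ.≤ k₁ ℕ.* l₁ → P ℕ.≤ k₂ ℕ.* l₂ → 2 ℕ.* P ℕ.≤ (k₁ ℕ.+ k₂) ℕ.* (l₁ ℕ.⊔ l₂)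
⊔-*-+-≤ˡ {P} k₁ k₂ l₁ l₂ p q = begin
  P ℕ.+ (P ℕ.+ 0)                             ≡⟨ cong (P ℕ.+_) (ℕP.+-identityʳ P) ⟩
  P ℕ.+ P                                     ≤⟨ ℕP.+-mono-≤ p q ⟩
  k₁ ℕ.* l₁ ℕ.+ k₂ ℕ.* l₂                     ≤⟨ ℕP.+-mono-≤ (ℕP.*-monoʳ-≤ k₁ (ℕP.m≤m⊔n l₁ l₂))
                                                             (ℕP.*-monoʳ-≤ k₂ (ℕP.m≤n⊔m l₁ l₂)) ⟩
  k₁ ℕ.* (l₁ ℕ.⊔ l₂) ℕ.+ k₂ ℕ.* (l₁ ℕ.⊔ l₂)   ≡⟨ sym (ℕP.*-distribʳ-+ (l₁ ℕ.⊔ l₂) k₁ k₂) ⟩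
  (k₁ ℕ.+ k₂) ℕ.* (l₁ ℕ.⊔ l₂)                 ∎
  where open ℕP.≤-Reasoning

-- The maximum is one of its two arguments, so families of rows never have to be shortened or
-- padded.
⊔-preserves : ∀ (P : ℕ → Set) {a b} → P a → P b → P (a ℕ.⊔ b)
⊔-preserves P {a} {b} p q with ℕP.⊔-sel a b
... | inj₁ e = subst P (sym e) p
... | inj₂ e = subst P (sym e) q

record Spread (f : Vec Bool n → ℚ) (P : ℕ) : Set where
  constructor spread
  field
    {andRank orRank} : ℕ
    andRows          : AndRows f andRank
    orRows           : OrRows f orRank
    bound            : P ℕ.≤ andRank ℕ.* orRank

module _ {f : Vec Bool (suc n) → ℚ} {P : ℕ} where

  spread-lo : Spread (lo f) P → Spread f P
  spread-lo (spread A O b) = spread (and-lo f A) (or-lo f O) b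

  spread-lo-∂ : Spread (lo f) P → Spread (∂ f) P → Spread f (2 ℕ.* P)
  spread-lo-∂ (spread {k₀} {l₀} A₀ O₀ b₀) (spread {k} {l} A O b) = spread (and-join f A₀ A)
    (⊔-preserves (OrRows f) (or-lo f O₀) (or-∂ f O)) (⊔-*-+-≤ˡ k₀ k l₀ l b₀ b)

  spread-hi-∂ : Spread (hi f) P → Spread (∂ f) P → Spread f (2 ℕ.* P)
  spread-hi-∂ (spread {k₁} {l₁} A₁ O₁ b₁) (spread {k} {l} A O b) =
    spread (⊔-preserves (AndRows f) (and-hi f A₁) (and-∂ f A)) (or-join f O₁ O)
      (swap (l₁ ℕ.+ l) (k₁ ℕ.⊔ k) (⊔-*-+-≤ˡ l₁ l k₁ k (swap k₁ l₁ b₁) (swap k l b)))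
    where
    swap : ∀ {P} a b → P ℕ.≤ a ℕ.* b → P ℕ.≤ b ℕ.* a
    swap {P} a b = subst (P ℕ.≤_) (ℕP.*-comm a b)

-- With f = f₀ + x (f₁ − f₀): if f₀ has a nonzero coefficient at S as well,
-- the AND rank is at least the sum, and the OR rank at least the maximum,
-- of the ranks of f₀ and f₁ − f₀.  If f₀ has none, then f₁ has one and the
-- roles of AND and OR are exchanged.
uncertainty : ∀ (f : Vec Bool n → ℚ) S → coef f S ≢ 0ℚ → Spread f (2 ℕ.^ ∣ S ∣)
uncertainty f [] q≢0 = spread {andRank = 1} {orRank = 1}
  ((λ _ → []) , singleton-independent (λ _ y → f (zipWith _∧_ [] y)) [] q≢0)
  ((λ _ → []) , singleton-independent (λ _ y → f (zipWith _∨_ [] y)) [] q≢0) (s≤s z≤n)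
uncertainty f (outside ∷ S) q≢0 = spread-lo (uncertainty (lo f) S q≢0)
uncertainty f (inside ∷ S) q≢0 with coef (lo f) S ℚP.≟ 0ℚ
... | no lo≢0  = spread-lo-∂ (uncertainty (lo f) S lo≢0) (uncertainty (∂ f) S q≢0)
... | yes lo≡0 = spread-hi-∂ (uncertainty (hi f) S hi≢0) (uncertainty (∂ f) S q≢0)
  where
  hi≢0 : coef (hi f) S ≢ 0ℚ
  hi≢0 hi≡0 = q≢0 (trans (sym (ℚP.+-identityˡ _))
    (trans (cong (ℚ._+ coef (∂ f) S) (sym lo≡0)) (trans (sym (coef-hi f S)) hi≡0)))

-- Coefficients of a representing polynomial, and numerical bounds

≈-sym : ∀ x y → x ≈ y → y ≈ x
≈-sym x y h ε 0<ε = let N , b = h ε 0<ε in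
  N , λ m g → subst (ℚ._≤ ε) (∣-∣-comm (seq x m) (seq y m)) (b m g)

≈-respʳ : ∀ x y z → x ≈ y → (∀ m → seq y m ≡ seq z m) → x ≈ z
≈-respʳ x y z h e ε 0<ε = let N , b = h ε 0<ε in
  N , λ m g → subst (λ q → ℚ.∣ seq x m ℚ.- q ∣ ℚ.≤ ε) (e m) (b m g)

sumSubsets-cong : ∀ (g h : Subset n → ℝ) {m} → (∀ S → seq (g S) m ≡ seq (h S) m) →
  seq (sumSubsets g) m ≡ seq (sumSubsets h) m
sumSubsets-cong {zero}  g h e = e []
sumSubsets-cong {suc n} g h e = cong₂ ℚ._+_
  (sumSubsets-cong (g ∘ (outside ∷_)) (h ∘ (outside ∷_)) (e ∘ (outside ∷_)))
  (sumSubsets-cong (g ∘ (inside ∷_)) (h ∘ (inside ∷_)) (e ∘ (inside ∷_)))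

sumSubsets-null : ∀ (g : Subset n → ℝ) {m} → (∀ S → seq (g S) m ≡ 0ℚ) → seq (sumSubsets g) m ≡ 0ℚ
sumSubsets-null {zero}  g e = e []
sumSubsets-null {suc n} g e = cong₂ ℚ._+_
  (sumSubsets-null (g ∘ (outside ∷_)) (e ∘ (outside ∷_)))
  (sumSubsets-null (g ∘ (inside ∷_)) (e ∘ (inside ∷_)))

Represents : (Subset n → ℝ) → (Vec Bool n → ℚ) → Set
Represents α f = ∀ x → fromℚ (f x) ≈ sumSubsets (λ S → α S * monomial S x)

module _ (α : Subset (suc n) → ℝ) (x : Vec Bool n) where

  private
    value : Bool → ℝ
    value b = sumSubsets (λ S → α S * monomial S (b ∷ x))
    part : Bool → ℝ
    part s = sumSubsets (λ S → α (s ∷ S) * monomial S x)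

  value-false : ∀ m → seq (value false) m ≡ seq (part outside) m
  value-false m = trans
    (cong₂ ℚ._+_
      (sumSubsets-cong (λ S → α (outside ∷ S) * monomial (outside ∷ S) (false ∷ x)) _
        (λ S → cong (seq (α (outside ∷ S)) m ℚ.*_) (ℚP.*-identityˡ _)))
      (sumSubsets-null (λ S → α (inside ∷ S) * monomial (inside ∷ S) (false ∷ x))
        (λ S → trans (cong (seq (α (inside ∷ S)) m ℚ.*_) (ℚP.*-zeroˡ (seq (monomial S x) m)))
          (ℚP.*-zeroʳ (seq (α (inside ∷ S)) m)))))
    (ℚP.+-identityʳ _)

  value-true : ∀ m → seq (value true) m ≡ seq (part outside) m ℚ.+ seq (part inside) m
  value-true m = cong₂ ℚ._+_
    (sumSubsets-cong (λ S → α (outside ∷ S) * monomial (outside ∷ S) (true ∷ x)) _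
      (λ S → cong (seq (α (outside ∷ S)) m ℚ.*_) (ℚP.*-identityˡ _)))
    (sumSubsets-cong (λ S → α (inside ∷ S) * monomial (inside ∷ S) (true ∷ x)) _
      (λ S → cong (seq (α (inside ∷ S)) m ℚ.*_) (ℚP.*-identityˡ _)))

represents-lo : ∀ (α : Subset (suc n) → ℝ) f → Represents α f → Represents (α ∘ (outside ∷_)) (lo f)
represents-lo α f h x = ≈-respʳ (fromℚ (lo f x)) (sumSubsets (λ S → α S * monomial S (false ∷ x)))
  (sumSubsets (λ S → α (outside ∷ S) * monomial S x)) (h (false ∷ x)) (value-false α x)

represents-∂ : ∀ (α : Subset (suc n) → ℝ) f → Represents α f → Represents (α ∘ (inside ∷_)) (∂ f)
represents-∂ α f h x = ≈-sub (fromℚ (hi f x)) (sumSubsets (λ S → α S * monomial S (true ∷ x)))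
  (fromℚ (lo f x)) (sumSubsets (λ S → α S * monomial S (false ∷ x)))
  (fromℚ (∂ f x)) (sumSubsets (λ S → α (inside ∷ S) * monomial S x)) (h (true ∷ x)) (h (false ∷ x))
  (λ _ → refl)
  (λ m → trans (solve 2 (λ a b → b := (a :+ b) :- a) refl
      (seq (sumSubsets (λ S → α (outside ∷ S) * monomial S x)) m)
      (seq (sumSubsets (λ S → α (inside ∷ S) * monomial S x)) m))
    (sym (cong₂ ℚ._-_ (value-true α x m) (value-false α x m))))

-- Setting a variable to 0 keeps the monomials without it, and taking the difference keeps those
-- with it; after all variables a single coefficient is left. This carries the real coefficients of
-- `IsDegree` over to the rational `coef`.
represents-unique : ∀ {n} (α : Subset n → ℝ) f → Represents α f → ∀ S → α S ≈ fromℚ (coef f S)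
represents-unique α f h []            = ≈-sym (fromℚ (f [])) (α [])
  (≈-respʳ (fromℚ (f [])) (α [] * 1#) (α []) (h []) (λ m → ℚP.*-identityʳ (seq (α []) m)))
represents-unique α f h (outside ∷ S) = represents-unique (α ∘ (outside ∷_)) (lo f) (represents-lo α f h) S
represents-unique α f h (inside ∷ S)  = represents-unique (α ∘ (inside ∷_)) (∂ f) (represents-∂ α f h) S

signℚ : Sign → ℚ
signℚ Sign.+ = 1ℚ
signℚ Sign.- = ℚ.- 1ℚ

fromℚ-signℚ : ∀ s → fromℚ (signℚ s) ≡ signℝ s
fromℚ-signℚ Sign.+ = refl
fromℚ-signℚ Sign.- = refl

sum-cong : ∀ {v w : Fin k → ℝ} → (∀ i → v i ≡ w i) → sum v ≡ sum w
sum-cong {zero}  e = refl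
sum-cong {suc k} e = cong₂ _+_ (e zero) (sum-cong (e ∘ suc))

independent-cong : ∀ {v w : Fin k → Y → ℝ} → (∀ i j → v i j ≡ w i j) →
  LinearlyIndependent v → LinearlyIndependent w
independent-cong e iv a h = iv a λ j → subst (_≈ 0#) (sum-cong (λ i → cong (a i *_) (sym (e i j)))) (h j)

-- The numbers r₁ and r₂ enter through maximality alone, so the rank of the matrix of F, which
-- contains both matrices as blocks of rows, can stand for either of them.
rank-product : ∀ (f : Vec Bool n → Sign) S {r₁ r₂} → coef (signℚ ∘ f) S ≢ 0ℚ →
  (∀ k ρ → LinearlyIndependent {k} (andMatrix f ∘ ρ) → k ℕ.≤ r₁) →
  (∀ k ρ → LinearlyIndependent {k} (orMatrix f ∘ ρ) → k ℕ.≤ r₂) →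
  2 ℕ.^ ∣ S ∣ ℕ.≤ r₁ ℕ.* r₂
rank-product f S q≢0 max₁ max₂ with uncertainty (signℚ ∘ f) S q≢0
... | spread {k} {l} (ρ , i) (σ , j) b = ℕP.≤-trans b (ℕP.*-mono-≤
  (max₁ k ρ (independent-cong (λ i y → fromℚ-signℚ (f (zipWith _∧_ (ρ i) y))) i))
  (max₂ l σ (independent-cong (λ i y → fromℚ-signℚ (f (zipWith _∨_ (σ i) y))) j)))

-- Powers and rational bounds for 3/(2√2)

ι : ℕ → ℚ
ι m = + m ℚ./ 1

ι-+ : ∀ a b → ι (a ℕ.+ b) ≡ ι a ℚ.+ ι b
ι-+ zero    b = sym (ℚP.+-identityˡ (ι b))
ι-+ (suc a) b = trans (/-suc (a ℕ.+ b) 0) (trans (cong (ℚ._+ 1ℚ) (ι-+ a b)) (trans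
  (solve 3 (λ a b c → (a :+ b) :+ c := (a :+ c) :+ b) refl (ι a) (ι b) 1ℚ)
  (cong (ℚ._+ ι b) (sym (/-suc a 0)))))

ι-* : ∀ a b → ι (a ℕ.* b) ≡ ι a ℚ.* ι b
ι-* zero    b = sym (ℚP.*-zeroˡ (ι b))
ι-* (suc a) b = trans (ι-+ b (a ℕ.* b)) (trans (cong (ι b ℚ.+_) (ι-* a b)) (trans
  (solve 2 (λ a b → b :+ a :* b := (a :+ con 1ℚ) :* b) refl (ι a) (ι b))
  (cong (ℚ._* ι b) (sym (/-suc a 0)))))

ι-mono : ∀ {a b} → a ℕ.≤ b → ι a ℚ.≤ ι b
ι-mono {a} {b} h = /-mono a b 0 0 (ℕP.*-monoˡ-≤ 1 h)

ι-nonNeg : ∀ a → 0ℚ ℚ.≤ ι a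
ι-nonNeg a = ι-mono {0} {a} z≤n

ι-^ : ∀ a d → ι (a ℕ.^ d) ≡ ι a ^ℚ d
ι-^ a zero    = refl
ι-^ a (suc d) = trans (ι-* a (a ℕ.^ d)) (cong (ι a ℚ.*_) (ι-^ a d))

seq-^ : ∀ x d m → seq (x ^ d) m ≡ seq x m ^ℚ d
seq-^ x zero    m = refl
seq-^ x (suc d) m = cong (seq x m ℚ.*_) (seq-^ x d m)

^ℚ-nonNeg : ∀ {p} d → 0ℚ ℚ.≤ p → 0ℚ ℚ.≤ p ^ℚ d
^ℚ-nonNeg zero    0≤p = ℚP.<⇒≤ 0<1
^ℚ-nonNeg {p} (suc d) 0≤p = subst (ℚ._≤ p ℚ.* p ^ℚ d) (ℚP.*-zeroʳ 0ℚ)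
  (*-mono-≤ ℚP.≤-refl 0≤p 0≤p (^ℚ-nonNeg d 0≤p))

^ℚ-mono-≤ : ∀ {p q} d → 0ℚ ℚ.≤ p → p ℚ.≤ q → p ^ℚ d ℚ.≤ q ^ℚ d
^ℚ-mono-≤ zero    0≤p p≤q = ℚP.≤-refl
^ℚ-mono-≤ (suc d) 0≤p p≤q =
  *-mono-≤ (^ℚ-nonNeg d 0≤p) (ℚP.≤-trans 0≤p p≤q) p≤q (^ℚ-mono-≤ d 0≤p p≤q)

^ℚ-distrib-* : ∀ p q d → (p ℚ.* q) ^ℚ d ≡ p ^ℚ d ℚ.* q ^ℚ d
^ℚ-distrib-* p q zero    = refl
^ℚ-distrib-* p q (suc d) = trans (cong (p ℚ.* q ℚ.*_) (^ℚ-distrib-* p q d))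
  (solve 4 (λ p q r s → (p :* q) :* (r :* s) := (p :* r) :* (q :* s)) refl p q (p ^ℚ d) (q ^ℚ d))

square-cancel-≤ : ∀ {p q} → 0ℚ ℚ.≤ q → p ℚ.* p ℚ.≤ q ℚ.* q → p ℚ.≤ q
square-cancel-≤ {p} {q} 0≤q h = ℚP.≮⇒≥ λ q<p → ℚP.<-irrefl refl (begin-strict
  q ℚ.* q ≤⟨ ℚP.*-monoˡ-≤-nonNeg q {{ℚ.nonNegative 0≤q}} (ℚP.<⇒≤ q<p) ⟩
  q ℚ.* p <⟨ ℚP.*-monoˡ-<-pos p {{ℚ.positive (ℚP.≤-<-trans 0≤q q<p)}} q<p ⟩
  p ℚ.* p ≤⟨ h ⟩
  q ℚ.* q ∎)
  where open ℚP.≤-Reasoning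

≤-eventually : ∀ x y → Eventually (λ m → seq x m ℚ.≤ seq y m) → x ≤ y
≤-eventually x y (N , b) ε 0<ε = N , λ m h → ℚP.≤-trans (b m h)
  (subst (ℚ._≤ seq y m ℚ.+ ε) (ℚP.+-identityʳ (seq y m)) (ℚP.+-monoʳ-≤ (seq y m) (ℚP.<⇒≤ 0<ε)))

-- Stated for arbitrary r, since ⌊√ 2 * (K * K) ⌋ unfolds badly.
module RootTwo (K r : ℕ) (r²≤2K² : r ℕ.* r ℕ.≤ 2 ℕ.* (K ℕ.* K))
  (2K²<[1+r]² : 2 ℕ.* (K ℕ.* K) ℕ.< suc r ℕ.* suc r) where
  open ℕP.≤-Reasoning

  -- The bound r/K ≥ 9/8 makes 3/(2 r/K) at most 4/3. Rounding down costs at most 1/K ≤ 1/4, and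
  -- (9/8 + 1/4)² = 121/64 < 2.
  lower : 4 ℕ.≤ K → 9 ℕ.* K ℕ.≤ r ℕ.* 8
  lower 4≤K = ℕP.≮⇒≥ λ r<9K → ℕP.<-irrefl refl (begin-strict
    121 ℕ.* (K ℕ.* K)                    ≤⟨ ℕP.*-monoˡ-≤ (K ℕ.* K) (ℕP.≤ᵇ⇒≤ 121 128 _) ⟩
    128 ℕ.* (K ℕ.* K)                    ≡⟨ lem₁ K ⟩
    64 ℕ.* (2 ℕ.* (K ℕ.* K))             <⟨ ℕP.*-monoʳ-< 64 2K²<[1+r]² ⟩
    64 ℕ.* (suc r ℕ.* suc r)             ≡⟨ lem₂ r ⟩
    (suc (r ℕ.* 8) ℕ.+ 7) ℕ.* (suc (r ℕ.* 8) ℕ.+ 7) ≤⟨ ℕP.*-mono-≤ (bound r<9K) (bound r<9K) ⟩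
    (11 ℕ.* K) ℕ.* (11 ℕ.* K)            ≡⟨ lem₃ K ⟩
    121 ℕ.* (K ℕ.* K)                    ∎)
    where
    lem₁ : ∀ K → 128 ℕ.* (K ℕ.* K) ≡ 64 ℕ.* (2 ℕ.* (K ℕ.* K))
    lem₁ = solve-∀
    lem₂ : ∀ r → 64 ℕ.* (suc r ℕ.* suc r) ≡ (suc (r ℕ.* 8) ℕ.+ 7) ℕ.* (suc (r ℕ.* 8) ℕ.+ 7)
    lem₂ = solve-∀
    lem₃ : ∀ K → (11 ℕ.* K) ℕ.* (11 ℕ.* K) ≡ 121 ℕ.* (K ℕ.* K)
    lem₃ = solve-∀
    lem₄ : ∀ K → 9 ℕ.* K ℕ.+ 2 ℕ.* K ≡ 11 ℕ.* K
    lem₄ = solve-∀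
    bound : suc (r ℕ.* 8) ℕ.≤ 9 ℕ.* K → suc (r ℕ.* 8) ℕ.+ 7 ℕ.≤ 11 ℕ.* K
    bound h = begin
      suc (r ℕ.* 8) ℕ.+ 7   ≤⟨ ℕP.+-mono-≤ h (ℕP.≤-trans (ℕP.n≤1+n 7) (ℕP.*-monoʳ-≤ 2 4≤K)) ⟩
      9 ℕ.* K ℕ.+ 2 ℕ.* K   ≡⟨ lem₄ K ⟩
      11 ℕ.* K              ∎

  -- The fraction 75/53 is exactly 3/(2 · 1.06), and 75² = 2 · 53² + 7.
  upper : r ℕ.* 53 ℕ.≤ 75 ℕ.* K
  upper = ℕP.≮⇒≥ λ 75K<r → ℕP.<-irrefl refl (begin-strict
    (75 ℕ.* K) ℕ.* (75 ℕ.* K)     <⟨ ℕP.*-mono-< 75K<r 75K<r ⟩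
    (r ℕ.* 53) ℕ.* (r ℕ.* 53)     ≡⟨ lem₁ r ⟩
    2809 ℕ.* (r ℕ.* r)            ≤⟨ ℕP.*-monoʳ-≤ 2809 r²≤2K² ⟩
    2809 ℕ.* (2 ℕ.* (K ℕ.* K))    ≤⟨ ℕP.m≤m+n (2809 ℕ.* (2 ℕ.* (K ℕ.* K))) (7 ℕ.* (K ℕ.* K)) ⟩
    2809 ℕ.* (2 ℕ.* (K ℕ.* K)) ℕ.+ 7 ℕ.* (K ℕ.* K) ≡⟨ lem₂ K ⟩
    (75 ℕ.* K) ℕ.* (75 ℕ.* K)     ∎)
    where
    lem₁ : ∀ r → (r ℕ.* 53) ℕ.* (r ℕ.* 53) ≡ 2809 ℕ.* (r ℕ.* r)
    lem₁ = solve-∀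
    lem₂ : ∀ K → 2809 ℕ.* (2 ℕ.* (K ℕ.* K)) ℕ.+ 7 ℕ.* (K ℕ.* K) ≡ (75 ℕ.* K) ℕ.* (75 ℕ.* K)
    lem₂ = solve-∀

  positive : 1 ℕ.≤ K → 1 ℕ.≤ r
  positive 1≤K = ℕP.≮⇒≥ λ r<1 → ℕP.<-irrefl refl (begin-strict
    1                   <⟨ s≤s (s≤s z≤n) ⟩
    2 ℕ.* (1 ℕ.* 1)     ≤⟨ ℕP.*-monoʳ-≤ 2 (ℕP.*-mono-≤ 1≤K 1≤K) ⟩
    2 ℕ.* (K ℕ.* K)     <⟨ 2K²<[1+r]² ⟩
    suc r ℕ.* suc r     ≤⟨ ℕP.*-mono-≤ r<1 r<1 ⟩
    1                   ∎)

ratio-upper : ∀ K r .{{_ : ℕ.NonZero K}} → 9 ℕ.* K ℕ.≤ r ℕ.* 8 → ι 3 ℚ.* inv (ι 2 ℚ.* (+ r ℚ./ K)) ℚ.≤ + 4 ℚ./ 3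
ratio-upper (suc m) r h = ℚP.*-monoˡ-≤-nonNeg (ι 3)
  (inv-antimono {+ 9 ℚ./ 4} {ι 2 ℚ.* (+ r ℚ./ suc m)} (ℚP.positive⁻¹ (+ 9 ℚ./ 4))
    (ℚP.*-monoˡ-≤-nonNeg (ι 2) (/-mono 9 r 7 m h)))

ratio-lower : ∀ K r .{{_ : ℕ.NonZero K}} → 1 ℕ.≤ r → r ℕ.* 53 ℕ.≤ 75 ℕ.* K →
  + 106 ℚ./ 100 ℚ.≤ ι 3 ℚ.* inv (ι 2 ℚ.* (+ r ℚ./ K))
ratio-lower (suc m) r 1≤r h = ℚP.*-monoˡ-≤-nonNeg (ι 3)
  (inv-antimono {ι 2 ℚ.* (+ r ℚ./ suc m)} {+ 150 ℚ./ 53} (0<p*q (ℚP.positive⁻¹ (ι 2)) 0<r/K)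
    (ℚP.*-monoˡ-≤-nonNeg (ι 2) (/-mono r 75 m 52 h)))
  where
  0<r/K : 0ℚ ℚ.< + r ℚ./ suc m
  0<r/K = ℚP.<-≤-trans (ℚP.positive⁻¹ _ {{ℚP.normalize-pos 1 (suc m)}})
    (/-mono 1 r m m (ℕP.*-monoˡ-≤ (suc m) 1≤r))

module RootBounds (m : ℕ) = RootTwo (suc m) ⌊√ 2 ℕ.* (suc m ℕ.* suc m) ⌋
  (⌊√⌋-lower (2 ℕ.* (suc m ℕ.* suc m))) (⌊√⌋-upper (2 ℕ.* (suc m ℕ.* suc m)))

seq-3/2√2 : ∀ m → seq 3/2√2 m ≡ ι 3 ℚ.* inv (ι 2 ℚ.* (+ ⌊√ 2 ℕ.* (suc m ℕ.* suc m) ⌋ ℚ./ suc m))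
seq-3/2√2 m = refl

3/2√2-upper : ∀ m → 3 ℕ.≤ m → seq 3/2√2 m ℚ.≤ + 4 ℚ./ 3
3/2√2-upper m 3≤m = subst (ℚ._≤ + 4 ℚ./ 3) (sym (seq-3/2√2 m))
  (ratio-upper (suc m) ⌊√ 2 ℕ.* (suc m ℕ.* suc m) ⌋ (RootBounds.lower m (s≤s 3≤m)))

3/2√2-lower : ∀ m → + 106 ℚ./ 100 ℚ.≤ seq 3/2√2 m
3/2√2-lower m = subst (+ 106 ℚ./ 100 ℚ.≤_) (sym (seq-3/2√2 m))
  (ratio-lower (suc m) ⌊√ 2 ℕ.* (suc m ℕ.* suc m) ⌋ (RootBounds.positive m (s≤s z≤n)) (RootBounds.upper m))

1·06^d≤3/2√2^d : ∀ d → 3/2√2 ^ d ≥ 1·06 ^ d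
1·06^d≤3/2√2^d d = ≤-eventually (1·06 ^ d) (3/2√2 ^ d) (0 , λ m _ →
  subst₂ ℚ._≤_ (sym (seq-^ 1·06 d m)) (sym (seq-^ 3/2√2 d m))
    (^ℚ-mono-≤ d (ℚP.nonNegative⁻¹ (+ 106 ℚ./ 100)) (3/2√2-lower m)))

-- (4/3)² ≤ 2, and eventually the approximations of 3/(2√2) are at most 4/3.
3/2√2^d≤ : ∀ d R → 2 ℕ.^ d ℕ.≤ R ℕ.* R → fromℕ R ≥ 3/2√2 ^ d
3/2√2^d≤ d R h = ≤-eventually (3/2√2 ^ d) (fromℕ R) (3 , λ m 3≤m → begin
  seq (3/2√2 ^ d) m     ≡⟨ seq-^ 3/2√2 d m ⟩
  seq 3/2√2 m ^ℚ d      ≤⟨ ^ℚ-mono-≤ d (ℚP.≤-trans (ℚP.nonNegative⁻¹ (+ 106 ℚ./ 100)) (3/2√2-lower m)) (3/2√2-upper m 3≤m) ⟩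
  (+ 4 ℚ./ 3) ^ℚ d      ≤⟨ square-cancel-≤ (ι-nonNeg R) sq ⟩
  ι R                   ∎)
  where
  open ℚP.≤-Reasoning
  sq : (+ 4 ℚ./ 3) ^ℚ d ℚ.* (+ 4 ℚ./ 3) ^ℚ d ℚ.≤ ι R ℚ.* ι R
  sq = begin
    (+ 4 ℚ./ 3) ^ℚ d ℚ.* (+ 4 ℚ./ 3) ^ℚ d ≡⟨ sym (^ℚ-distrib-* (+ 4 ℚ./ 3) (+ 4 ℚ./ 3) d) ⟩
    (+ 16 ℚ./ 9) ^ℚ d  ≤⟨ ^ℚ-mono-≤ d (ℚP.nonNegative⁻¹ (+ 16 ℚ./ 9)) (/-mono 16 2 8 0 (ℕP.≤ᵇ⇒≤ 16 18 _)) ⟩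
    ι 2 ^ℚ d           ≡⟨ sym (ι-^ 2 d) ⟩
    ι (2 ℕ.^ d)        ≤⟨ ι-mono h ⟩
    ι (R ℕ.* R)        ≡⟨ ι-* R R ⟩
    ι R ℚ.* ι R        ∎

degree-coef : ∀ {f : Vec Bool n → Sign} {d} → IsDegree (λ x → signℝ (f x)) d →
  ∃ λ S → coef (signℚ ∘ f) S ≢ 0ℚ × ∣ S ∣ ≡ d
degree-coef {f = f} D = go attained
  where
  open IsDegree D
  unique : ∀ S → α S ≈ fromℚ (coef (signℚ ∘ f) S)
  unique = represents-unique α (signℚ ∘ f)
    λ x → subst (_≈ sumSubsets (λ S → α S * monomial S x)) (sym (fromℚ-signℚ (f x))) (represents x)
  go : (∃ λ S → (α S ≉ 0#) × ∣ S ∣ ≡ _) → ∃ λ S → coef (signℚ ∘ f) S ≢ 0ℚ × ∣ S ∣ ≡ _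
  go (S , αS≉0 , e) = S , (λ c≡0 → αS≉0 (subst (λ q → α S ≈ fromℚ q) c≡0 (unique S))) , e

rank-bound : ∀ {f : Vec Bool n → Sign} {d r₁ r₂} → IsDegree (λ x → signℝ (f x)) d →
  IsRank (andMatrix f) r₁ → IsRank (orMatrix f) r₂ → fromℕ (r₁ ℕ.⊔ r₂) ≥ 3/2√2 ^ d
rank-bound {f = f} {d} {r₁} {r₂} D A O = 3/2√2^d≤ d (r₁ ℕ.⊔ r₂) (ℕP.≤-trans (go (degree-coef D))
  (ℕP.*-mono-≤ (ℕP.m≤m⊔n r₁ r₂) (ℕP.m≤n⊔m r₁ r₂)))
  where
  go : (∃ λ S → coef (signℚ ∘ f) S ≢ 0ℚ × ∣ S ∣ ≡ d) → 2 ℕ.^ d ℕ.≤ r₁ ℕ.* r₂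
  go (S , c≢0 , e) = subst (λ d → 2 ℕ.^ d ℕ.≤ r₁ ℕ.* r₂) e
    (rank-product f S c≢0 (IsRank.maximal A) (IsRank.maximal O))

-- Alternating binomial sums of polynomials

double : ℕ → ℕ
double zero    = zero
double (suc d) = suc (suc (double d))

double≡+ : ∀ d → double d ≡ d ℕ.+ d
double≡+ zero    = refl
double≡+ (suc d) = cong suc (trans (cong suc (double≡+ d)) (sym (ℕP.+-suc d d)))

absorption : ∀ n k → suc k ℕ.* (suc n C suc k) ≡ suc n ℕ.* (n C k)
absorption zero    zero    = refl
absorption zero    (suc k) = trans (cong (suc (suc k) ℕ.*_) (k>n⇒nCk≡0 {1} {suc (suc k)} (s≤s (s≤s z≤n))))
  (ℕP.*-zeroʳ (suc (suc k)))
absorption (suc n) zero    = trans (ℕP.+-identityʳ _) (trans (nC1≡n (suc (suc n))) (sym (ℕP.*-identityʳ (suc (suc n)))))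
absorption (suc n) (suc k) = begin
  suc (suc k) ℕ.* (suc (suc n) C suc (suc k))
    ≡⟨ cong (suc (suc k) ℕ.*_) (sym (nCk+nC[k+1]≡[n+1]C[k+1] (suc n) (suc k))) ⟩
  suc (suc k) ℕ.* (a ℕ.+ (suc n C suc (suc k)))
    ≡⟨ lem₁ k a (suc n C suc (suc k)) ⟩
  a ℕ.+ (suc k ℕ.* a ℕ.+ suc (suc k) ℕ.* (suc n C suc (suc k)))
    ≡⟨ cong (a ℕ.+_) (cong₂ ℕ._+_ (absorption n k) (absorption n (suc k))) ⟩
  a ℕ.+ (suc n ℕ.* (n C k) ℕ.+ suc n ℕ.* (n C suc k))
    ≡⟨ cong (a ℕ.+_) (sym (ℕP.*-distribˡ-+ (suc n) (n C k) (n C suc k))) ⟩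
  a ℕ.+ suc n ℕ.* ((n C k) ℕ.+ (n C suc k))
    ≡⟨ cong (λ b → a ℕ.+ suc n ℕ.* b) (nCk+nC[k+1]≡[n+1]C[k+1] n k) ⟩
  suc (suc n) ℕ.* a ∎
  where
  open ≡-Reasoning
  a = suc n C suc k
  lem₁ : ∀ k a b → suc (suc k) ℕ.* (a ℕ.+ b) ≡ a ℕ.+ (suc k ℕ.* a ℕ.+ suc (suc k) ℕ.* b)
  lem₁ = solve-∀

-- The ratio C(2d + 2, d + 1) / C(2d, d) = 2 (2d + 1) / (d + 1), cleared of denominators.
central-step : ∀ d → suc (suc (double d)) ℕ.* (double (suc d) C suc d) ≡ 4 ℕ.* (suc (double d) ℕ.* (double d C d))
central-step d = begin
  suc (suc N) ℕ.* c               ≡⟨ cong (ℕ._* c) N+2 ⟩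
  2 ℕ.* suc d ℕ.* c               ≡⟨ lem₁ (suc d) c ⟩
  2 ℕ.* (suc d ℕ.* c)             ≡⟨ cong (λ x → 2 ℕ.* (suc d ℕ.* x)) c≡2b ⟩
  2 ℕ.* (suc d ℕ.* (2 ℕ.* b))     ≡⟨ lem₂ (suc d) b ⟩
  4 ℕ.* (suc d ℕ.* b)             ≡⟨ cong (4 ℕ.*_) (absorption N d) ⟩
  4 ℕ.* (suc N ℕ.* (N C d))       ∎
  where
  open ≡-Reasoning
  N = double d
  a = suc N C d
  b = suc N C suc d
  c = suc (suc N) C suc d
  lem₁ : ∀ x c → 2 ℕ.* x ℕ.* c ≡ 2 ℕ.* (x ℕ.* c)
  lem₁ = solve-∀
  lem₂ : ∀ x b → 2 ℕ.* (x ℕ.* (2 ℕ.* b)) ≡ 4 ℕ.* (x ℕ.* b)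
  lem₂ = solve-∀
  lem₃ : ∀ x a → 2 ℕ.* x ℕ.* a ≡ x ℕ.* (a ℕ.+ a)
  lem₃ = solve-∀
  N+2 : suc (suc N) ≡ 2 ℕ.* suc d
  N+2 = trans (double≡+ (suc d)) (cong (suc d ℕ.+_) (sym (ℕP.+-identityʳ (suc d))))
  c≡a+a : c ≡ a ℕ.+ a
  c≡a+a = ℕP.*-cancelˡ-≡ c (a ℕ.+ a) (suc d)
    (trans (absorption (suc N) d) (trans (cong (ℕ._* a) N+2) (lem₃ (suc d) a)))
  -- The symmetry C(2d + 1, d + 1) = C(2d + 1, d), read off from Pascal's rule and c = 2a.
  b≡a : b ≡ a
  b≡a = ℕP.+-cancelˡ-≡ a b a (trans (nCk+nC[k+1]≡[n+1]C[k+1] (suc N) d) c≡a+a)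
  c≡2b : c ≡ 2 ℕ.* b
  c≡2b = trans c≡a+a (trans (cong₂ ℕ._+_ (sym b≡a) (sym b≡a)) (cong (b ℕ.+_) (sym (ℕP.+-identityʳ b))))

central-lower : ∀ d → 2 ℕ.^ double d ℕ.≤ suc (double d) ℕ.* (double d C d)
central-lower zero    = ℕP.≤-refl
central-lower (suc d) = begin
  2 ℕ.* (2 ℕ.* 2 ℕ.^ N)                       ≡⟨ lem (2 ℕ.^ N) ⟩
  4 ℕ.* 2 ℕ.^ N                               ≤⟨ ℕP.*-monoʳ-≤ 4 (central-lower d) ⟩
  4 ℕ.* (suc N ℕ.* (N C d))                   ≡⟨ sym (central-step d) ⟩
  suc (suc N) ℕ.* (suc (suc N) C suc d)       ≤⟨ ℕP.*-monoˡ-≤ (suc (suc N) C suc d) (ℕP.n≤1+n (suc (suc N))) ⟩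
  suc (suc (suc N)) ℕ.* (suc (suc N) C suc d) ∎
  where
  open ℕP.≤-Reasoning
  N = double d
  lem : ∀ x → 2 ℕ.* (2 ℕ.* x) ≡ 4 ℕ.* x
  lem = solve-∀

-- binomialSum n f i = Σⱼ (n C j) f (i + j).
binomialSum : ℕ → (ℕ → ℚ) → ℕ → ℚ
binomialSum zero    f i = f i
binomialSum (suc n) f i = binomialSum n f i ℚ.+ binomialSum n f (suc i)

Annihilated : ℕ → (ℕ → ℚ) → Set
Annihilated n f = ∀ i → binomialSum n f i ≡ 0ℚ

binomialSum-cong : ∀ n {f g} → (∀ i → f i ≡ g i) → ∀ i → binomialSum n f i ≡ binomialSum n g i
binomialSum-cong zero    e i = e i
binomialSum-cong (suc n) e i = cong₂ ℚ._+_ (binomialSum-cong n e i) (binomialSum-cong n e (suc i))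

binomialSum-+ : ∀ n f g i → binomialSum n (λ i → f i ℚ.+ g i) i ≡ binomialSum n f i ℚ.+ binomialSum n g i
binomialSum-+ zero    f g i = refl
binomialSum-+ (suc n) f g i = trans (cong₂ ℚ._+_ (binomialSum-+ n f g i) (binomialSum-+ n f g (suc i)))
  (solve 4 (λ a b c d → (a :+ b) :+ (c :+ d) := (a :+ c) :+ (b :+ d)) refl
    (binomialSum n f i) (binomialSum n g i) (binomialSum n f (suc i)) (binomialSum n g (suc i)))

binomialSum-* : ∀ n c f i → binomialSum n (λ i → c ℚ.* f i) i ≡ c ℚ.* binomialSum n f i
binomialSum-* zero    c f i = refl
binomialSum-* (suc n) c f i = trans (cong₂ ℚ._+_ (binomialSum-* n c f i) (binomialSum-* n c f (suc i)))
  (sym (ℚP.*-distribˡ-+ c (binomialSum n f i) (binomialSum n f (suc i))))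

-- Discrete Leibniz rule: j C(n + 1, j) = (n + 1) C(n, j - 1), so the variable part of the factor
-- costs one order of the sum. Multiplication by a linear factor therefore raises the order of
-- annihilation by one.
binomialSum-linear : ∀ n c f i → binomialSum (suc n) (λ i → (ι i ℚ.- c) ℚ.* f i) i ≡
  (ι i ℚ.- c) ℚ.* binomialSum (suc n) f i ℚ.+ ι (suc n) ℚ.* binomialSum n f (suc i)
binomialSum-linear zero    c f i = trans
  (cong (λ s → (ι i ℚ.- c) ℚ.* f i ℚ.+ (s ℚ.- c) ℚ.* f (suc i)) (/-suc i 0))
  (solve 4 (λ i c a b → (i :- c) :* a :+ ((i :+ con 1ℚ) :- c) :* b := (i :- c) :* (a :+ b) :+ con 1ℚ :* b) refl
    (ι i) c (f i) (f (suc i)))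
binomialSum-linear (suc n) c f i = trans
  (cong₂ ℚ._+_ (binomialSum-linear n c f i) (trans (binomialSum-linear n c f (suc i))
    (cong (λ s → (s ℚ.- c) ℚ.* binomialSum (suc n) f (suc i) ℚ.+ ι (suc n) ℚ.* binomialSum n f (suc (suc i))) (/-suc i 0))))
  (trans (solve 6 (λ i c m a b d →
      ((i :- c) :* (a :+ b) :+ m :* b) :+ (((i :+ con 1ℚ) :- c) :* (b :+ d) :+ m :* d) :=
      (i :- c) :* ((a :+ b) :+ (b :+ d)) :+ (m :+ con 1ℚ) :* (b :+ d)) refl
      (ι i) c (ι (suc n)) (binomialSum n f i) (binomialSum n f (suc i)) (binomialSum n f (suc (suc i))))
    (cong (λ m → (ι i ℚ.- c) ℚ.* binomialSum (suc (suc n)) f i ℚ.+ m ℚ.* binomialSum (suc n) f (suc i))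
      (sym (/-suc (suc n) 0))))

annihilated-suc : ∀ {n f} → Annihilated n f → Annihilated (suc n) f
annihilated-suc h i = cong₂ ℚ._+_ (h i) (h (suc i))

annihilated-linear : ∀ {n f} c → Annihilated n f → Annihilated (suc n) (λ i → (ι i ℚ.- c) ℚ.* f i)
annihilated-linear {n} {f} c h i = trans (binomialSum-linear n c f i) (trans
  (cong₂ ℚ._+_ (trans (cong ((ι i ℚ.- c) ℚ.*_) (annihilated-suc {n} {f} h i)) (ℚP.*-zeroʳ (ι i ℚ.- c)))
    (trans (cong (ι (suc n) ℚ.*_) (h (suc i))) (ℚP.*-zeroʳ (ι (suc n)))))
  refl)

eval : Vec ℚ n → ℚ → ℚ
eval []      z = 0ℚ
eval (a ∷ p) z = a ℚ.+ z ℚ.* eval p z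

-- With these signs put into the function, `binomialSum n` is, up to sign, the n-th finite
-- difference.
record Alternating (τ : ℕ → ℚ) : Set where
  field
    alternates : ∀ i → τ (suc i) ≡ ℚ.- τ i
    unit       : ∀ i → ℚ.∣ τ i ∣ ≡ 1ℚ

module _ {τ} (alt : Alternating τ) where
  open Alternating alt

  -- Each step of Horner's scheme multiplies by (i - c)² s, that is by two linear factors, so every
  -- coefficient of p adds two to the order, as `double` does.
  annihilated-eval : ∀ (p : Vec ℚ n) s c →
    Annihilated (double n) (λ i → τ i ℚ.* eval p ((ι i ℚ.- c) ℚ.* (ι i ℚ.- c) ℚ.* s))
  annihilated-eval []      s c i = ℚP.*-zeroʳ (τ i)
  annihilated-eval {n = suc n} (a ∷ p) s c i = trans
    (binomialSum-cong (double (suc n)) (λ i →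
      solve 5 (λ t a x s e → t :* (a :+ x :* x :* s :* e) := a :* t :+ s :* (x :* (x :* (t :* e)))) refl
        (τ i) a (ι i ℚ.- c) s (eval p ((ι i ℚ.- c) ℚ.* (ι i ℚ.- c) ℚ.* s))) i)
    (trans (binomialSum-+ (double (suc n)) (λ i → a ℚ.* τ i) (λ i → s ℚ.* sq i) i)
      (cong₂ ℚ._+_
        (trans (binomialSum-* (double (suc n)) a τ i) (trans (cong (a ℚ.*_) (τ-null (suc (double n)) i)) (ℚP.*-zeroʳ a)))
        (trans (binomialSum-* (double (suc n)) s sq i) (trans (cong (s ℚ.*_) (sq-null i)) (ℚP.*-zeroʳ s)))))
    where
    tail : ℕ → ℚ
    tail i = τ i ℚ.* eval p ((ι i ℚ.- c) ℚ.* (ι i ℚ.- c) ℚ.* s)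
    sq : ℕ → ℚ
    sq i = (ι i ℚ.- c) ℚ.* ((ι i ℚ.- c) ℚ.* tail i)
    sq-null : Annihilated (double (suc n)) sq
    sq-null = annihilated-linear {suc (double n)} {λ i → (ι i ℚ.- c) ℚ.* tail i} c
      (annihilated-linear {double n} {tail} c (annihilated-eval p s c))
    τ-null : ∀ m → Annihilated (suc m) τ
    τ-null zero    i = trans (cong (τ i ℚ.+_) (alternates i)) (ℚP.+-inverseʳ (τ i))
    τ-null (suc m) = annihilated-suc {suc m} {τ} (τ-null m)

module _ (η : ℚ) where

  binomialSum-lower₀ : ∀ n i f → (∀ j → i ℕ.≤ j → j ℕ.≤ n ℕ.+ i → ℚ.- η ℚ.≤ f j) →
    ℚ.- (ι (2 ℕ.^ n) ℚ.* η) ℚ.≤ binomialSum n f i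
  binomialSum-lower₀ zero    i f h = subst (λ q → ℚ.- q ℚ.≤ f i) (sym (ℚP.*-identityˡ η)) (h i ℕP.≤-refl ℕP.≤-refl)
  binomialSum-lower₀ (suc n) i f h = subst (ℚ._≤ binomialSum (suc n) f i) split (ℚP.+-mono-≤
    (binomialSum-lower₀ n i f λ j i≤j j≤ → h j i≤j (ℕP.≤-trans j≤ (ℕP.n≤1+n (n ℕ.+ i))))
    (binomialSum-lower₀ n (suc i) f λ j i<j j≤ → h j (ℕP.<⇒≤ i<j) (ℕP.≤-trans j≤ (ℕP.≤-reflexive (ℕP.+-suc n i)))))
    where
    split : ℚ.- (ι (2 ℕ.^ n) ℚ.* η) ℚ.+ ℚ.- (ι (2 ℕ.^ n) ℚ.* η) ≡ ℚ.- (ι (2 ℕ.^ suc n) ℚ.* η)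
    split = trans (solve 2 (λ a η → (:- (a :* η)) :+ (:- (a :* η)) := :- (con (ι 2) :* a :* η)) refl (ι (2 ℕ.^ n)) η)
      (cong (λ a → ℚ.- (a ℚ.* η)) (sym (ι-* 2 (2 ℕ.^ n))))

  -- The position t stays fixed while Pascal's recursion moves the offset i, so m = t - i drops in
  -- the right branch. At m = 0 that branch no longer meets t and `binomialSum-lower₀` takes over;
  -- beyond the range the coefficient is 0. Charging η at t as well keeps the total weight at 2^n.
  binomialSum-lower : 0ℚ ℚ.≤ η → ∀ n m i f t → t ≡ m ℕ.+ i →
    (∀ j → i ℕ.≤ j → j ℕ.≤ n ℕ.+ i → j ≢ t → ℚ.- η ℚ.≤ f j) →
    ι (n C m) ℚ.* f t ℚ.- ι (2 ℕ.^ n) ℚ.* η ℚ.≤ binomialSum n f i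
  binomialSum-lower 0≤η zero zero i f t refl h = begin
    1ℚ ℚ.* f i ℚ.- 1ℚ ℚ.* η ≡⟨ cong₂ ℚ._-_ (ℚP.*-identityˡ (f i)) (ℚP.*-identityˡ η) ⟩
    f i ℚ.- η               ≤⟨ ℚP.+-monoʳ-≤ (f i) (ℚP.neg-antimono-≤ 0≤η) ⟩
    f i ℚ.+ 0ℚ              ≡⟨ ℚP.+-identityʳ (f i) ⟩
    f i                     ∎
    where open ℚP.≤-Reasoning
  binomialSum-lower 0≤η zero (suc m) i f t e h = begin
    0ℚ ℚ.* f t ℚ.- 1ℚ ℚ.* η ≡⟨ solve 2 (λ a η → con 0ℚ :* a :- con 1ℚ :* η := :- η) refl (f t) η ⟩
    ℚ.- η                   ≤⟨ h i ℕP.≤-refl ℕP.≤-refl (λ i≡t → ℕP.m≢1+n+m i (trans i≡t e)) ⟩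
    f i                     ∎
    where open ℚP.≤-Reasoning
  binomialSum-lower 0≤η (suc n) zero i f t e h = begin
    ι (suc n C 0) ℚ.* f t ℚ.- ι (2 ℕ.^ suc n) ℚ.* η
      ≡⟨ trans (cong (λ a → 1ℚ ℚ.* f t ℚ.- a ℚ.* η) (ι-* 2 (2 ℕ.^ n)))
          (solve 3 (λ a t η → con 1ℚ :* t :- con (ι 2) :* a :* η := (con 1ℚ :* t :- a :* η) :+ (:- (a :* η))) refl
            (ι (2 ℕ.^ n)) (f t) η) ⟩
    (ι (n C 0) ℚ.* f t ℚ.- ι (2 ℕ.^ n) ℚ.* η) ℚ.+ ℚ.- (ι (2 ℕ.^ n) ℚ.* η)
      ≤⟨ ℚP.+-mono-≤
          (binomialSum-lower 0≤η n zero i f t e λ j i≤j j≤ → h j i≤j (ℕP.≤-trans j≤ (ℕP.n≤1+n (n ℕ.+ i))))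
          (binomialSum-lower₀ n (suc i) f λ j i<j j≤ → h j (ℕP.<⇒≤ i<j) (ℕP.≤-trans j≤ (ℕP.≤-reflexive (ℕP.+-suc n i)))
            λ j≡t → ℕP.<⇒≢ i<j (sym (trans j≡t e))) ⟩
    binomialSum n f i ℚ.+ binomialSum n f (suc i) ∎
    where open ℚP.≤-Reasoning
  binomialSum-lower 0≤η (suc n) (suc m) i f t e h = begin
    ι (suc n C suc m) ℚ.* f t ℚ.- ι (2 ℕ.^ suc n) ℚ.* η
      ≡⟨ trans (cong₂ (λ c a → c ℚ.* f t ℚ.- a ℚ.* η)
            (trans (cong ι (trans (sym (nCk+nC[k+1]≡[n+1]C[k+1] n m)) (ℕP.+-comm (n C m) (n C suc m))))
              (ι-+ (n C suc m) (n C m)))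
            (ι-* 2 (2 ℕ.^ n)))
          (solve 5 (λ a b c t η → (a :+ b) :* t :- con (ι 2) :* c :* η := (a :* t :- c :* η) :+ (b :* t :- c :* η)) refl
            (ι (n C suc m)) (ι (n C m)) (ι (2 ℕ.^ n)) (f t) η) ⟩
    (ι (n C suc m) ℚ.* f t ℚ.- ι (2 ℕ.^ n) ℚ.* η) ℚ.+ (ι (n C m) ℚ.* f t ℚ.- ι (2 ℕ.^ n) ℚ.* η)
      ≤⟨ ℚP.+-mono-≤
          (binomialSum-lower 0≤η n (suc m) i f t e λ j i≤j j≤ → h j i≤j (ℕP.≤-trans j≤ (ℕP.n≤1+n (n ℕ.+ i))))
          (binomialSum-lower 0≤η n m (suc i) f t (trans e (sym (ℕP.+-suc m i)))
            λ j i<j j≤ → h j (ℕP.<⇒≤ i<j) (ℕP.≤-trans j≤ (ℕP.≤-reflexive (ℕP.+-suc n i)))) ⟩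
    binomialSum n f i ℚ.+ binomialSum n f (suc i) ∎
    where open ℚP.≤-Reasoning

-- A Markov inequality

ι-distance² : ∀ d i → ∃ λ t → (ι i ℚ.- ι d) ℚ.* (ι i ℚ.- ι d) ≡ ι (t ℕ.* t) ×
  (i ≢ d → 1 ℕ.≤ t) × (i ℕ.≤ double d → t ℕ.≤ d)
ι-distance² d i with ℕP.≤-total d i
... | inj₁ d≤i with ℕP.m≤n⇒∃[o]m+o≡n d≤i
...   | t , refl = t ,
          trans (cong₂ ℚ._*_ diff diff) (sym (ι-* t t)) ,
          (λ i≢d → ℕP.n≢0⇒n>0 λ t≡0 → i≢d (trans (cong (d ℕ.+_) t≡0) (ℕP.+-identityʳ d))) ,
          (λ h → ℕP.+-cancelˡ-≤ d t d (ℕP.≤-trans h (ℕP.≤-reflexive (double≡+ d))))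
  where
  diff : ι (d ℕ.+ t) ℚ.- ι d ≡ ι t
  diff = trans (cong (ℚ._- ι d) (ι-+ d t)) (solve 2 (λ d t → (d :+ t) :- d := t) refl (ι d) (ι t))
ι-distance² d i | inj₂ i≤d with ℕP.m≤n⇒∃[o]m+o≡n i≤d
...   | t , refl = t ,
          trans (cong₂ ℚ._*_ diff diff) (trans (solve 1 (λ t → (:- t) :* (:- t) := t :* t) refl (ι t)) (sym (ι-* t t))) ,
          (λ i≢d → ℕP.n≢0⇒n>0 λ t≡0 → i≢d (sym (trans (cong (i ℕ.+_) t≡0) (ℕP.+-identityʳ i)))) ,
          (λ _ → ℕP.m≤n+m t i)
  where
  diff : ι i ℚ.- ι (i ℕ.+ t) ≡ ℚ.- ι t
  diff = trans (cong (λ x → ι i ℚ.- x) (ι-+ i t)) (solve 2 (λ i t → i :- (i :+ t) := :- t) refl (ι i) (ι t))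

∣p∣≤q⇒-q≤p : ∀ p q → ℚ.∣ p ∣ ℚ.≤ q → ℚ.- q ℚ.≤ p
∣p∣≤q⇒-q≤p p q h = subst (ℚ.- q ℚ.≤_) (solve 1 (λ p → :- (:- p) := p) refl p)
  (ℚP.neg-antimono-≤ (ℚP.≤-trans (p≤∣p∣ (ℚ.- p)) (subst (ℚ._≤ q) (sym (ℚP.∣-p∣≡∣p∣ p)) h)))

0<ι : ∀ a → 1 ℕ.≤ a → 0ℚ ℚ.< ι a
0<ι a 1≤a = ℚP.<-≤-trans 0<1 (ι-mono 1≤a)

-- The factor 2d + 1 is lost at the central binomial coefficient, and d² in passing from z p(z) to
-- p(z) at the smallest nonzero node 1/d².
markovFactor : ℕ → ℕ
markovFactor d = suc (double d) ℕ.* (d ℕ.* d)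

-- The bounded polynomial z p(z) has degree at most d and vanishes at 0, where p(0) is its
-- derivative.
module _ {d} (p : Vec ℚ d) {M} (bounded : ∀ z → 0ℚ ℚ.≤ z → z ℚ.≤ 1ℚ → ℚ.∣ z ℚ.* eval p z ∣ ℚ.≤ M) where

  private
    s : ℚ
    s = inv (ι (d ℕ.* d))
    node : ℕ → ℚ
    node i = (ι i ℚ.- ι d) ℚ.* (ι i ℚ.- ι d) ℚ.* s

  -- A nonzero node u is at least s = 1/d², hence |p(u)| ≤ d² u |p(u)| ≤ d² M.
  node-bound : 1 ℕ.≤ d → ∀ i → i ≢ d → i ℕ.≤ double d → ℚ.∣ eval p (node i) ∣ ℚ.≤ ι (d ℕ.* d) ℚ.* M
  node-bound 1≤d i i≢d i≤2d with ι-distance² d i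
  ... | t , e , lower , upper = begin
    h                             ≡⟨ sym (ℚP.*-identityʳ h) ⟩
    h ℚ.* 1ℚ                      ≡⟨ cong (h ℚ.*_) (sym d²s≡1) ⟩
    h ℚ.* (ι (d ℕ.* d) ℚ.* s)     ≡⟨ solve 3 (λ h d s → h :* (d :* s) := d :* (s :* h)) refl h (ι (d ℕ.* d)) s ⟩
    ι (d ℕ.* d) ℚ.* (s ℚ.* h)     ≤⟨ ℚP.*-monoˡ-≤-nonNeg (ι (d ℕ.* d)) {{ℚ.nonNegative (ι-nonNeg (d ℕ.* d))}} (begin
      s ℚ.* h                       ≤⟨ ℚP.*-monoʳ-≤-nonNeg h {{ℚ.nonNegative (ℚP.0≤∣p∣ (eval p (node i)))}} s≤u ⟩
      u ℚ.* h                       ≡⟨ cong (ℚ._* h) (sym (ℚP.0≤p⇒∣p∣≡p 0≤u)) ⟩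
      ℚ.∣ u ∣ ℚ.* h                 ≡⟨ sym (ℚP.∣p*q∣≡∣p∣*∣q∣ u (eval p (node i))) ⟩
      ℚ.∣ u ℚ.* eval p (node i) ∣   ≤⟨ bounded u 0≤u u≤1 ⟩
      M                             ∎) ⟩
    ι (d ℕ.* d) ℚ.* M             ∎
    where
    open ℚP.≤-Reasoning
    u h : ℚ
    u = node i
    h = ℚ.∣ eval p (node i) ∣
    0<d² : 0ℚ ℚ.< ι (d ℕ.* d)
    0<d² = 0<ι (d ℕ.* d) (ℕP.*-mono-≤ 1≤d 1≤d)
    d²s≡1 : ι (d ℕ.* d) ℚ.* s ≡ 1ℚ
    d²s≡1 = inv-inverse (ι (d ℕ.* d)) (0<⇒≢0 0<d²)
    0≤s : 0ℚ ℚ.≤ s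
    0≤s = ℚP.<⇒≤ (inv-pos 0<d²)
    1≤t : 1 ℕ.≤ t
    1≤t = lower i≢d
    t≤d : t ℕ.≤ d
    t≤d = upper i≤2d
    u≡ : u ≡ ι (t ℕ.* t) ℚ.* s
    u≡ = cong (ℚ._* s) e
    s≤u : s ℚ.≤ u
    s≤u = subst₂ ℚ._≤_ (ℚP.*-identityˡ s) (sym u≡)
      (ℚP.*-monoʳ-≤-nonNeg s {{ℚ.nonNegative 0≤s}} (ι-mono {1} (ℕP.*-mono-≤ 1≤t 1≤t)))
    0≤u : 0ℚ ℚ.≤ u
    0≤u = ℚP.≤-trans 0≤s s≤u
    u≤1 : u ℚ.≤ 1ℚ
    u≤1 = subst₂ ℚ._≤_ (sym u≡) d²s≡1
      (ℚP.*-monoʳ-≤-nonNeg s {{ℚ.nonNegative 0≤s}} (ι-mono (ℕP.*-mono-≤ t≤d t≤d)))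

  -- The binomial sum of τ i · p((i − d)² / d²) vanishes, its central term
  -- is at least 4ᵈ / (2d + 1) times τ d · p(0), and |p| ≤ d² M at the
  -- remaining nodes.
  markov-alternating : ∀ {τ} → Alternating τ → 1 ℕ.≤ d → 0ℚ ℚ.≤ M →
    τ d ℚ.* eval p 0ℚ ℚ.≤ ι (markovFactor d) ℚ.* M
  markov-alternating {τ} alt 1≤d 0≤M = ℚP.*-cancelˡ-≤-pos (ι c) {{ℚ.positive (0<ι c 1≤c)}} (begin
    ι c ℚ.* (τ d ℚ.* eval p 0ℚ)       ≡⟨ cong (λ z → ι c ℚ.* (τ d ℚ.* eval p z)) (sym node-d) ⟩
    ι c ℚ.* f d                       ≡⟨ solve 2 (λ a b → a := (a :- b) :+ b) refl (ι c ℚ.* f d) (ι (2 ℕ.^ N) ℚ.* η) ⟩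
    (ι c ℚ.* f d ℚ.- ι (2 ℕ.^ N) ℚ.* η) ℚ.+ ι (2 ℕ.^ N) ℚ.* η
      ≤⟨ ℚP.+-monoˡ-≤ (ι (2 ℕ.^ N) ℚ.* η) (binomialSum-lower η 0≤η N d 0 f d (sym (ℕP.+-identityʳ d)) off) ⟩
    binomialSum N f 0 ℚ.+ ι (2 ℕ.^ N) ℚ.* η
      ≡⟨ trans (cong (ℚ._+ ι (2 ℕ.^ N) ℚ.* η) (annihilated-eval alt p s (ι d) 0)) (ℚP.+-identityˡ (ι (2 ℕ.^ N) ℚ.* η)) ⟩
    ι (2 ℕ.^ N) ℚ.* η                 ≤⟨ ℚP.*-monoʳ-≤-nonNeg η {{ℚ.nonNegative 0≤η}} (ι-mono (central-lower d)) ⟩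
    ι (suc N ℕ.* c) ℚ.* η             ≡⟨ cong (ℚ._* η) (ι-* (suc N) c) ⟩
    ι (suc N) ℚ.* ι c ℚ.* (ι (d ℕ.* d) ℚ.* M)
      ≡⟨ solve 4 (λ a b c m → a :* b :* (c :* m) := b :* (a :* c :* m)) refl (ι (suc N)) (ι c) (ι (d ℕ.* d)) M ⟩
    ι c ℚ.* (ι (suc N) ℚ.* ι (d ℕ.* d) ℚ.* M)
      ≡⟨ cong (λ q → ι c ℚ.* (q ℚ.* M)) (sym (ι-* (suc N) (d ℕ.* d))) ⟩
    ι c ℚ.* (ι (markovFactor d) ℚ.* M) ∎)
    where
    open ℚP.≤-Reasoning
    open Alternating alt
    N c : ℕ
    N = double d
    c = N C d
    η : ℚ
    η = ι (d ℕ.* d) ℚ.* M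
    f : ℕ → ℚ
    f i = τ i ℚ.* eval p (node i)
    0≤η : 0ℚ ℚ.≤ η
    0≤η = subst (ℚ._≤ η) (ℚP.*-zeroʳ (ι (d ℕ.* d)))
      (ℚP.*-monoˡ-≤-nonNeg (ι (d ℕ.* d)) {{ℚ.nonNegative (ι-nonNeg (d ℕ.* d))}} 0≤M)
    1≤c : 1 ℕ.≤ c
    1≤c = ℕP.n≢0⇒n>0 λ c≡0 → ℕP.<⇒≱ (ℕP.m^n>0 2 N) (ℕP.≤-trans (central-lower d)
      (ℕP.≤-reflexive (trans (cong (suc N ℕ.*_) c≡0) (ℕP.*-zeroʳ (suc N)))))
    node-d : node d ≡ 0ℚ
    node-d = solve 2 (λ d s → (d :- d) :* (d :- d) :* s := con 0ℚ) refl (ι d) s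
    off : ∀ j → 0 ℕ.≤ j → j ℕ.≤ N ℕ.+ 0 → j ≢ d → ℚ.- η ℚ.≤ f j
    off j _ j≤N j≢d = ∣p∣≤q⇒-q≤p (f j) η (subst (ℚ._≤ η)
      (sym (trans (ℚP.∣p*q∣≡∣p∣*∣q∣ (τ j) (eval p (node j)))
        (trans (cong (ℚ._* ℚ.∣ eval p (node j) ∣) (unit j)) (ℚP.*-identityˡ _))))
      (node-bound 1≤d j j≢d (subst (j ℕ.≤_) (ℕP.+-identityʳ N) j≤N)))

alternatingSign : ℚ → ℕ → ℚ
alternatingSign c zero    = c
alternatingSign c (suc i) = ℚ.- alternatingSign c i

alternatingSign-alternating : ∀ {c} → ℚ.∣ c ∣ ≡ 1ℚ → Alternating (alternatingSign c)
alternatingSign-alternating {c} u = record { alternates = λ _ → refl ; unit = unit }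
  where
  unit : ∀ i → ℚ.∣ alternatingSign c i ∣ ≡ 1ℚ
  unit zero    = u
  unit (suc i) = trans (ℚP.∣-p∣≡∣p∣ (alternatingSign c i)) (unit i)

alternatingSign-neg : ∀ c i → alternatingSign (ℚ.- c) i ≡ ℚ.- alternatingSign c i
alternatingSign-neg c zero    = refl
alternatingSign-neg c (suc i) = cong ℚ.-_ (alternatingSign-neg c i)

-- A weak form of the Markov brothers' inequality at an end point.
markov : ∀ {d} (p : Vec ℚ d) {M} → 0ℚ ℚ.≤ M → (∀ z → 0ℚ ℚ.≤ z → z ℚ.≤ 1ℚ → ℚ.∣ z ℚ.* eval p z ∣ ℚ.≤ M) →
  ℚ.∣ eval p 0ℚ ∣ ℚ.≤ ι (markovFactor d) ℚ.* M
markov []          {M} 0≤M h = ℚP.≤-reflexive (sym (ℚP.*-zeroˡ M))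
-- The alternating sequences starting with 1 and with -1 give the two sides of the bound on the
-- absolute value.
markov {suc d} p {M} 0≤M h = subst (ℚ._≤ B) ∣στ∣ (abs-bound (σ (suc d) ℚ.* p₀) B
  (markov-alternating p h (alternatingSign-alternating refl) (s≤s z≤n) 0≤M)
  (subst (ℚ._≤ B) (trans (cong (ℚ._* p₀) (alternatingSign-neg 1ℚ (suc d))) (sym (ℚP.neg-distribˡ-* (σ (suc d)) p₀)))
    (markov-alternating p h (alternatingSign-alternating refl) (s≤s z≤n) 0≤M)))
  where
  σ : ℕ → ℚ
  σ = alternatingSign 1ℚ
  p₀ B : ℚ
  p₀ = eval p 0ℚ
  B = ι (markovFactor (suc d)) ℚ.* M
  ∣στ∣ : ℚ.∣ σ (suc d) ℚ.* p₀ ∣ ≡ ℚ.∣ p₀ ∣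
  ∣στ∣ = trans (ℚP.∣p*q∣≡∣p∣*∣q∣ (σ (suc d)) p₀) (trans (cong (ℚ._* ℚ.∣ p₀ ∣)
    (Alternating.unit (alternatingSign-alternating {1ℚ} refl) (suc d))) (ℚP.*-identityˡ ℚ.∣ p₀ ∣))
  abs-bound : ∀ x b → x ℚ.≤ b → ℚ.- x ℚ.≤ b → ℚ.∣ x ∣ ℚ.≤ b
  abs-bound x b p q with ℚP.∣p∣≡p∨∣p∣≡-p x
  ... | inj₁ e = subst (ℚ._≤ b) (sym e) p
  ... | inj₂ e = subst (ℚ._≤ b) (sym e) q

-- Degree and sensitivity

-- The bound is strict, so that 0 describes the zero function and each `∂` lowers e by one.
DegreeBelow : ℕ → (Vec Bool n → ℚ) → Set
DegreeBelow e f = ∀ S → e ℕ.≤ ∣ S ∣ → coef f S ≡ 0ℚ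

coef-0 : ∀ {f : Vec Bool n → ℚ} → (∀ x → f x ≡ 0ℚ) → ∀ S → coef f S ≡ 0ℚ
coef-0 e []            = e []
coef-0 e (outside ∷ S) = coef-0 (e ∘ (false ∷_)) S
coef-0 e (inside ∷ S)  = coef-0 (λ x → cong₂ ℚ._-_ (e (true ∷ x)) (e (false ∷ x))) S

hi≡lo : ∀ (f : Vec Bool (suc n) → ℚ) x → ∂ f x ≡ 0ℚ → hi f x ≡ lo f x
hi≡lo f x e = trans (solve 2 (λ a b → a := (a :- b) :+ b) refl (hi f x) (lo f x))
  (trans (cong (ℚ._+ lo f x) e) (ℚP.+-identityˡ (lo f x)))

degreeBelow-0 : ∀ (f : Vec Bool n → ℚ) → DegreeBelow 0 f → ∀ x → f x ≡ 0ℚ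
degreeBelow-0 f h []          = h [] z≤n
degreeBelow-0 f h (false ∷ x) = degreeBelow-0 (lo f) (λ S _ → h (outside ∷ S) z≤n) x
degreeBelow-0 f h (true ∷ x)  = trans
  (hi≡lo f x (degreeBelow-0 (∂ f) (λ S _ → h (inside ∷ S) z≤n) x))
  (degreeBelow-0 (lo f) (λ S _ → h (outside ∷ S) z≤n) x)

degreeBelow-1 : ∀ (f : Vec Bool n → ℚ) → DegreeBelow 1 f → ∀ x → f x ≡ f ⊥
degreeBelow-1 f h []          = refl
degreeBelow-1 f h (false ∷ x) = degreeBelow-1 (lo f) (h ∘ (outside ∷_)) x
degreeBelow-1 f h (true ∷ x)  = trans
  (hi≡lo f x (degreeBelow-0 (∂ f) (λ S _ → h (inside ∷ S) (s≤s z≤n)) x))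
  (degreeBelow-1 (lo f) (h ∘ (outside ∷_)) x)

bitℚ : Bool → ℚ
bitℚ false = 0ℚ
bitℚ true  = 1ℚ

-- Because x_j² = x_j on bits, a monomial that already contains x_j keeps its size; every other one
-- grows by one.
degreeBelow-* : ∀ j (f : Vec Bool n → ℚ) → DegreeBelow e f → DegreeBelow (suc e) (λ x → bitℚ (lookup x j) ℚ.* f x)
degreeBelow-* zero    f h (outside ∷ S) _        = coef-0 (λ x → ℚP.*-zeroˡ (lo f x)) S
degreeBelow-* zero    f h (inside ∷ S)  (s≤s e≤) = trans
  (coef-cong (λ x → solve 2 (λ a b → con 1ℚ :* a :- con 0ℚ :* b := a) refl (hi f x) (lo f x)) S)
  (trans (coef-hi f S) (cong₂ ℚ._+_ (h (outside ∷ S) e≤) (h (inside ∷ S) (ℕP.m≤n⇒m≤1+n e≤))))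
degreeBelow-* (suc j) f h (outside ∷ S) e≤       = degreeBelow-* j (lo f) (h ∘ (outside ∷_)) S e≤
degreeBelow-* {e = zero}  (suc j) f h (inside ∷ S) _        =
  coef-0 (λ x → trans (cong₂ (λ a b → bitℚ (lookup x j) ℚ.* a ℚ.- bitℚ (lookup x j) ℚ.* b)
    (degreeBelow-0 f h (true ∷ x)) (degreeBelow-0 f h (false ∷ x)))
    (ℚP.+-inverseʳ (bitℚ (lookup x j) ℚ.* 0ℚ))) S
degreeBelow-* {e = suc e} (suc j) f h (inside ∷ S) (s≤s e≤) = trans
  (coef-cong (λ x → solve 3 (λ c a b → c :* a :- c :* b := c :* (a :- b)) refl (bitℚ (lookup x j)) (hi f x) (lo f x)) S)
  (degreeBelow-* j (∂ f) (λ S e≤ → h (inside ∷ S) (s≤s e≤)) S e≤)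

-- Coordinates of colour j become y_j and uncoloured ones 0, so the unit vector at j switches on
-- exactly the block j.
expand : Vec (Maybe (Fin k)) n → Vec Bool k → Vec Bool n
expand c y = map (maybe (lookup y) false) c

degreeBelow-expand : ∀ (c : Vec (Maybe (Fin k)) n) f → DegreeBelow e f → DegreeBelow e (f ∘ expand c)
degreeBelow-expand {e = zero}  c             f h S e≤ = coef-0 (λ y → degreeBelow-0 f h (expand c y)) S
degreeBelow-expand {e = suc e} []            f h S e≤ = trans (coef-cong (λ y → sym (ℚP.*-identityˡ (f []))) S) (const S e≤)
  where
  const : ∀ {k} (S : Subset k) → suc e ℕ.≤ ∣ S ∣ → coef (λ _ → 1ℚ ℚ.* f []) S ≡ 0ℚ
  const (outside ∷ S) e≤ = const S e≤
  const (inside ∷ S)  e≤ = coef-0 (λ _ → ℚP.+-inverseʳ (1ℚ ℚ.* f [])) S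
degreeBelow-expand {e = suc e} (nothing ∷ c) f h      = degreeBelow-expand c (lo f) (h ∘ (outside ∷_))
degreeBelow-expand {e = suc e} (just j ∷ c)  f h S e≤ = trans
  (coef-cong (λ y → split (lookup y j) (expand c y)) S)
  (trans (coef-+ (lo f ∘ expand c) (λ y → bitℚ (lookup y j) ℚ.* ∂ f (expand c y)) S)
    (cong₂ ℚ._+_ (degreeBelow-expand c (lo f) (h ∘ (outside ∷_)) S e≤)
      (degreeBelow-* j (∂ f ∘ expand c) (degreeBelow-expand c (∂ f) (λ S e≤ → h (inside ∷ S) (s≤s e≤))) S e≤)))
  where
  split : ∀ b x → f (b ∷ x) ≡ lo f x ℚ.+ bitℚ b ℚ.* ∂ f x
  split false x = solve 2 (λ a b → b := b :+ con 0ℚ :* (a :- b)) refl (hi f x) (lo f x)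
  split true  x = solve 2 (λ a b → a := b :+ con 1ℚ :* (a :- b)) refl (hi f x) (lo f x)

-- mean g z is the expectation of g under independent bits equal to 1 with
-- probability z, and slope g z is its difference quotient (mean g z − g 0) / z.
mean slope : (Vec Bool k → ℚ) → ℚ → ℚ
mean {zero}  g z = g []
mean {suc k} g z = mean (lo g) z ℚ.+ z ℚ.* mean (∂ g) z
slope {zero}  g z = 0ℚ
slope {suc k} g z = slope (lo g) z ℚ.+ mean (∂ g) z

mean-slope : ∀ (g : Vec Bool k → ℚ) z → mean g z ≡ g ⊥ ℚ.+ z ℚ.* slope g z
mean-slope {zero}  g z = sym (trans (cong (g [] ℚ.+_) (ℚP.*-zeroʳ z)) (ℚP.+-identityʳ (g [])))
mean-slope {suc k} g z = trans (cong (ℚ._+ z ℚ.* mean (∂ g) z) (mean-slope (lo g) z))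
  (solve 4 (λ a z s m → (a :+ z :* s) :+ z :* m := a :+ z :* (s :+ m)) refl
    (lo g ⊥) z (slope (lo g) z) (mean (∂ g) z))

mean-at-0 : ∀ (g : Vec Bool k → ℚ) → mean g 0ℚ ≡ g ⊥
mean-at-0 g = trans (mean-slope g 0ℚ) (trans (cong (g ⊥ ℚ.+_) (ℚP.*-zeroˡ (slope g 0ℚ))) (ℚP.+-identityʳ (g ⊥)))

mean-sub : ∀ (g h : Vec Bool k → ℚ) z → mean (λ y → g y ℚ.- h y) z ≡ mean g z ℚ.- mean h z
mean-sub {zero}  g h z = refl
mean-sub {suc k} g h z = trans
  (cong₂ (λ a b → a ℚ.+ z ℚ.* b) (mean-sub (lo g) (lo h) z)
    (trans (mean-sub (λ y → hi g y ℚ.- hi h y) (λ y → lo g y ℚ.- lo h y) z)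
      (trans (cong₂ ℚ._-_ (mean-sub (hi g) (hi h) z) (mean-sub (lo g) (lo h) z))
        (trans (solve 4 (λ a b c d → (a :- b) :- (c :- d) := (a :- c) :- (b :- d)) refl
            (mean (hi g) z) (mean (hi h) z) (mean (lo g) z) (mean (lo h) z))
          (sym (cong₂ ℚ._-_ (mean-sub (hi g) (lo g) z) (mean-sub (hi h) (lo h) z)))))))
  (solve 5 (λ a b z p q → (a :- b) :+ z :* (p :- q) := (a :+ z :* p) :- (b :+ z :* q)) refl
    (mean (lo g) z) (mean (lo h) z) z (mean (∂ g) z) (mean (∂ h) z))

-- The defining recursion displays the degree in z; this form displays the bound on [0, 1].
mean-convex : ∀ (g : Vec Bool (suc k) → ℚ) z → mean g z ≡ (1ℚ ℚ.- z) ℚ.* mean (lo g) z ℚ.+ z ℚ.* mean (hi g) z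
mean-convex g z = trans (cong (λ q → mean (lo g) z ℚ.+ z ℚ.* q) (mean-sub (hi g) (lo g) z))
  (solve 3 (λ a b z → a :+ z :* (b :- a) := (con 1ℚ :- z) :* a :+ z :* b) refl (mean (lo g) z) (mean (hi g) z) z)

mean-bounded : ∀ (g : Vec Bool k → ℚ) {M} → (∀ y → ℚ.∣ g y ∣ ℚ.≤ M) →
  ∀ z → 0ℚ ℚ.≤ z → z ℚ.≤ 1ℚ → ℚ.∣ mean g z ∣ ℚ.≤ M
mean-bounded {zero}  g     b z 0≤z z≤1 = b []
mean-bounded {suc k} g {M} b z 0≤z z≤1 = begin
  ℚ.∣ mean g z ∣
    ≡⟨ cong ℚ.∣_∣ (mean-convex g z) ⟩
  ℚ.∣ (1ℚ ℚ.- z) ℚ.* mean (lo g) z ℚ.+ z ℚ.* mean (hi g) z ∣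
    ≤⟨ ℚP.∣p+q∣≤∣p∣+∣q∣ ((1ℚ ℚ.- z) ℚ.* mean (lo g) z) (z ℚ.* mean (hi g) z) ⟩
  ℚ.∣ (1ℚ ℚ.- z) ℚ.* mean (lo g) z ∣ ℚ.+ ℚ.∣ z ℚ.* mean (hi g) z ∣
    ≡⟨ cong₂ ℚ._+_ (scale (1ℚ ℚ.- z) (mean (lo g) z) 0≤1-z) (scale z (mean (hi g) z) 0≤z) ⟩
  (1ℚ ℚ.- z) ℚ.* ℚ.∣ mean (lo g) z ∣ ℚ.+ z ℚ.* ℚ.∣ mean (hi g) z ∣
    ≤⟨ ℚP.+-mono-≤
        (ℚP.*-monoˡ-≤-nonNeg (1ℚ ℚ.- z) {{ℚ.nonNegative 0≤1-z}} (mean-bounded (lo g) (b ∘ (false ∷_)) z 0≤z z≤1))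
        (ℚP.*-monoˡ-≤-nonNeg z {{ℚ.nonNegative 0≤z}} (mean-bounded (hi g) (b ∘ (true ∷_)) z 0≤z z≤1)) ⟩
  (1ℚ ℚ.- z) ℚ.* M ℚ.+ z ℚ.* M
    ≡⟨ solve 2 (λ z M → (con 1ℚ :- z) :* M :+ z :* M := M) refl z M ⟩
  M ∎
  where
  open ℚP.≤-Reasoning
  0≤1-z : 0ℚ ℚ.≤ 1ℚ ℚ.- z
  0≤1-z = subst (ℚ._≤ 1ℚ ℚ.- z) (ℚP.+-inverseʳ z) (ℚP.+-monoˡ-≤ (ℚ.- z) z≤1)
  scale : ∀ c q → 0ℚ ℚ.≤ c → ℚ.∣ c ℚ.* q ∣ ≡ c ℚ.* ℚ.∣ q ∣
  scale c q 0≤c = trans (ℚP.∣p*q∣≡∣p∣*∣q∣ c q) (cong (ℚ._* ℚ.∣ q ∣) (ℚP.0≤p⇒∣p∣≡p 0≤c))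

eval-+ : ∀ (p q : Vec ℚ d) z → eval (zipWith ℚ._+_ p q) z ≡ eval p z ℚ.+ eval q z
eval-+ []      []      z = refl
eval-+ (a ∷ p) (b ∷ q) z = trans (cong (λ r → a ℚ.+ b ℚ.+ z ℚ.* r) (eval-+ p q z))
  (solve 5 (λ a b z p q → a :+ b :+ z :* (p :+ q) := (a :+ z :* p) :+ (b :+ z :* q)) refl a b z (eval p z) (eval q z))

eval-replicate-0 : ∀ d z → eval (replicate d 0ℚ) z ≡ 0ℚ
eval-replicate-0 zero    z = refl
eval-replicate-0 (suc d) z = trans (ℚP.+-identityˡ _) (trans (cong (z ℚ.*_) (eval-replicate-0 d z)) (ℚP.*-zeroʳ z))

meanPolynomial : ∀ (g : Vec Bool k → ℚ) → DegreeBelow e g → ∃ λ (p : Vec ℚ e) → ∀ z → mean g z ≡ eval p z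
meanPolynomial {zero}  {zero}  g h = [] , λ _ → h [] z≤n
meanPolynomial {zero}  {suc e} g h = g [] ∷ replicate e 0ℚ , λ z →
  sym (trans (cong (λ q → g [] ℚ.+ z ℚ.* q) (eval-replicate-0 e z))
    (trans (cong (g [] ℚ.+_) (ℚP.*-zeroʳ z)) (ℚP.+-identityʳ (g []))))
meanPolynomial {suc k} {zero}  g h
  with meanPolynomial {e = 0} (lo g) (h ∘ (outside ∷_)) | meanPolynomial {e = 0} (∂ g) (λ S _ → h (inside ∷ S) z≤n)
... | [] , E | [] , E′ = [] , λ z → trans (cong₂ (λ a b → a ℚ.+ z ℚ.* b) (E z) (E′ z))
      (trans (ℚP.+-identityˡ (z ℚ.* 0ℚ)) (ℚP.*-zeroʳ z))
meanPolynomial {suc k} {suc e} g h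
  with meanPolynomial {e = suc e} (lo g) (h ∘ (outside ∷_)) | meanPolynomial {e = e} (∂ g) (λ S e≤ → h (inside ∷ S) (s≤s e≤))
-- The shift `0ℚ ∷ q` is multiplication by z.
... | p , E | q , E′ = zipWith ℚ._+_ p (0ℚ ∷ q) , λ z → trans (cong₂ (λ a b → a ℚ.+ z ℚ.* b) (E z) (E′ z))
      (sym (trans (eval-+ p (0ℚ ∷ q) z) (cong (eval p z ℚ.+_) (ℚP.+-identityˡ (z ℚ.* eval q z)))))

slopePolynomial : ∀ (g : Vec Bool k → ℚ) → DegreeBelow (suc d) g → ∃ λ (p : Vec ℚ d) → ∀ z → slope g z ≡ eval p z
slopePolynomial {zero}  {d} g h = replicate d 0ℚ , λ z → sym (eval-replicate-0 d z)
slopePolynomial {suc k} {d} g h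
  with slopePolynomial {d = d} (lo g) (h ∘ (outside ∷_)) | meanPolynomial {e = d} (∂ g) (λ S e≤ → h (inside ∷ S) (s≤s e≤))
... | p , E | q , E′ = zipWith ℚ._+_ p q , λ z → trans (cong₂ ℚ._+_ (E z) (E′ z)) (sym (eval-+ p q z))

-- The derivative of the mean at 0 is the sum of the k single differences at 0.
slope-at-0 : ∀ (g : Vec Bool k → ℚ) c → (∀ i → g ⁅ i ⁆ ℚ.- g ⊥ ≡ c) → slope g 0ℚ ≡ ι k ℚ.* c
slope-at-0 {zero}  g c h = sym (ℚP.*-zeroˡ c)
slope-at-0 {suc k} g c h = trans
  (cong₂ ℚ._+_ (slope-at-0 (lo g) c (h ∘ suc)) (trans (mean-at-0 (∂ g)) (h zero)))
  (trans (solve 2 (λ k c → k :* c :+ c := (k :+ con 1ℚ) :* c) refl (ι k) c) (cong (ℚ._* c) (sym (/-suc k 0))))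

ι-cancel-≤ : ∀ a b → ι a ℚ.≤ ι b → a ℕ.≤ b
ι-cancel-≤ a b h = ℕP.≮⇒≥ λ b<a → ℚP.<-irrefl refl (begin-strict
  ι b             ≡⟨ sym (ℚP.+-identityʳ (ι b)) ⟩
  ι b ℚ.+ 0ℚ      <⟨ ℚP.+-monoʳ-< (ι b) 0<1 ⟩
  ι b ℚ.+ 1ℚ      ≡⟨ sym (/-suc b 0) ⟩
  ι (suc b)       ≤⟨ ι-mono b<a ⟩
  ι a             ≤⟨ h ⟩
  ι b             ∎)
  where open ℚP.≤-Reasoning

-- A function with values ±1 can only change from g(0) to -g(0), so for it the k differences share
-- one value c = ±2 and cannot cancel. The factor 2 disappears against |q(z) - q(0)| ≤ 2, where q is
-- the mean.
sensitivity-bound : ∀ (g : Vec Bool k → ℚ) c → ℚ.∣ c ∣ ≡ ι 2 → (∀ y → ℚ.∣ g y ∣ ℚ.≤ 1ℚ) → DegreeBelow (suc d) g →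
  (∀ i → g ⁅ i ⁆ ℚ.- g ⊥ ≡ c) → k ℕ.≤ markovFactor d
sensitivity-bound {k} {d} g c ∣c∣≡2 ∣g∣≤1 h sens with slopePolynomial g h
... | p , E = ι-cancel-≤ k (markovFactor d) (ℚP.*-cancelʳ-≤-pos (ι 2) (begin
  ι k ℚ.* ι 2                  ≡⟨ cong₂ ℚ._*_ (sym (ℚP.0≤p⇒∣p∣≡p (ι-nonNeg k))) (sym ∣c∣≡2) ⟩
  ℚ.∣ ι k ∣ ℚ.* ℚ.∣ c ∣        ≡⟨ sym (ℚP.∣p*q∣≡∣p∣*∣q∣ (ι k) c) ⟩
  ℚ.∣ ι k ℚ.* c ∣              ≡⟨ cong ℚ.∣_∣ (sym (slope-at-0 g c sens)) ⟩
  ℚ.∣ slope g 0ℚ ∣             ≡⟨ cong ℚ.∣_∣ (E 0ℚ) ⟩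
  ℚ.∣ eval p 0ℚ ∣              ≤⟨ markov p (ι-nonNeg 2) bounded ⟩
  ι (markovFactor d) ℚ.* ι 2   ∎))
  where
  open ℚP.≤-Reasoning
  bounded : ∀ z → 0ℚ ℚ.≤ z → z ℚ.≤ 1ℚ → ℚ.∣ z ℚ.* eval p z ∣ ℚ.≤ ι 2
  bounded z 0≤z z≤1 = begin
    ℚ.∣ z ℚ.* eval p z ∣            ≡⟨ cong (λ q → ℚ.∣ z ℚ.* q ∣) (sym (E z)) ⟩
    ℚ.∣ z ℚ.* slope g z ∣           ≡⟨ cong ℚ.∣_∣ (trans (solve 2 (λ a b → b := (a :+ b) :- a) refl (g ⊥) (z ℚ.* slope g z))
                                         (cong (ℚ._- g ⊥) (sym (mean-slope g z)))) ⟩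
    ℚ.∣ mean g z ℚ.- g ⊥ ∣          ≤⟨ ℚP.∣p-q∣≤∣p∣+∣q∣ (mean g z) (g ⊥) ⟩
    ℚ.∣ mean g z ∣ ℚ.+ ℚ.∣ g ⊥ ∣    ≤⟨ ℚP.+-mono-≤ (mean-bounded g ∣g∣≤1 z 0≤z z≤1) (∣g∣≤1 ⊥) ⟩
    1ℚ ℚ.+ 1ℚ                       ≡⟨⟩
    ι 2                             ∎

-- Decision trees and protocols

infix 4 _⊑_

_⊑_ : Subset n → Subset n → Set
_⊑_ = Pointwise Bool._≤_

Disjoint : Subset n → Subset n → Set
Disjoint = Pointwise λ s h → s ∧ h ≡ false

disjoint? : (S H : Subset n) → Dec (Disjoint S H)
disjoint? = Pointwise.decidable λ s h → (s ∧ h) Bool.≟ false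

⊑-disjoint : ∀ {B S H : Subset n} → B ⊑ S → Disjoint S H → Disjoint B H
⊑-disjoint []                []      = []
⊑-disjoint (f≤t ∷ B⊑S)       (_ ∷ D) = refl ∷ ⊑-disjoint B⊑S D
⊑-disjoint (b≤b ∷ B⊑S)       (e ∷ D) = e ∷ ⊑-disjoint B⊑S D

⊑-card : ∀ {B S : Subset n} → B ⊑ S → ∣ B ∣ ℕ.≤ ∣ S ∣
⊑-card []                   = z≤n
⊑-card (f≤t ∷ B⊑S)          = ℕP.m≤n⇒m≤1+n (⊑-card B⊑S)
⊑-card (b≤b {true} ∷ B⊑S)   = s≤s (⊑-card B⊑S)
⊑-card (b≤b {false} ∷ B⊑S)  = ⊑-card B⊑S

disjoint-∪ : ∀ {S H T : Subset n} → Disjoint S H → T ⊑ H → S ∪ T ≡ S ⊎ ∣ S ∣ ℕ.< ∣ S ∪ T ∣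
disjoint-∪ [] [] = inj₁ refl
disjoint-∪ (_∷_ {x = true}  {y = false} _ D) (b≤b ∷ T⊑H) with disjoint-∪ D T⊑H
... | inj₁ e = inj₁ (cong (true ∷_) e)
... | inj₂ l = inj₂ (s≤s l)
disjoint-∪ (_∷_ {x = false} {y = true}  _ D) (b≤b ∷ T⊑H) with disjoint-∪ D T⊑H
... | inj₁ e = inj₂ (s≤s (ℕP.≤-reflexive (cong ∣_∣ (sym e))))
... | inj₂ l = inj₂ (ℕP.m≤n⇒m≤1+n l)
disjoint-∪ (_∷_ {x = false} {y = true}  _ D) (f≤t ∷ T⊑H) with disjoint-∪ D T⊑H
... | inj₁ e = inj₁ (cong (false ∷_) e)
... | inj₂ l = inj₂ l
disjoint-∪ (_∷_ {x = false} {y = false} _ D) (b≤b ∷ T⊑H) with disjoint-∪ D T⊑H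
... | inj₁ e = inj₁ (cong (false ∷_) e)
... | inj₂ l = inj₂ l

-- The coefficient at S is an alternating sum of the values of g at the subsets of S.
coef-support : ∀ (g : Vec Bool n → ℚ) S → coef g S ≢ 0ℚ → ∃ λ B → B ⊑ S × g B ≢ 0ℚ
coef-support g []            c≢0 = [] , [] , c≢0
coef-support g (outside ∷ S) c≢0 with coef-support (lo g) S c≢0
... | B , B⊑S , gB≢0 = outside ∷ B , b≤b ∷ B⊑S , gB≢0
coef-support g (inside ∷ S)  c≢0 with coef-support (∂ g) S c≢0
... | B , B⊑S , ∂gB≢0 with hi g B ℚP.≟ 0ℚ | lo g B ℚP.≟ 0ℚ
...   | no hi≢0  | _        = inside ∷ B , b≤b ∷ B⊑S , hi≢0
...   | yes _    | no lo≢0  = outside ∷ B , f≤t ∷ B⊑S , lo≢0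
...   | yes hi≡0 | yes lo≡0 = contradiction (cong₂ ℚ._-_ hi≡0 lo≡0) ∂gB≢0

coef-const : ∀ c (S : Subset n) → 1 ℕ.≤ ∣ S ∣ → coef (λ _ → c) S ≡ 0ℚ
coef-const c (outside ∷ S) 1≤ = coef-const c S 1≤
coef-const c (inside ∷ S)  1≤ = coef-0 (λ _ → ℚP.+-inverseʳ c) S

signℚ-≢ : ∀ {s t} → s ≢ t → signℚ s ℚ.- signℚ t ≡ ℚ.- (ι 2 ℚ.* signℚ t)
signℚ-≢ {Sign.+} {Sign.+} s≢t = contradiction refl s≢t
signℚ-≢ {Sign.+} {Sign.-} s≢t = refl
signℚ-≢ {Sign.-} {Sign.+} s≢t = refl
signℚ-≢ {Sign.-} {Sign.-} s≢t = contradiction refl s≢t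

∣signℚ∣ : ∀ s → ℚ.∣ signℚ s ∣ ≡ 1ℚ
∣signℚ∣ Sign.+ = refl
∣signℚ∣ Sign.- = refl

∣2signℚ∣ : ∀ s → ℚ.∣ ℚ.- (ι 2 ℚ.* signℚ s) ∣ ≡ ι 2
∣2signℚ∣ Sign.+ = refl
∣2signℚ∣ Sign.- = refl

signℚ≢0 : ∀ s → signℚ s ≢ 0ℚ
signℚ≢0 Sign.+ ()
signℚ≢0 Sign.- ()

-- Subtracting f(0) leaves the coefficient at a nonempty S unchanged, so the difference f - f(0) is
-- nonzero somewhere below S.
sensitive-block : ∀ (f : Vec Bool n → Sign) S → 1 ℕ.≤ ∣ S ∣ → coef (signℚ ∘ f) S ≢ 0ℚ →
  ∃ λ B → B ⊑ S × f B ≢ f ⊥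
sensitive-block f S 1≤ c≢0 with coef-support (λ x → signℚ (f x) ℚ.+ c) S shifted≢0
  where
  c : ℚ
  c = ℚ.- signℚ (f ⊥)
  shifted≢0 : coef (λ x → signℚ (f x) ℚ.+ c) S ≢ 0ℚ
  shifted≢0 e = c≢0 (trans (sym (trans (cong (coef (signℚ ∘ f) S ℚ.+_) (coef-const c S 1≤)) (ℚP.+-identityʳ _)))
    (trans (sym (coef-+ (signℚ ∘ f) (λ _ → c) S)) e))
... | B , B⊑S , ≢0 = B , B⊑S , λ e → ≢0 (trans (cong (λ s → signℚ s ℚ.- signℚ (f ⊥)) e) (ℚP.+-inverseʳ (signℚ (f ⊥))))

-- Disjoint sensitive blocks and hitting sets

colored : Vec (Maybe (Fin k)) n → Subset n
colored = map is-just

adjoin : Subset n → Vec (Maybe (Fin k)) n → Vec (Maybe (Fin (suc k))) n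
adjoin = zipWith λ b c → if b then just zero else Maybe.map suc c

expand-adjoin-zero : ∀ (B : Subset n) (c : Vec (Maybe (Fin k)) n) → expand (adjoin B c) ⁅ zero ⁆ ≡ B
expand-adjoin-zero []          []            = refl
expand-adjoin-zero (true ∷ B)  (m ∷ c)       = cong (true ∷_) (expand-adjoin-zero B c)
expand-adjoin-zero (false ∷ B) (nothing ∷ c) = cong (false ∷_) (expand-adjoin-zero B c)
expand-adjoin-zero (false ∷ B) (just j ∷ c)  = cong₂ _∷_ (VecP.lookup-replicate j false) (expand-adjoin-zero B c)

expand-adjoin-suc : ∀ {B : Subset n} {c : Vec (Maybe (Fin k)) n} → Disjoint B (colored c) →
  ∀ y → expand (adjoin B c) (false ∷ y) ≡ expand c y
expand-adjoin-suc {B = []}        {[]}          []      y = refl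
expand-adjoin-suc {B = true ∷ B}  {nothing ∷ c} (e ∷ D) y = cong (false ∷_) (expand-adjoin-suc D y)
expand-adjoin-suc {B = false ∷ B} {nothing ∷ c} (e ∷ D) y = cong (false ∷_) (expand-adjoin-suc D y)
expand-adjoin-suc {B = false ∷ B} {just j ∷ c}  (e ∷ D) y = cong (lookup y j ∷_) (expand-adjoin-suc D y)

adjoin-card : ∀ (B : Subset n) (c : Vec (Maybe (Fin k)) n) → ∣ colored (adjoin B c) ∣ ℕ.≤ ∣ B ∣ ℕ.+ ∣ colored c ∣
adjoin-card []          []            = z≤n
adjoin-card (true ∷ B)  (just j ∷ c)  = s≤s (ℕP.≤-trans (adjoin-card B c) (ℕP.+-monoʳ-≤ ∣ B ∣ (ℕP.n≤1+n _)))
adjoin-card (true ∷ B)  (nothing ∷ c) = s≤s (adjoin-card B c)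
adjoin-card (false ∷ B) (just j ∷ c)  = ℕP.≤-trans (s≤s (adjoin-card B c)) (ℕP.≤-reflexive (sym (ℕP.+-suc ∣ B ∣ _)))
adjoin-card (false ∷ B) (nothing ∷ c) = adjoin-card B c

expand-⊥ : ∀ (c : Vec (Maybe (Fin k)) n) → expand c ⊥ ≡ ⊥
expand-⊥ []            = refl
expand-⊥ (nothing ∷ c) = cong (false ∷_) (expand-⊥ c)
expand-⊥ (just j ∷ c)  = cong₂ _∷_ (VecP.lookup-replicate j false) (expand-⊥ c)

-- The colour classes are k disjoint blocks of at most d coordinates each,
-- and f is sensitive to each of them at 0.
record Blocks (f : Vec Bool n → Sign) (d k : ℕ) : Set where
  field
    color     : Vec (Maybe (Fin k)) n
    sensitive : ∀ i → f (expand color ⁅ i ⁆) ≢ f ⊥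
    card      : ∣ colored color ∣ ℕ.≤ k ℕ.* d

record HittingSet (f : Vec Bool n → Sign) (d : ℕ) : Set where
  field
    H    : Subset n
    card : ∣ H ∣ ℕ.≤ markovFactor d ℕ.* d
    hits : ∀ S → ∣ S ∣ ≡ d → Disjoint S H → coef (signℚ ∘ f) S ≡ 0ℚ

module _ (f : Vec Bool n → Sign) (d : ℕ) (1≤d : 1 ℕ.≤ d) (deg : DegreeBelow (suc d) (signℚ ∘ f)) where

  noBlocks : Blocks f d 0
  noBlocks = record
    { color     = replicate n nothing
    ; sensitive = λ ()
    ; card      = ℕP.≤-reflexive (uncolored n)
    }
    where
    uncolored : ∀ n → ∣ colored (replicate n (nothing {A = Fin 0})) ∣ ≡ 0
    uncolored zero    = refl
    uncolored (suc n) = uncolored n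

  blocks-bound : Blocks f d k → k ℕ.≤ markovFactor d
  blocks-bound blocks = sensitivity-bound (signℚ ∘ f ∘ expand color) (ℚ.- (ι 2 ℚ.* signℚ (f ⊥))) (∣2signℚ∣ (f ⊥))
    (λ y → ℚP.≤-reflexive (∣signℚ∣ (f (expand color y)))) (degreeBelow-expand color (signℚ ∘ f) deg)
    (λ i → trans (cong (λ x → signℚ (f (expand color ⁅ i ⁆)) ℚ.- signℚ (f x)) (expand-⊥ color)) (signℚ-≢ (sensitive i)))
    where open Blocks blocks

  -- A block found inside the monomial S inherits from S both its size bound and its disjointness
  -- from the older blocks.
  addBlock : (blocks : Blocks f d k) → ∀ S → ∣ S ∣ ≡ d → Disjoint S (colored (Blocks.color blocks)) →
    coef (signℚ ∘ f) S ≢ 0ℚ → Blocks f d (suc k)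
  addBlock {k} blocks S ∣S∣≡d D c≢0 with sensitive-block f S (subst (1 ℕ.≤_) (sym ∣S∣≡d) 1≤d) c≢0
  ... | B , B⊑S , fB≢f⊥ = record
    { color     = adjoin B color
    ; sensitive = λ where
        zero    → fB≢f⊥ ∘ trans (cong f (sym (expand-adjoin-zero B color)))
        (suc i) → sensitive i ∘ trans (cong f (sym (expand-adjoin-suc (⊑-disjoint B⊑S D) ⁅ i ⁆)))
    ; card      = ℕP.≤-trans (adjoin-card B color)
                    (ℕP.+-mono-≤ (ℕP.≤-trans (⊑-card B⊑S) (ℕP.≤-reflexive ∣S∣≡d)) card)
    }
    where open Blocks blocks

  private
    avoids? : ∀ (H S : Subset n) → Dec (∣ S ∣ ≡ d × Disjoint S H × coef (signℚ ∘ f) S ≢ 0ℚ)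
    avoids? H S = (∣ S ∣ ℕP.≟ d) ×-dec disjoint? S H ×-dec ¬? (coef (signℚ ∘ f) S ℚP.≟ 0ℚ)

    -- Greedy choice of blocks; the fuel allows one block more than `blocks-bound` does, so running
    -- out of it is a contradiction.
    search : ∀ fuel → k ℕ.+ fuel ≡ suc (markovFactor d) → Blocks f d k → HittingSet f d
    search {k} zero    e blocks = contradiction
      (ℕP.≤-trans (ℕP.≤-reflexive (trans (sym e) (ℕP.+-identityʳ k))) (blocks-bound blocks)) (ℕP.<-irrefl refl)
    search {k} (suc fuel) e blocks with anySubset? (avoids? (colored (Blocks.color blocks)))
    ... | yes (S , ∣S∣≡d , D , c≢0) = search fuel (trans (sym (ℕP.+-suc k fuel)) e) (addBlock blocks S ∣S∣≡d D c≢0)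
    ... | no none = record
      { H    = colored (Blocks.color blocks)
      ; card = ℕP.≤-trans (Blocks.card blocks) (ℕP.*-monoˡ-≤ d (blocks-bound blocks))
      ; hits = hits
      }
      where
      hits : ∀ S → ∣ S ∣ ≡ d → Disjoint S (colored (Blocks.color blocks)) → coef (signℚ ∘ f) S ≡ 0ℚ
      hits S ∣S∣≡d D with coef (signℚ ∘ f) S ℚP.≟ 0ℚ
      ... | yes c≡0 = c≡0
      ... | no c≢0  = contradiction (S , ∣S∣≡d , D , c≢0) none

  hittingSet : HittingSet f d
  hittingSet = search (suc (markovFactor d)) refl noBlocks

merge : Subset n → Vec Bool n → Vec Bool n → Vec Bool n
merge []      []      []      = []
merge (h ∷ H) (b ∷ v) (a ∷ x) = (if h then b else a) ∷ merge H v x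

-- Once the variables in H are fixed to v, the coefficient at S is 0 if S meets H, and otherwise the
-- sum of the coefficients at S ∪ T over those T below H on which v is 1.
coef-merge : ∀ (g : Vec Bool n → ℚ) H v S →
  (Disjoint S H → ∀ T → T ⊑ H → coef g (S ∪ T) ≡ 0ℚ) → coef (g ∘ merge H v) S ≡ 0ℚ
coef-merge g []          []          []            h = h [] [] []
coef-merge g (true ∷ H)  (b ∷ v)     (inside ∷ S)  h = coef-0 (λ x → ℚP.+-inverseʳ (g (b ∷ merge H v x))) S
coef-merge g (true ∷ H)  (false ∷ v) (outside ∷ S) h = coef-merge (lo g) H v S
  λ D T T⊑H → h (refl ∷ D) (outside ∷ T) (f≤t ∷ T⊑H)
coef-merge g (true ∷ H)  (true ∷ v)  (outside ∷ S) h = coef-merge (hi g) H v S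
  λ D T T⊑H → trans (coef-hi g (S ∪ T))
    (cong₂ ℚ._+_ (h (refl ∷ D) (outside ∷ T) (f≤t ∷ T⊑H)) (h (refl ∷ D) (inside ∷ T) (b≤b ∷ T⊑H)))
coef-merge g (false ∷ H) (b ∷ v)     (outside ∷ S) h = coef-merge (lo g) H v S
  λ D T T⊑H → h (refl ∷ D) (outside ∷ T) (b≤b ∷ T⊑H)
coef-merge g (false ∷ H) (b ∷ v)     (inside ∷ S)  h = coef-merge (∂ g) H v S
  λ D T T⊑H → h (refl ∷ D) (outside ∷ T) (b≤b ∷ T⊑H)

-- Adding T either pushes the monomial beyond size d or leaves S as it is; only size exactly d then
-- calls for the hitting property.
merge-degree : ∀ (g : Vec Bool n → ℚ) H v → DegreeBelow (suc d) g →
  (∀ S → ∣ S ∣ ≡ d → Disjoint S H → coef g S ≡ 0ℚ) → DegreeBelow d (g ∘ merge H v)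
merge-degree {d = d} g H v deg hits S d≤S = coef-merge g H v S vanish
  where
  vanish : Disjoint S H → ∀ T → T ⊑ H → coef g (S ∪ T) ≡ 0ℚ
  vanish D T T⊑H with disjoint-∪ D T⊑H | ℕP.m≤n⇒m<n∨m≡n d≤S
  ... | inj₂ S<S∪T | _         = deg (S ∪ T) (ℕP.≤-<-trans d≤S S<S∪T)
  ... | inj₁ e     | inj₁ d<S  = trans (cong (coef g) e) (deg S d<S)
  ... | inj₁ e     | inj₂ d≡S  = trans (cong (coef g) e) (hits S (sym d≡S) D)

-- Decision trees from hitting sets

data DecisionTree (n : ℕ) : Set where
  leaf  : Sign → DecisionTree n
  query : Fin n → (Bool → DecisionTree n) → DecisionTree n

decide : DecisionTree n → Vec Bool n → Sign
decide (leaf s)    x = s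
decide (query i t) x = decide (t (lookup x i)) x

queries : DecisionTree n → Vec Bool n → ℕ
queries (leaf s)    x = 0
queries (query i t) x = suc (queries (t (lookup x i)) x)

-- The map j locates the remaining coordinates in the whole input while H is consumed. Coordinates
-- outside H get the default `false`, which `merge` ignores.
queryAll : Subset m → (Fin m → Fin n) → (Vec Bool m → DecisionTree n) → DecisionTree n
queryAll []            j t = t []
queryAll (inside ∷ H)  j t = query (j zero) λ b → queryAll H (j ∘ suc) (t ∘ (b ∷_))
queryAll (outside ∷ H) j t = queryAll H (j ∘ suc) (t ∘ (false ∷_))

answers : Subset m → (Fin m → Fin n) → Vec Bool n → Vec Bool m
answers H j x = H ∩ Vec.tabulate (lookup x ∘ j)

decide-queryAll : ∀ H j (t : Vec Bool m → DecisionTree n) x → decide (queryAll H j t) x ≡ decide (t (answers H j x)) x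
decide-queryAll []            j t x = refl
decide-queryAll (inside ∷ H)  j t x = decide-queryAll H (j ∘ suc) (t ∘ (lookup x (j zero) ∷_)) x
decide-queryAll (outside ∷ H) j t x = decide-queryAll H (j ∘ suc) (t ∘ (false ∷_)) x

queries-queryAll : ∀ H j (t : Vec Bool m → DecisionTree n) x →
  queries (queryAll H j t) x ≡ ∣ H ∣ ℕ.+ queries (t (answers H j x)) x
queries-queryAll []            j t x = refl
queries-queryAll (inside ∷ H)  j t x = cong suc (queries-queryAll H (j ∘ suc) (t ∘ (lookup x (j zero) ∷_)) x)
queries-queryAll (outside ∷ H) j t x = queries-queryAll H (j ∘ suc) (t ∘ (false ∷_)) x

merge-∩ : ∀ H (x : Vec Bool n) → merge H (H ∩ x) x ≡ x
merge-∩ []          []      = refl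
merge-∩ (true ∷ H)  (b ∷ x) = cong (b ∷_) (merge-∩ H x)
merge-∩ (false ∷ H) (b ∷ x) = cong (b ∷_) (merge-∩ H x)

Decides : DecisionTree n → (Vec Bool n → Sign) → ℕ → Set
Decides t f m = (∀ x → decide t x ≡ f x) × (∀ x → queries t x ℕ.≤ m)

queryAll-decides : ∀ {f : Vec Bool n → Sign} H t → (∀ v → Decides (t v) (f ∘ merge H v) m) →
  Decides (queryAll H (λ i → i) t) f (∣ H ∣ ℕ.+ m)
queryAll-decides {m = m} {f} H t h =
  (λ x → trans (decide-queryAll H (λ i → i) t x) (trans (proj₁ (h (answers H (λ i → i) x)) x)
    (cong f (trans (cong (λ w → merge H (H ∩ w) x) (VecP.tabulate∘lookup x)) (merge-∩ H x))))) ,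
  (λ x → ℕP.≤-trans (ℕP.≤-reflexive (queries-queryAll H (λ i → i) t x))
    (ℕP.+-monoʳ-≤ ∣ H ∣ (proj₂ (h (answers H (λ i → i) x)) x)))

depthBound : ℕ → ℕ
depthBound zero    = 0
depthBound (suc d) = markovFactor (suc d) ℕ.* suc d ℕ.+ depthBound d

signℚ-injective : ∀ {s t} → signℚ s ≡ signℚ t → s ≡ t
signℚ-injective {Sign.+} {Sign.+} _ = refl
signℚ-injective {Sign.-} {Sign.-} _ = refl

-- Nisan and Smolensky: querying a set that hits all monomials of maximal
-- degree leaves a function of smaller degree.
decisionTree : ∀ d (f : Vec Bool n → Sign) → DegreeBelow (suc d) (signℚ ∘ f) → ∃ λ t → Decides t f (depthBound d)
decisionTree zero    f deg = leaf (f ⊥) , (λ x → sym (signℚ-injective (degreeBelow-1 (signℚ ∘ f) deg x))) , λ _ → z≤n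
decisionTree (suc d) f deg = queryAll H (λ i → i) (proj₁ ∘ sub) , proj₁ all ,
  λ x → ℕP.≤-trans (proj₂ all x) (ℕP.+-monoˡ-≤ (depthBound d) card)
  where
  open HittingSet (hittingSet f (suc d) (s≤s z≤n) deg)
  sub : ∀ v → ∃ λ t → Decides t (f ∘ merge H v) (depthBound d)
  sub v = decisionTree d (f ∘ merge H v) (merge-degree (signℚ ∘ f) H v deg hits)
  all : Decides (queryAll H (λ i → i) (proj₁ ∘ sub)) f (∣ H ∣ ℕ.+ depthBound d)
  all = queryAll-decides H (proj₁ ∘ sub) (proj₂ ∘ sub)

-- Simulation of a decision tree by a protocol

combine : Bool → Bool → Bool → Bool
combine b = if b then _∨_ else _∧_

simulate : Bool → DecisionTree n → Protocol (Vec Bool n × Bool) (Vec Bool n) Sign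
simulate b (leaf s)    = output s
simulate b (query i t) = alice (λ u → lookup (proj₁ u) i) λ a →
  bob (λ y → lookup y i) λ c → simulate b (t (combine b a c))

run-simulate : ∀ b (t : DecisionTree n) u y → run (simulate b t) u y ≡ decide t (zipWith (combine b) (proj₁ u) y)
run-simulate b (leaf s)    u y = refl
run-simulate b (query i t) u y = trans
  (run-simulate b (t (combine b (lookup (proj₁ u) i) (lookup y i))) u y)
  (cong (λ a → decide (t a) (zipWith (combine b) (proj₁ u) y)) (sym (VecP.lookup-zipWith (combine b) i (proj₁ u) y)))

bits-simulate : ∀ b (t : DecisionTree n) u y →
  bits (simulate b t) u y ≡ double (queries t (zipWith (combine b) (proj₁ u) y))
bits-simulate b (leaf s)    u y = refl
bits-simulate b (query i t) u y = cong (2 ℕ.+_) (trans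
  (bits-simulate b (t (combine b (lookup (proj₁ u) i) (lookup y i))) u y)
  (cong (λ a → double (queries (t a) (zipWith (combine b) (proj₁ u) y)))
    (sym (VecP.lookup-zipWith (combine b) i (proj₁ u) y))))

double-mono : ∀ {a b} → a ℕ.≤ b → double a ℕ.≤ double b
double-mono z≤n     = z≤n
double-mono (s≤s h) = s≤s (s≤s (double-mono h))

-- One bit announces b, and each query costs one bit of Alice and one of Bob.
protocolCost : ℕ → ℕ
protocolCost d = suc (double (depthBound d))

problem-computable : ∀ d (f : Vec Bool n → Sign) → DegreeBelow (suc d) (signℚ ∘ f) →
  ComputableWithin (problem f) (protocolCost d)
problem-computable d f deg with decisionTree d f deg
... | t , correct , depth = alice proj₂ (λ b → simulate b t) ,
  (λ where
    u@(x , false) y → trans (run-simulate false t u y) (correct _)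
    u@(x , true)  y → trans (run-simulate true t u y) (correct _)) ,
  (λ u y → s≤s (ℕP.≤-trans (ℕP.≤-reflexive (bits-simulate (proj₂ u) t u y)) (double-mono (depth _))))

-- The communication bound is given no degree, so one is found by descending from a known bound;
-- coefficients can be tested for zero, and the descent stops before 0 because f is not the zero
-- function.
degree-exists : ∀ (f : Vec Bool n → Sign) e → DegreeBelow e (signℚ ∘ f) →
  ∃ λ S → coef (signℚ ∘ f) S ≢ 0ℚ × DegreeBelow (suc ∣ S ∣) (signℚ ∘ f)
degree-exists f zero    deg = contradiction (degreeBelow-0 (signℚ ∘ f) deg ⊥) (signℚ≢0 (f ⊥))
degree-exists f (suc e) deg with anySubset? (λ S → (∣ S ∣ ℕP.≟ e) ×-dec ¬? (coef (signℚ ∘ f) S ℚP.≟ 0ℚ))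
... | yes (S , refl , c≢0) = S , c≢0 , deg
... | no none = degree-exists f e below
  where
  below : DegreeBelow e (signℚ ∘ f)
  below S e≤S with ℕP.m≤n⇒m<n∨m≡n e≤S | coef (signℚ ∘ f) S ℚP.≟ 0ℚ
  ... | inj₁ e<S | _       = deg S e<S
  ... | inj₂ e≡S | yes c≡0 = c≡0
  ... | inj₂ e≡S | no c≢0  = contradiction (S , sym e≡S , c≢0) none

-- From 2^d ≤ r² the integer bound 2^e ≤ r follows with e = ⌊d/2⌋, without a square root.
half : ∀ d → ∃ λ e → double e ℕ.≤ d × d ℕ.≤ suc (double e)
half zero          = 0 , z≤n , z≤n
half (suc zero)    = 0 , z≤n , s≤s z≤n
half (suc (suc d)) with half d
... | e , p , q = suc e , s≤s (s≤s p) , s≤s (s≤s q)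

-- Cost estimates and the logarithm of the rank

depthBound-mono : ∀ {a b} → a ℕ.≤ b → depthBound a ℕ.≤ depthBound b
depthBound-mono z≤n             = z≤n
depthBound-mono {suc a} {suc b} (s≤s h) = ℕP.+-mono-≤
  (ℕP.*-mono-≤ (ℕP.*-mono-≤ (s≤s (double-mono (s≤s h))) (ℕP.*-mono-≤ (s≤s h) (s≤s h))) (s≤s h))
  (depthBound-mono h)

depthBound≤ : ∀ d → depthBound d ℕ.≤ d ℕ.* (markovFactor d ℕ.* d)
depthBound≤ zero    = z≤n
depthBound≤ (suc d) = ℕP.+-monoʳ-≤ (markovFactor (suc d) ℕ.* suc d) (ℕP.≤-trans (depthBound≤ d)
  (ℕP.*-monoʳ-≤ d (ℕP.*-mono-≤ (ℕP.*-mono-≤ (s≤s (double-mono (ℕP.n≤1+n d)))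
    (ℕP.*-mono-≤ (ℕP.n≤1+n d) (ℕP.n≤1+n d))) (ℕP.n≤1+n d))))

1+2a≤3a : ∀ a → 1 ℕ.≤ a → suc (double a) ℕ.≤ 3 ℕ.* a
1+2a≤3a a 1≤a = ℕP.≤-trans (ℕP.+-mono-≤ 1≤a (ℕP.≤-reflexive (double≡+ a))) (ℕP.≤-reflexive (lem a))
  where
  lem : ∀ a → a ℕ.+ (a ℕ.+ a) ≡ 3 ℕ.* a
  lem = solve-∀

-- The depth is a sum of d terms, each at most (2d + 1) d³ ≤ 3 d⁴; it is doubled, and the one extra
-- bit is at most d⁵.
protocolCost≤ : ∀ d → 1 ℕ.≤ d → protocolCost d ℕ.≤ 7 ℕ.* d ℕ.^ 5
protocolCost≤ d 1≤d = begin
  suc (double (depthBound d))               ≤⟨ s≤s (double-mono (ℕP.≤-trans (depthBound≤ d) poly)) ⟩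
  suc (double (3 ℕ.* d ℕ.^ 5))              ≡⟨ cong suc (double≡+ (3 ℕ.* d ℕ.^ 5)) ⟩
  suc (3 ℕ.* d ℕ.^ 5 ℕ.+ 3 ℕ.* d ℕ.^ 5)     ≤⟨ ℕP.+-monoˡ-≤ (3 ℕ.* d ℕ.^ 5 ℕ.+ 3 ℕ.* d ℕ.^ 5) (1≤d⁵ 1≤d) ⟩
  d ℕ.^ 5 ℕ.+ (3 ℕ.* d ℕ.^ 5 ℕ.+ 3 ℕ.* d ℕ.^ 5) ≡⟨ lem₁ (d ℕ.^ 5) ⟩
  7 ℕ.* d ℕ.^ 5                             ∎
  where
  open ℕP.≤-Reasoning
  lem₁ : ∀ a → a ℕ.+ (3 ℕ.* a ℕ.+ 3 ℕ.* a) ≡ 7 ℕ.* a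
  lem₁ = solve-∀
  lem₂ : ∀ d → d ℕ.* (3 ℕ.* d ℕ.* (d ℕ.* d) ℕ.* d) ≡ 3 ℕ.* (d ℕ.* (d ℕ.* (d ℕ.* (d ℕ.* (d ℕ.* 1)))))
  lem₂ = solve-∀
  1≤d⁵ : 1 ℕ.≤ d → 1 ℕ.≤ d ℕ.^ 5
  1≤d⁵ = ℕP.^-monoˡ-≤ 5
  poly : d ℕ.* (markovFactor d ℕ.* d) ℕ.≤ 3 ℕ.* d ℕ.^ 5
  poly = ℕP.≤-trans
    (ℕP.*-monoʳ-≤ d (ℕP.*-monoˡ-≤ d (ℕP.*-monoˡ-≤ (d ℕ.* d) (1+2a≤3a d 1≤d))))
    (ℕP.≤-reflexive (lem₂ d))

-- 465 = protocolCost 3 is what the case e = 1 asks for.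
protocolCost≤^ : ∀ c e → 465 ℕ.≤ c → protocolCost (suc (double e)) ℕ.≤ e ℕ.^ c ℕ.+ c
protocolCost≤^ c zero             465≤c = ℕP.≤-trans (ℕP.≤ᵇ⇒≤ 7 465 _) (ℕP.≤-trans 465≤c (ℕP.m≤n+m c (0 ℕ.^ c)))
protocolCost≤^ c (suc zero)       465≤c = ℕP.≤-trans 465≤c (ℕP.m≤n+m c (1 ℕ.^ c))
protocolCost≤^ c e@(suc (suc _)) 465≤c = ℕP.≤-trans (large e (s≤s (s≤s z≤n))) (ℕP.m≤m+n (e ℕ.^ c) c)
  where
  open ℕP.≤-Reasoning
  lem : ∀ e → 7 ℕ.* (3 ℕ.* e ℕ.* (3 ℕ.* e ℕ.* (3 ℕ.* e ℕ.* (3 ℕ.* e ℕ.* (3 ℕ.* e ℕ.* 1))))) ≡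
    1701 ℕ.* (e ℕ.* (e ℕ.* (e ℕ.* (e ℕ.* (e ℕ.* 1)))))
  lem = solve-∀
  large : ∀ e → 2 ℕ.≤ e → protocolCost (suc (double e)) ℕ.≤ e ℕ.^ c
  large e 2≤e = begin
    protocolCost (suc (double e))      ≤⟨ protocolCost≤ (suc (double e)) (s≤s z≤n) ⟩
    7 ℕ.* suc (double e) ℕ.^ 5         ≤⟨ ℕP.*-monoʳ-≤ 7 (ℕP.^-monoˡ-≤ 5 (1+2a≤3a e (ℕP.<⇒≤ 2≤e))) ⟩
    7 ℕ.* (3 ℕ.* e) ℕ.^ 5              ≡⟨ lem e ⟩
    -- The constant 1701 = 7 · 3⁵ is at most 2¹¹ ≤ e¹¹, so the exponent can absorb it.
    1701 ℕ.* e ℕ.^ 5                   ≤⟨ ℕP.*-monoˡ-≤ (e ℕ.^ 5) (ℕP.≤-trans (ℕP.≤ᵇ⇒≤ 1701 2048 _) (ℕP.^-monoˡ-≤ 11 2≤e)) ⟩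
    e ℕ.^ 11 ℕ.* e ℕ.^ 5               ≡⟨ sym (ℕP.^-distribˡ-+-* e 11 5) ⟩
    e ℕ.^ 16                           ≤⟨ ℕP.^-monoʳ-≤ e {{ℕ.>-nonZero (ℕP.<⇒≤ 2≤e)}} (ℕP.≤-trans (ℕP.≤ᵇ⇒≤ 16 465 _) 465≤c) ⟩
    e ℕ.^ c                            ∎

2^double : ∀ e → 2 ℕ.^ double e ≡ 2 ℕ.^ e ℕ.* 2 ℕ.^ e
2^double e = trans (cong (2 ℕ.^_) (double≡+ e)) (ℕP.^-distribˡ-+-* 2 e e)

-- Not only the limit but every approximation is at least e, since the floor is exact at powers of
-- two.
log₂-lower : ∀ r e m → 2 ℕ.^ e ℕ.≤ r → ι e ℚ.≤ seq (log₂ r) m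
log₂-lower r e m 2^e≤r = /-mono e ⌊log₂ r ℕ.^ suc m ⌋ 0 m (begin
  e ℕ.* suc m                       ≡⟨ sym (⌊log₂[2^n]⌋≡n (e ℕ.* suc m)) ⟩
  ⌊log₂ 2 ℕ.^ (e ℕ.* suc m) ⌋       ≡⟨ cong ⌊log₂_⌋ (sym (ℕP.^-*-assoc 2 e (suc m))) ⟩
  ⌊log₂ (2 ℕ.^ e) ℕ.^ suc m ⌋       ≤⟨ ⌊log₂⌋-mono-≤ (ℕP.^-monoˡ-≤ (suc m) 2^e≤r) ⟩
  ⌊log₂ r ℕ.^ suc m ⌋               ≡⟨ sym (ℕP.*-identityʳ _) ⟩
  ⌊log₂ r ℕ.^ suc m ⌋ ℕ.* 1         ∎)
  where open ℕP.≤-Reasoning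

≤-log₂-power : ∀ c {r e D} → 2 ℕ.^ e ℕ.≤ r → D ℕ.≤ e ℕ.^ c ℕ.+ c → fromℕ D ≤ log₂ r ^ c + fromℕ c
≤-log₂-power c {r} {e} {D} 2^e≤r D≤ = ≤-eventually (fromℕ D) (log₂ r ^ c + fromℕ c) (0 , λ m _ → begin
  ι D                               ≤⟨ ι-mono D≤ ⟩
  ι (e ℕ.^ c ℕ.+ c)                 ≡⟨ trans (ι-+ (e ℕ.^ c) c) (cong (ℚ._+ ι c) (ι-^ e c)) ⟩
  ι e ^ℚ c ℚ.+ ι c                  ≤⟨ ℚP.+-monoˡ-≤ (ι c) (^ℚ-mono-≤ c (ι-nonNeg e) (log₂-lower r e m 2^e≤r)) ⟩
  seq (log₂ r) m ^ℚ c ℚ.+ ι c       ≡⟨ cong (ℚ._+ ι c) (sym (seq-^ (log₂ r) c m)) ⟩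
  seq (log₂ r ^ c) m ℚ.+ ι c        ∎)
  where open ℚP.≤-Reasoning

square-cancel-ℕ : ∀ a b → a ℕ.* a ℕ.≤ b ℕ.* b → a ℕ.≤ b
square-cancel-ℕ a b h = ℕP.≮⇒≥ λ b<a → ℕP.<⇒≱ (ℕP.*-mono-< b<a b<a) h

communication-bound : ∀ (f : Vec Bool n → Sign) {r D} →
  IsRank (problemMatrix f) r → IsCommunicationComplexity (problem f) D →
  ∃ λ e → 2 ℕ.^ e ℕ.≤ r × D ℕ.≤ protocolCost (suc (double e))
-- No subset has more than n elements, so the search for the degree can start at n + 1.
communication-bound {n} f {r} {D} R I = go (degree-exists f (suc n) λ S n<S → contradiction (∣p∣≤n S) (ℕP.<⇒≱ n<S))
  where
  -- Fixing Alice's bit b selects the rows of the AND matrix or those of the OR matrix inside the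
  -- matrix of F.
  maximal : ∀ b k (ρ : Fin k → Vec Bool n) → LinearlyIndependent (λ i → problemMatrix f (ρ i , b)) → k ℕ.≤ r
  maximal b k ρ = IsRank.maximal R k (λ i → ρ i , b)
  go : (∃ λ S → coef (signℚ ∘ f) S ≢ 0ℚ × DegreeBelow (suc ∣ S ∣) (signℚ ∘ f)) →
    ∃ λ e → 2 ℕ.^ e ℕ.≤ r × D ℕ.≤ protocolCost (suc (double e))
  go (S , c≢0 , deg) with half ∣ S ∣
  ... | e , 2e≤d , d≤2e+1 = e ,
    square-cancel-ℕ (2 ℕ.^ e) r (ℕP.≤-trans (ℕP.≤-reflexive (sym (2^double e)))
      (ℕP.≤-trans (ℕP.^-monoʳ-≤ 2 2e≤d) (rank-product f S c≢0 (maximal false) (maximal true)))) ,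
    ℕP.≤-trans (IsCommunicationComplexity.least I _ (problem-computable ∣ S ∣ f deg))
      (s≤s (double-mono (depthBound-mono d≤2e+1)))

theorem6p4 : (∀ (n : ℕ) → 1 ℕ.≤ n → (f : Vec Bool n → Sign) →
    ∀ (d r₁ r₂ : ℕ) →
    IsDegree (λ x → signℝ (f x)) d →
    IsRank (andMatrix f) r₁ →
    IsRank (orMatrix f) r₂ →
    (fromℕ (r₁ ℕ.⊔ r₂) ≥ 3/2√2 ^ d) × (3/2√2 ^ d ≥ 1·06 ^ d))
    ×
    (∃ λ (c : ℕ) → (1 ℕ.≤ c) ×
    (∀ (n : ℕ) → 1 ℕ.≤ n → (f : Vec Bool n → Sign) →
    ∀ (r D : ℕ) →
    IsRank (problemMatrix f) r →
    IsCommunicationComplexity (problem f) D →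
    fromℕ D ≤ log₂ r ^ c + fromℕ c))
theorem6p4 =
  (λ n _ f d r₁ r₂ deg R₁ R₂ → rank-bound deg R₁ R₂ , 1·06^d≤3/2√2^d d) ,
  465 , s≤s z≤n ,
  λ n _ f r D R I → let e , 2^e≤r , D≤ = communication-bound f R I in
    ≤-log₂-power 465 {r} {e} {D} 2^e≤r (ℕP.≤-trans D≤ (protocolCost≤^ 465 e ℕP.≤-refl))
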